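{- Let \[ A_n:=27^n\,[z^n]\,{}_2F_1\!\left(\tfrac13,\tfrac13;1;z\right)^3\qquad(n\ge0). \] For every prime $p\ge5$ and every integer $m\ge1$, \[ A_{pm}\equiv A_m\pmod{p^4}. \]
   Context: ${}_2F_1$ denotes the Gauss hypergeometric function and $[z^n]$ extracts the coefficient of $z^n$ in a power series. The numbers $A_n$ are integers (the sequence begins $1,9,135,2439,\dots$). -}

module Defs where

open import Data.Nat as ℕ using (ℕ; zero; suc; NonZero; _!; _∸_)
open import Data.Nat.Properties as ℕP using (m*n≢0; _!≢0)
open import Data.Integer as ℤ using (ℤ; +_)
open import Data.Rational as ℚ using (ℚ; 0ℚ; 1ℚ; _/_)

ℕtoℚ : ℕ → ℚ
ℕtoℚ n = + n / 1

rising : ℚ → ℕ → ℚ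
rising a zero    = 1ℚ
rising a (suc k) = rising a k ℚ.* (a ℚ.+ ℕtoℚ k)

risingℕ : ℕ → ℕ → ℕ
risingℕ c zero    = 1
risingℕ c (suc k) = risingℕ c k ℕ.* (c ℕ.+ k)

risingℕ-nonZero : ∀ c .{{_ : NonZero c}} k → NonZero (risingℕ c k)
risingℕ-nonZero c zero    = _
risingℕ-nonZero (suc c) (suc k) =
  m*n≢0 (risingℕ (suc c) k) (suc c ℕ.+ k) {{risingℕ-nonZero (suc c) k}}

hyp2F1Coeff : ℚ → ℚ → (c : ℕ) → .{{NonZero c}} → ℕ → ℚ
hyp2F1Coeff a b c k =
  rising a k ℚ.* rising b k ℚ.*
    (_/_ (+ 1) (risingℕ c k ℕ.* k !)
       {{m*n≢0 (risingℕ c k) (k !) {{risingℕ-nonZero c k}} {{k !≢0}}}})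

sumUpTo : ℕ → (ℕ → ℚ) → ℚ
sumUpTo zero    f = f 0
sumUpTo (suc n) f = sumUpTo n f ℚ.+ f (suc n)

cauchy : (ℕ → ℚ) → (ℕ → ℚ) → ℕ → ℚ
cauchy f g n = sumUpTo n (λ i → f i ℚ.* g (n ∸ i))

F : ℕ → ℚ
F = hyp2F1Coeff (+ 1 / 3) (+ 1 / 3) 1

Fcube : ℕ → ℚ
Fcube = cauchy F (cauchy F F)

A : ℕ → ℚ
A n = ℕtoℚ (27 ℕ.^ n) ℚ.* Fcube n

{-# OPTIONS --safe #-}
module Submission where

-- Let f = Σ 3ⁿ (∏_{i<n} (3 i + 1) / n!)² tⁿ, so that F = f³ has the coefficients A_n, and let a_m = A_{pm}.
-- Three facts are combined.
--
-- (1) Split the exponents of f (or, for p ≡ 2 mod 3, of the series with 3 i + 2, related to f by Euler's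
--     transformation) by residue modulo p.  The section of residue r is f times a p-adically slowly varying
--     factor for r ≤ n₀ = ⌊p / 3⌋, and p² (3 ϑ + 1)² f times such a factor otherwise.  A reflection and a
--     triplication formula for (x + 1) ⋯ (x + p − 1) control the first factor modulo p⁴, and cubing gives
--       a_m ≡ A_m + p² (c₀ β₁ + p c₁ ϑβ₁ + c₂ β₂)_{m−1}  mod p⁴
--     with unknown constants c₀, c₁, c₂ and explicit integer sequences β₁, β₂.
--
-- (2) A satisfies the second-order recurrence
--       (n + 1)⁴ A_{n+1} + 729 n⁴ A_{n−1} = P(n) A_n,  P = 54 y² + 48 y + 9,  y = n (n + 1).
--     Iterating it p times yields a recurrence for a_m modulo p⁸ whose middle coefficient, being a continuant
--     invariant under m ↦ −1 − m, is a cubic polynomial in y with unknown coefficients.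
--
-- (3) Substituting (1) in (2) for m = 0, …, 11 gives linear equations modulo p⁸ for the eleven unknowns.
--     Modulo p² their matrix is an explicit integer matrix with a left inverse up to 2¹⁰ 3⁸ 5 7.  Hence for
--     p ≥ 11 all unknowns vanish, to the order that forces a_m ≡ A_m mod p⁴; for p = 5 and 7 the three
--     constants are found from a_1, a_2, a_3.

open import Algebra.Bundles using (CommutativeRing; RawRing)
open import Algebra.Structures using (IsCommutativeRing)
import Algebra.Solver.Ring as RingSolver
open import Algebra.Solver.Ring.AlmostCommutativeRing
  using (AlmostCommutativeRing; fromCommutativeRing; _-Raw-AlmostCommutative⟶_)
import Defs
open import Data.Integer as ℤ using (ℤ; +_; -[1+_]; ∣_∣)
import Data.Integer.Divisibility.Signed as ℤD
import Data.Integer.Properties as ℤP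
open import Data.List using (List; []; _∷_)
open import Data.List.Relation.Unary.All using (_∷_)
open import Data.Maybe using (Maybe; just; nothing)
open import Data.Nat as ℕ using (ℕ; zero; suc; NonZero; _!)
open import Data.Nat.Coprimality using (recompute)
open import Data.Nat.Divisibility
  using (_∣_; _∤_; _∣?_; _∣0; divides; ∣-trans; ∣⇒≤; ∣m+n∣m⇒∣n; m∣m*n; n∣m*n)
import Data.Nat.DivMod as ℕD
open import Data.Nat.Primality
  using (Prime; prime?; prime⇒irreducible; prime⇒nonTrivial; euclidsLemma; ¬prime[1])
open import Data.Nat.Primality.Factorisation using (factorise; PrimeFactorisation)
import Data.Nat.Properties as ℕP
open import Data.Nat.Solver using (module +-*-Solver)
open import Data.Product using (_,_; proj₁; proj₂; _×_; ∃-syntax)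
open import Data.Rational as ℚ using (ℚ; 0ℚ; 1ℚ; mkℚ; _/_; toℚᵘ)
import Data.Rational.Properties as ℚP
open import Data.Rational.Unnormalised as ℚᵘ using (mkℚᵘ; *≡*; _≃_)
import Data.Rational.Unnormalised.Properties as ℚᵘP
open import Data.Sum using (_⊎_; inj₁; inj₂; [_,_]′)
open import Relation.Binary.PropositionalEquality
  using (_≡_; _≢_; refl; sym; trans; cong; cong₂; subst; subst₂)
open import Relation.Nullary using (Dec; yes; no; ¬_; contradiction)
open import Relation.Nullary.Decidable using (from-yes; from-no)

-- The constants in (1) are sums over residue classes that are never evaluated; for p ≥ 11 it is (2)
-- that makes them vanish to the order needed. p⁴ times the recurrence of A is itself of the shape
-- found for a_m, so after subtraction the system in (3) is homogeneous, and its matrix is known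
-- modulo p² because (1) already gives a_m ≡ A_m modulo p². The modulus p⁸ fits: the leading
-- coefficient is p⁴ (m + 1)⁴ and the errors have size p², so the constants enter with p⁶ and are
-- found modulo p². The shape in (1) depends on a cancellation. Coefficient m p of the split series
-- is coefficient m of f times G(m) = 1 + p² (a m² + b m³) modulo p⁴, without a term in m. Hence G
-- contributes only ϑ²f and ϑ³f, and the differential equation ϑ²f = 3 t (3 ϑ + 1)² f turns these
-- into t times the series that the high residues produce anyway; a term in ϑf would not fit.
-- Reflection and triplication serve to prove this cancellation. The series with 3 i + 2 is used for
-- p ≡ 2 mod 3 because then its coefficients at multiples of p, rather than those of f, are modelled
-- on f.

-- An abstract copy of ℚ; over ℚ itself the terms would be normalised.
record Ground : Set₁ where
  infixl 6 _+_
  infixl 7 _*_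
  infix  8 -_
  field
    K       : Set
    _+_ _*_ : K → K → K
    -_      : K → K
    0# 1#   : K
    isCR    : IsCommutativeRing _≡_ _+_ _*_ -_ 0# 1#
    ι       : ℤ → K
    ι-+     : ∀ i j → ι (i ℤ.+ j) ≡ ι i + ι j
    ι-*     : ∀ i j → ι (i ℤ.* j) ≡ ι i * ι j
    ι-neg   : ∀ i → ι (ℤ.- i) ≡ - ι i
    ι-0     : ι (+ 0) ≡ 0#
    ι-1     : ι (+ 1) ≡ 1#
    inv     : ℤ → K
    ι-inv   : ∀ i → i ≢ + 0 → ι i * inv i ≡ 1#

-- Abstract scalars and a ring solver with integer constants.

module Scalars (𝔾 : Ground) where
  open Ground 𝔾 public

  commutativeRing : CommutativeRing _ _
  commutativeRing = record { isCommutativeRing = isCR }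

  open CommutativeRing commutativeRing public
    using (+-assoc; +-comm; +-identityˡ; +-identityʳ; *-assoc; *-comm;
           *-identityˡ; *-identityʳ; zeroˡ; zeroʳ; distribˡ; distribʳ;
           -‿inverseˡ; -‿inverseʳ; +-congˡ; +-congʳ; *-congˡ; *-congʳ)

  private
    ℤ-raw : RawRing _ _
    ℤ-raw = CommutativeRing.rawRing ℤP.+-*-commutativeRing

    acr : AlmostCommutativeRing _ _
    acr = fromCommutativeRing commutativeRing

    morphism : ℤ-raw -Raw-AlmostCommutative⟶ acr
    morphism = record
      { ⟦_⟧    = ι
      ; +-homo = ι-+
      ; *-homo = ι-*
      ; -‿homo = ι-neg
      ; 0-homo = ι-0
      ; 1-homo = ι-1
      }

    decide : ∀ i j → Maybe (ι i ≡ ι j)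
    decide i j with i ℤ.≟ j
    ... | yes eq = just (cong ι eq)
    ... | no _   = nothing

  module Solver = RingSolver ℤ-raw acr morphism decide

-- Formal power series and the derivation `ϑ`.

module Series (𝔾 : Ground) where
  open Scalars 𝔾
  open Solver using (solve; _:=_; _:+_; _:*_)

  S : Set
  S = ℕ → K

  infix 4 _≗_
  _≗_ : S → S → Set
  u ≗ v = ∀ n → u n ≡ v n

  tail : S → S
  tail u n = u (suc n)

  infixl 6 _⊕_
  infixl 7 _⊛_
  infix  8 ⊖_

  _⊕_ : S → S → S
  (u ⊕ v) n = u n + v n

  ⊖_ : S → S
  (⊖ u) n = - u n

  -- The Cauchy product, by peeling the constant term off the left factor: identities then follow by
  -- induction along `tail`, without manipulating sums.
  _⊛_ : S → S → S
  (u ⊛ v) zero    = u 0 * v 0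
  (u ⊛ v) (suc n) = u 0 * v (suc n) + (tail u ⊛ v) n

  const : K → S
  const x zero    = x
  const x (suc _) = 0#

  ⊛-cong : ∀ {u u′ v v′} → u ≗ u′ → v ≗ v′ → u ⊛ v ≗ u′ ⊛ v′
  ⊛-cong e d zero    = cong₂ _*_ (e 0) (d 0)
  ⊛-cong e d (suc n) =
    cong₂ _+_ (cong₂ _*_ (e 0) (d (suc n))) (⊛-cong (λ i → e (suc i)) d n)

  ⊛-distribʳ : ∀ w u v → (u ⊕ v) ⊛ w ≗ (u ⊛ w) ⊕ (v ⊛ w)
  ⊛-distribʳ w u v zero    = distribʳ _ _ _
  ⊛-distribʳ w u v (suc n) = trans
    (cong (_+_ ((u 0 + v 0) * w (suc n))) (⊛-distribʳ w (tail u) (tail v) n))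
    (solve 5 (λ a b c x y → (a :+ b) :* c :+ (x :+ y) := (a :* c :+ x) :+ (b :* c :+ y))
           refl (u 0) (v 0) (w (suc n)) ((tail u ⊛ w) n) ((tail v ⊛ w) n))

  ⊛-scaleˡ : ∀ x u v → (λ n → x * u n) ⊛ v ≗ (λ n → x * (u ⊛ v) n)
  ⊛-scaleˡ x u v zero    = *-assoc _ _ _
  ⊛-scaleˡ x u v (suc n) = trans
    (cong (_+_ (x * u 0 * v (suc n))) (⊛-scaleˡ x (tail u) v n))
    (solve 4 (λ a b c y → a :* b :* c :+ a :* y := a :* (b :* c :+ y))
           refl x (u 0) (v (suc n)) ((tail u ⊛ v) n))

  -- The definition recurses on the left factor; this is the same recursion on the right factor.
  -- Played against each other, the two give commutativity.
  ⊛-tailʳ : ∀ u v n → (u ⊛ v) (suc n) ≡ u (suc n) * v 0 + (u ⊛ tail v) n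
  ⊛-tailʳ u v zero    = +-comm _ _
  ⊛-tailʳ u v (suc n) = trans
    (cong (_+_ (u 0 * v (suc (suc n)))) (⊛-tailʳ (tail u) v n))
    (solve 3 (λ a b c → a :+ (b :+ c) := b :+ (a :+ c)) refl _ _ _)

  ⊛-comm : ∀ u v → u ⊛ v ≗ v ⊛ u
  ⊛-comm u v zero    = *-comm _ _
  ⊛-comm u v (suc n) = trans
    (cong₂ _+_ (*-comm _ _) (⊛-comm (tail u) v n))
    (sym (⊛-tailʳ v u n))

  ⊛-assoc : ∀ u v w → (u ⊛ v) ⊛ w ≗ u ⊛ (v ⊛ w)
  ⊛-assoc u v w zero    = *-assoc _ _ _
  ⊛-assoc u v w (suc n) = trans
    (cong (_+_ (u 0 * v 0 * w (suc n))) (trans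
      (⊛-distribʳ w (λ i → u 0 * v (suc i)) (tail u ⊛ v) n)
      (cong₂ _+_ (⊛-scaleˡ (u 0) (tail v) w n) (⊛-assoc (tail u) v w n))))
    (solve 5 (λ a b c x y → a :* b :* c :+ (a :* x :+ y) := a :* (b :* c :+ x) :+ y)
           refl (u 0) (v 0) (w (suc n)) ((tail v ⊛ w) n) ((tail u ⊛ (v ⊛ w)) n))

  ⊛-zeroˡ : ∀ u v → u ≗ const 0# → u ⊛ v ≗ const 0#
  ⊛-zeroˡ u v e zero    = trans (cong (_* v 0) (e 0)) (zeroˡ _)
  ⊛-zeroˡ u v e (suc n) = trans
    (cong₂ _+_ (trans (cong (_* v (suc n)) (e 0)) (zeroˡ _))
               (trans (⊛-zeroˡ (tail u) v (λ { zero → e 1 ; (suc i) → e (suc (suc i)) }) n)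
                      (const0 n)))
    (+-identityˡ _)
    where
    const0 : ∀ n → const 0# n ≡ 0#
    const0 zero    = refl
    const0 (suc _) = refl

  const-⊛ : ∀ x u → const x ⊛ u ≗ (λ n → x * u n)
  const-⊛ x u zero    = refl
  const-⊛ x u (suc n) = trans
    (cong (_+_ (x * u (suc n))) (trans (⊛-zeroˡ (λ _ → 0#) u c0 n) (d0 n)))
    (+-identityʳ _)
    where
    c0 : (λ _ → 0#) ≗ const 0#
    c0 zero    = refl
    c0 (suc _) = refl
    d0 : ∀ n → const 0# n ≡ 0#
    d0 zero    = refl
    d0 (suc _) = refl

  ⊛-identityˡ : ∀ u → const 1# ⊛ u ≗ u
  ⊛-identityˡ u n = trans (const-⊛ 1# u n) (*-identityˡ _)

  -- The derivation t d/dt.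
  ϑ : S → S
  ϑ u n = ι (+ n) * u n

  shift : S → S
  shift u zero    = 0#
  shift u (suc n) = u n

  const-0 : ∀ n → const 0# n ≡ 0#
  const-0 zero    = refl
  const-0 (suc _) = refl

  const-+ : ∀ x y → const (x + y) ≗ const x ⊕ const y
  const-+ x y zero    = refl
  const-+ x y (suc n) = sym (+-identityˡ _)

  const-* : ∀ x y → const (x * y) ≗ const x ⊛ const y
  const-* x y zero    = refl
  const-* x y (suc n) = sym (trans (const-⊛ x (const y) (suc n)) (zeroʳ x))

  -0#≡0# : - 0# ≡ 0#
  -0#≡0# = trans (sym (+-identityˡ _)) (-‿inverseʳ 0#)

  seriesRing : CommutativeRing _ _
  seriesRing = record
    { Carrier = S ; _≈_ = _≗_ ; _+_ = _⊕_ ; _*_ = _⊛_ ; -_ = ⊖_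
    ; 0# = const 0# ; 1# = const 1#
    ; isCommutativeRing = record
      { isRing = record
        { +-isAbelianGroup = record
          { isGroup = record
            { isMonoid = record
              { isSemigroup = record
                { isMagma = record
                  { isEquivalence = record
                    { refl = λ _ → refl ; sym = λ e n → sym (e n)
                    ; trans = λ e d n → trans (e n) (d n) }
                  ; ∙-cong = λ e d n → cong₂ _+_ (e n) (d n) }
                ; assoc = λ u v w n → +-assoc _ _ _ }
              ; identity =
                  (λ u n → trans (cong (_+ u n) (const-0 n)) (+-identityˡ _)) ,
                  (λ u n → trans (cong (_+_ (u n)) (const-0 n)) (+-identityʳ _)) }
            ; inverse =
                (λ u n → trans (-‿inverseˡ _) (sym (const-0 n))) ,
                (λ u n → trans (-‿inverseʳ _) (sym (const-0 n)))
            ; ⁻¹-cong = λ e n → cong -_ (e n) }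
          ; comm = λ u v n → +-comm _ _ }
        ; *-cong = ⊛-cong
        ; *-assoc = ⊛-assoc
        ; *-identity = ⊛-identityˡ , (λ u n → trans (⊛-comm u _ n) (⊛-identityˡ u n))
        ; distrib =
            (λ w u v n → trans (⊛-comm w (u ⊕ v) n) (trans (⊛-distribʳ w u v n)
               (cong₂ _+_ (⊛-comm u w n) (⊛-comm v w n)))) ,
            ⊛-distribʳ
        }
      ; *-comm = ⊛-comm
      }
    }

  private
    acr : AlmostCommutativeRing _ _
    acr = fromCommutativeRing seriesRing

    ℤ-raw : RawRing _ _
    ℤ-raw = CommutativeRing.rawRing ℤP.+-*-commutativeRing

    const-cong : ∀ {x y} → x ≡ y → const x ≗ const y
    const-cong e n = cong (λ z → const z n) e

    const-neg : ∀ x → const (- x) ≗ ⊖ const x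
    const-neg x zero    = refl
    const-neg x (suc n) = sym -0#≡0#

    morphism : ℤ-raw -Raw-AlmostCommutative⟶ acr
    morphism = record
      { ⟦_⟧    = λ i → const (ι i)
      ; +-homo = λ i j n → trans (const-cong (ι-+ i j) n) (const-+ _ _ n)
      ; *-homo = λ i j n → trans (const-cong (ι-* i j) n) (const-* _ _ n)
      ; -‿homo = λ i n → trans (const-cong (ι-neg i) n) (const-neg _ n)
      ; 0-homo = const-cong ι-0
      ; 1-homo = const-cong ι-1
      }

    decide : ∀ i j → Maybe (const (ι i) ≗ const (ι j))
    decide i j with i ℤ.≟ j
    ... | yes eq = just (const-cong (cong ι eq))
    ... | no _   = nothing

  module SeriesSolver = RingSolver ℤ-raw acr morphism decide

  ϑ-tail : ∀ u n → ϑ u (suc n) ≡ ϑ (tail u) n + tail u n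
  ϑ-tail u n = trans
    (cong (_* u (suc n)) (trans (ι-+ (+ 1) (+ n)) (cong (_+ ι (+ n)) ι-1)))
    (trans (distribʳ _ _ _) (trans (+-congʳ (*-identityˡ _)) (+-comm _ _)))

  ϑ-⊛ : ∀ u v → ϑ (u ⊛ v) ≗ (ϑ u ⊛ v) ⊕ (u ⊛ ϑ v)
  ϑ-⊛ u v zero = trans (*-congʳ ι-0) (trans (zeroˡ _) (sym (trans
    (cong₂ (λ a b → a * u 0 * v 0 + u 0 * (b * v 0)) ι-0 ι-0)
    (trans (cong₂ (λ a b → a * v 0 + u 0 * b) (zeroˡ _) (zeroˡ _))
      (trans (cong₂ _+_ (zeroˡ _) (zeroʳ _)) (+-identityˡ _))))))
  ϑ-⊛ u v (suc n) = trans (ϑ-tail (u ⊛ v) n) (trans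
    (+-congʳ (distribˡ (ι (+ n)) _ _))
    (trans (cong (λ z → ι (+ n) * (u 0 * v (suc n)) + z + (u 0 * v (suc n) + (tail u ⊛ v) n))
                 (ϑ-⊛ (tail u) v n))
    (trans
      (solve 6 (λ m a b x y z → m :* (a :* b) :+ (x :+ y) :+ (a :* b :+ z)
                              := (x :+ z) :+ (a :* (m :* b :+ b) :+ y))
             refl (ι (+ n)) (u 0) (v (suc n)) ((ϑ (tail u) ⊛ v) n) ((tail u ⊛ ϑ v) n)
             ((tail u ⊛ v) n))
      (cong₂ _+_
        (sym (trans (cong₂ _+_ (trans (cong (λ z → z * u 0 * v (suc n)) ι-0)
                                 (trans (cong (_* v (suc n)) (zeroˡ _)) (zeroˡ _)))
                          (trans (⊛-cong (ϑ-tail u) (λ _ → refl) n)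
                                 (⊛-distribʳ v (ϑ (tail u)) (tail u) n)))
                   (+-identityˡ _)))
        (cong (λ z → u 0 * z + (tail u ⊛ ϑ v) n) (sym (ϑ-tail v n)))))))

  t : S
  t = shift (const 1#)

  t-⊛ : ∀ u → t ⊛ u ≗ shift u
  t-⊛ u zero    = zeroˡ _
  t-⊛ u (suc n) = trans (+-congʳ (zeroˡ _)) (trans (+-identityˡ _) (⊛-identityˡ u n))

-- Differential equations, the recurrence of the cube, Euler's transformation.

module Hypergeometric (𝔾 : Ground) where
  open Scalars 𝔾
  open Series 𝔾
  open CommutativeRing seriesRing using ()
    renaming (refl to ≗-refl; trans to ≗-trans; +-cong to ⊕-cong; zeroʳ to ⊛-zeroʳ; +-identityʳ to ⊕-identityʳ)
  open SeriesSolver using (solve; _:=_; _:+_; _:*_; _:-_; :-_; con)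
  open Scalars.Solver 𝔾 using ()
    renaming (solve to solveK; _:=_ to _:≡_; _:+_ to _⊞_; _:*_ to _⊠_; con to lit; :-_ to ⊟_)

  n̂ : ℕ → K
  n̂ n = ι (+ n)

  linear : ℕ → ℕ → K
  linear c n = ι (+ 3) * n̂ n + n̂ c

  -- The coefficients of ₂F₁(c/3, c/3; 1; 27 t), since 27 (n + c/3)² = 3 (3 n + c)². Only c = 1 and
  -- c = 2 occur.
  hyp : ℕ → S
  hyp c zero    = 1#
  hyp c (suc n) = hyp c n * (ι (+ 3) * (linear c n * linear c n)) * (inv (+ suc n) * inv (+ suc n))

  n̂-suc : ∀ n → n̂ (suc n) ≡ n̂ n + 1#
  n̂-suc n = trans (ι-+ (+ 1) (+ n)) (trans (cong (_+ n̂ n) ι-1) (+-comm _ _))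

  n̂-inv : ∀ n → n̂ (suc n) * inv (+ suc n) ≡ 1#
  n̂-inv n = ι-inv (+ suc n) (λ ())

  k : ℤ → S
  k i = const (ι i)

  hyp-step : ∀ c n → n̂ (suc n) * (n̂ (suc n) * hyp c (suc n))
                   ≡ ι (+ 3) * (linear c n * linear c n) * hyp c n
  hyp-step c n = trans
    (solveK 4 (λ m i q h → m ⊠ (m ⊠ (h ⊠ q ⊠ (i ⊠ i))) :≡ (m ⊠ i) ⊠ (m ⊠ i) ⊠ (q ⊠ h)) refl
       (n̂ (suc n)) (inv (+ suc n)) (ι (+ 3) * (linear c n * linear c n)) (hyp c n))
    (trans (cong (λ z → z * z * (ι (+ 3) * (linear c n * linear c n) * hyp c n)) (n̂-inv n))
           (trans (*-congʳ (*-identityˡ 1#)) (*-identityˡ _)))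

  ϑ-cong : ∀ {u v} → u ≗ v → ϑ u ≗ ϑ v
  ϑ-cong e n = *-congˡ (e n)

  ϑ-⊕ : ∀ u v → ϑ (u ⊕ v) ≗ ϑ u ⊕ ϑ v
  ϑ-⊕ u v n = distribˡ _ _ _

  ϑ-k : ∀ i u → ϑ (k i ⊛ u) ≗ k i ⊛ ϑ u
  ϑ-k i u n = trans (*-congˡ (const-⊛ (ι i) u n)) (trans
    (solveK 3 (λ a b c → a ⊠ (b ⊠ c) :≡ b ⊠ (a ⊠ c)) refl _ _ _) (sym (const-⊛ (ι i) (ϑ u) n)))

  ϑ-t : ϑ t ≗ t
  ϑ-t zero          = trans (*-congʳ ι-0) (zeroˡ _)
  ϑ-t (suc zero)    = trans (*-congʳ ι-1) (*-identityˡ _)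
  ϑ-t (suc (suc n)) = zeroʳ _

  ϑ-t⊛ : ∀ u → ϑ (t ⊛ u) ≗ t ⊛ (u ⊕ ϑ u)
  ϑ-t⊛ u = ≗-trans (ϑ-⊛ t u) (≗-trans (⊕-cong (⊛-cong ϑ-t ≗-refl) ≗-refl)
    (solve 3 (λ x a b → x :* a :+ x :* b := x :* (a :+ b)) ≗-refl t u (ϑ u)))

  -- The right side is 3 t (3 ϑ + c)² applied to `hyp c`, with the square expanded; coefficient by
  -- coefficient this is `hyp-step`.
  ode : ∀ c → ϑ (ϑ (hyp c)) ≗
    t ⊛ (k (+ 27) ⊛ ϑ (ϑ (hyp c)) ⊕ k (+ 18 ℤ.* + c) ⊛ ϑ (hyp c) ⊕ k (+ 3 ℤ.* (+ c ℤ.* + c)) ⊛ hyp c)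
  ode c zero    = trans (*-congʳ ι-0) (trans (zeroˡ _) (sym (zeroˡ _)))
  ode c (suc n) = trans (hyp-step c n) (sym (trans (t-⊛ _ (suc n)) (trans
    (cong₂ _+_ (cong₂ _+_ (const-⊛ _ _ n) (trans (const-⊛ _ _ n) (*-congʳ (ι-* (+ 18) (+ c)))))
      (trans (const-⊛ _ _ n) (*-congʳ (trans (ι-* (+ 3) (+ c ℤ.* + c)) (*-congˡ (ι-* (+ c) (+ c)))))))
    (solveK 3 (λ m h e → lit (+ 27) ⊠ (m ⊠ (m ⊠ h)) ⊞ lit (+ 18) ⊠ e ⊠ (m ⊠ h) ⊞ lit (+ 3) ⊠ (e ⊠ e) ⊠ h
        :≡ lit (+ 3) ⊠ ((lit (+ 3) ⊠ m ⊞ e) ⊠ (lit (+ 3) ⊠ m ⊞ e)) ⊠ h)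
      refl (n̂ n) (hyp c n) (n̂ c)))))

  4th : K → K
  4th x = x * x * (x * x)

  P : K → K
  P x = ι (+ 54) * (x * (x + 1#) * (x * (x + 1#))) + ι (+ 48) * (x * (x + 1#)) + ι (+ 9)

  Recurrent : S → Set
  Recurrent u = ∀ n → 4th (n̂ (suc n)) * u (suc n) + ι (+ 729) * (4th (n̂ n) * shift u n) ≡ P (n̂ n) * u n

  module _ (u : S) where
    private
      u1 = ϑ u
      u2 = ϑ u1
      u3 = ϑ u2
      u4 = ϑ u3

    -- This is ϑ⁴ - t P(ϑ) + 729 t² (ϑ + 1)⁴ applied to `u`; 54, 108, 102, 48, 9 are the
    -- coefficients of `P` in powers of its argument. Its coefficient of t to the n + 1 is the
    -- recurrence at n.
    operator : S
    operator = u4 ⊕ ⊖ (t ⊛ (k (+ 54) ⊛ u4 ⊕ k (+ 108) ⊛ u3 ⊕ k (+ 102) ⊛ u2 ⊕ k (+ 48) ⊛ u1 ⊕ k (+ 9) ⊛ u))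
      ⊕ k (+ 729) ⊛ (t ⊛ (t ⊛ (u4 ⊕ k (+ 4) ⊛ u3 ⊕ k (+ 6) ⊛ u2 ⊕ k (+ 4) ⊛ u1 ⊕ u)))

    private
      low : ∀ n → (t ⊛ (u4 ⊕ k (+ 4) ⊛ u3 ⊕ k (+ 6) ⊛ u2 ⊕ k (+ 4) ⊛ u1 ⊕ u)) n ≡ 4th (n̂ n) * shift u n
      low zero    = trans (zeroˡ _) (sym (zeroʳ _))
      low (suc n) = trans (t-⊛ _ (suc n)) (trans
        (cong₂ _+_ (cong₂ _+_ (cong₂ _+_ (+-congˡ (const-⊛ _ _ n)) (const-⊛ _ _ n)) (const-⊛ _ _ n)) refl)
        (trans (solveK 2 (λ m x → m ⊠ (m ⊠ (m ⊠ (m ⊠ x))) ⊞ lit (+ 4) ⊠ (m ⊠ (m ⊠ (m ⊠ x)))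
                   ⊞ lit (+ 6) ⊠ (m ⊠ (m ⊠ x)) ⊞ lit (+ 4) ⊠ (m ⊠ x) ⊞ x
                   :≡ (m ⊞ lit (+ 1)) ⊠ (m ⊞ lit (+ 1)) ⊠ ((m ⊞ lit (+ 1)) ⊠ (m ⊞ lit (+ 1))) ⊠ x)
                 refl (n̂ n) (u n))
               (cong (λ z → 4th z * u n) (trans (+-congˡ ι-1) (sym (n̂-suc n))))))

    recurrence : operator ≗ const 0# → Recurrent u
    recurrence e n = trans
      (solveK 3 (λ a b c → a ⊞ b :≡ (a ⊞ ⊟ c ⊞ b) ⊞ c) refl _ _ (P (n̂ n) * u n))
      (trans (+-congʳ (trans (sym expand) (e (suc n)))) (+-identityˡ _))
      where
      expand : operator (suc n) ≡ 4th (n̂ (suc n)) * u (suc n) + - (P (n̂ n) * u n)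
                                + ι (+ 729) * (4th (n̂ n) * shift u n)
      expand = cong₂ _+_
        (cong₂ _+_
          (solveK 2 (λ m x → m ⊠ (m ⊠ (m ⊠ (m ⊠ x))) :≡ m ⊠ m ⊠ (m ⊠ m) ⊠ x) refl (n̂ (suc n)) (u (suc n)))
          (cong -_ (trans (t-⊛ _ (suc n)) (trans
            (cong₂ _+_ (cong₂ _+_ (cong₂ _+_ (cong₂ _+_ (const-⊛ _ _ n) (const-⊛ _ _ n)) (const-⊛ _ _ n))
                                  (const-⊛ _ _ n)) (const-⊛ _ _ n))
            (trans (solveK 2 (λ m x →
                 lit (+ 54) ⊠ (m ⊠ (m ⊠ (m ⊠ (m ⊠ x)))) ⊞ lit (+ 108) ⊠ (m ⊠ (m ⊠ (m ⊠ x)))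
                 ⊞ lit (+ 102) ⊠ (m ⊠ (m ⊠ x)) ⊞ lit (+ 48) ⊠ (m ⊠ x) ⊞ lit (+ 9) ⊠ x
                 :≡ (lit (+ 54) ⊠ (m ⊠ (m ⊞ lit (+ 1)) ⊠ (m ⊠ (m ⊞ lit (+ 1))))
                    ⊞ lit (+ 48) ⊠ (m ⊠ (m ⊞ lit (+ 1))) ⊞ lit (+ 9)) ⊠ x) refl (n̂ n) (u n))
              (cong (λ o → (ι (+ 54) * (n̂ n * (n̂ n + o) * (n̂ n * (n̂ n + o))) + ι (+ 48) * (n̂ n * (n̂ n + o))
                            + ι (+ 9)) * u n) ι-1))))))
        (trans (const-⊛ _ _ (suc n)) (*-congˡ (trans (t-⊛ _ (suc n)) (low n))))

  ϑ-⊛₃ : ∀ a b c → ϑ (a ⊛ (b ⊛ c)) ≗ ϑ a ⊛ (b ⊛ c) ⊕ a ⊛ (ϑ b ⊛ c) ⊕ a ⊛ (b ⊛ ϑ c)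
  ϑ-⊛₃ a b c = ≗-trans (ϑ-⊛ a (b ⊛ c)) (≗-trans
    (⊕-cong ≗-refl (⊛-cong {u = a} ≗-refl (ϑ-⊛ b c)))
    (solve 5 (λ a b c x y → x :+ a :* (b :+ c) := x :+ a :* b :+ a :* c) ≗-refl
       a (ϑ b ⊛ c) (b ⊛ ϑ c) (ϑ a ⊛ (b ⊛ c)) a))

  module Cube (h : S) where
    private
      h1 = ϑ h
      h2 = ϑ h1
      h3 = ϑ h2
      h4 = ϑ h3

    -- The cube of a solution of a second-order equation satisfies one of order four (its symmetric
    -- cube), hence derivatives up to the fourth.
    cube cube₁ cube₂ cube₃ cube₄ : S
    cube  = h ⊛ (h ⊛ h)
    cube₁ = k (+ 3) ⊛ (h ⊛ (h ⊛ h1))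
    cube₂ = k (+ 6) ⊛ (h ⊛ (h1 ⊛ h1)) ⊕ k (+ 3) ⊛ (h ⊛ (h ⊛ h2))
    cube₃ = k (+ 6) ⊛ (h1 ⊛ (h1 ⊛ h1)) ⊕ k (+ 18) ⊛ (h ⊛ (h1 ⊛ h2)) ⊕ k (+ 3) ⊛ (h ⊛ (h ⊛ h3))
    cube₄ = k (+ 36) ⊛ (h1 ⊛ (h1 ⊛ h2)) ⊕ k (+ 18) ⊛ (h ⊛ (h2 ⊛ h2)) ⊕ k (+ 24) ⊛ (h ⊛ (h1 ⊛ h3))
          ⊕ k (+ 3) ⊛ (h ⊛ (h ⊛ h4))

    ϑ-cube : ϑ cube ≗ cube₁
    ϑ-cube = ≗-trans (ϑ-⊛₃ h h h)
      (solve 2 (λ x y → y :* (x :* x) :+ x :* (y :* x) :+ x :* (x :* y) := con (+ 3) :* (x :* (x :* y)))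
         ≗-refl h h1)

    ϑ-cube₁ : ϑ cube₁ ≗ cube₂
    ϑ-cube₁ = ≗-trans (ϑ-k (+ 3) _) (≗-trans (⊛-cong {u = k (+ 3)} ≗-refl (ϑ-⊛₃ h h h1))
      (solve 3 (λ x y z → con (+ 3) :* (y :* (x :* y) :+ x :* (y :* y) :+ x :* (x :* z))
          := con (+ 6) :* (x :* (y :* y)) :+ con (+ 3) :* (x :* (x :* z)))
         ≗-refl h h1 h2))

    ϑ-cube₂ : ϑ cube₂ ≗ cube₃
    ϑ-cube₂ = ≗-trans (ϑ-⊕ _ _) (≗-trans (⊕-cong (ϑ-k (+ 6) _) (ϑ-k (+ 3) _)) (≗-trans
      (⊕-cong (⊛-cong {u = k (+ 6)} ≗-refl (ϑ-⊛₃ h h1 h1)) (⊛-cong {u = k (+ 3)} ≗-refl (ϑ-⊛₃ h h h2)))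
      (solve 4 (λ x y z w → con (+ 6) :* (y :* (y :* y) :+ x :* (z :* y) :+ x :* (y :* z))
                         :+ con (+ 3) :* (y :* (x :* z) :+ x :* (y :* z) :+ x :* (x :* w))
          := con (+ 6) :* (y :* (y :* y)) :+ con (+ 18) :* (x :* (y :* z)) :+ con (+ 3) :* (x :* (x :* w)))
         ≗-refl h h1 h2 h3)))

    ϑ-cube₃ : ϑ cube₃ ≗ cube₄
    ϑ-cube₃ = ≗-trans (ϑ-⊕ _ _) (≗-trans
      (⊕-cong (≗-trans (ϑ-⊕ _ _) (⊕-cong (ϑ-k (+ 6) _) (ϑ-k (+ 18) _))) (ϑ-k (+ 3) _)) (≗-trans
      (⊕-cong (⊕-cong (⊛-cong {u = k (+ 6)} ≗-refl (ϑ-⊛₃ h1 h1 h1)) (⊛-cong {u = k (+ 18)} ≗-refl (ϑ-⊛₃ h h1 h2)))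
              (⊛-cong {u = k (+ 3)} ≗-refl (ϑ-⊛₃ h h h3)))
      (solve 5 (λ x y z w q →
             con (+ 6) :* (z :* (y :* y) :+ y :* (z :* y) :+ y :* (y :* z))
          :+ con (+ 18) :* (y :* (y :* z) :+ x :* (z :* z) :+ x :* (y :* w))
          :+ con (+ 3) :* (y :* (x :* w) :+ x :* (y :* w) :+ x :* (x :* q))
          := con (+ 36) :* (y :* (y :* z)) :+ con (+ 18) :* (x :* (z :* z)) :+ con (+ 24) :* (x :* (y :* w))
          :+ con (+ 3) :* (x :* (x :* q)))
         ≗-refl h h1 h2 h3 h4)))

  module _ (c : ℕ) where
    private
      h  = hyp c
      h1 = ϑ h
      h2 = ϑ h1
      h3 = ϑ h2
      h4 = ϑ h3
      b  = + 18 ℤ.* + c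
      d  = + 3 ℤ.* (+ c ℤ.* + c)

    rhs : S → S → S → S
    rhs x y z = k (+ 27) ⊛ x ⊕ k b ⊛ y ⊕ k d ⊛ z

    private
      ϑ-rhs : ∀ x y z → ϑ (rhs x y z) ≗ rhs (ϑ x) (ϑ y) (ϑ z)
      ϑ-rhs x y z = ≗-trans (ϑ-⊕ _ _) (⊕-cong (≗-trans (ϑ-⊕ _ _) (⊕-cong (ϑ-k (+ 27) x) (ϑ-k b y))) (ϑ-k d z))

    ode₃ : h3 ≗ t ⊛ (rhs h2 h1 h ⊕ rhs h3 h2 h1)
    ode₃ = ≗-trans (ϑ-cong (ode c)) (≗-trans (ϑ-t⊛ _)
      (⊛-cong {u = t} ≗-refl (⊕-cong ≗-refl (ϑ-rhs h2 h1 h))))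

    ode₄ : h4 ≗ t ⊛ (rhs h2 h1 h ⊕ rhs h3 h2 h1 ⊕ (rhs h3 h2 h1 ⊕ rhs h4 h3 h2))
    ode₄ = ≗-trans (ϑ-cong ode₃) (≗-trans (ϑ-t⊛ _) (⊛-cong {u = t} ≗-refl
      (⊕-cong ≗-refl (≗-trans (ϑ-⊕ _ _) (⊕-cong (ϑ-rhs h2 h1 h) (ϑ-rhs h3 h2 h1))))))

  difference-zero : ∀ {u v} → u ≗ v → u ⊕ ⊖ v ≗ const 0#
  difference-zero {u} {v} e n = trans (+-congʳ (e n)) (trans (-‿inverseʳ _) (sym (const-0 n)))

  combination-zero : ∀ α β γ {x y z} → x ≗ const 0# → y ≗ const 0# → z ≗ const 0# →
    α ⊛ x ⊕ β ⊛ y ⊕ γ ⊛ z ≗ const 0#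
  combination-zero α β γ ex ey ez = ≗-trans
    (⊕-cong (⊕-cong (⊛-cong {u = α} ≗-refl ex) (⊛-cong {u = β} ≗-refl ey)) (⊛-cong {u = γ} ≗-refl ez))
    (≗-trans (⊕-cong (⊕-cong (⊛-zeroʳ α) (⊛-zeroʳ β)) (⊛-zeroʳ γ))
      (≗-trans (⊕-identityʳ _) (⊕-identityʳ _)))

  operator-cong : ∀ u {u1 u2 u3 u4} → ϑ u ≗ u1 → ϑ (ϑ u) ≗ u2 → ϑ (ϑ (ϑ u)) ≗ u3 → ϑ (ϑ (ϑ (ϑ u))) ≗ u4 →
    operator u ≗ u4 ⊕ ⊖ (t ⊛ (k (+ 54) ⊛ u4 ⊕ k (+ 108) ⊛ u3 ⊕ k (+ 102) ⊛ u2 ⊕ k (+ 48) ⊛ u1 ⊕ k (+ 9) ⊛ u))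
      ⊕ k (+ 729) ⊛ (t ⊛ (t ⊛ (u4 ⊕ k (+ 4) ⊛ u3 ⊕ k (+ 6) ⊛ u2 ⊕ k (+ 4) ⊛ u1 ⊕ u)))
  operator-cong u e1 e2 e3 e4 = ⊕-cong
    (⊕-cong e4 (λ n → cong -_ (⊛-cong {u = t} ≗-refl
      (⊕-cong (⊕-cong (⊕-cong (⊕-cong (m e4) (m e3)) (m e2)) (m e1)) ≗-refl) n)))
    (m (⊛-cong {u = t} ≗-refl (⊛-cong {u = t} ≗-refl
      (⊕-cong (⊕-cong (⊕-cong (⊕-cong e4 (m e3)) (m e2)) (m e1)) ≗-refl))))
    where
    m : ∀ {a x y} → x ≗ y → a ⊛ x ≗ a ⊛ y
    m {a} e = ⊛-cong {u = a} ≗-refl e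

  module _ where
    private
      h  = hyp 1
      h1 = ϑ h
      h2 = ϑ h1
      h3 = ϑ h2
      h4 = ϑ h3
    open Cube h

    -- The operator applied to a cube is a combination of the differential equation of h and its two derivatives.
    cube-recurrent : Recurrent cube
    cube-recurrent = recurrence cube (≗-trans
      (operator-cong cube d₁ d₂ d₃ d₄)
      (≗-trans
        (solve 6 (λ t x y z w q →
           let c₀ = x :* (x :* x)
               c₁ = con (+ 3) :* (x :* (x :* y))
               c₂ = con (+ 6) :* (x :* (y :* y)) :+ con (+ 3) :* (x :* (x :* z))
               c₃ = con (+ 6) :* (y :* (y :* y)) :+ con (+ 18) :* (x :* (y :* z)) :+ con (+ 3) :* (x :* (x :* w))
               c₄ = con (+ 36) :* (y :* (y :* z)) :+ con (+ 18) :* (x :* (z :* z)) :+ con (+ 24) :* (x :* (y :* w)) :+ con (+ 3) :* (x :* (x :* q))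
               r₀ = con (+ 27) :* z :+ con (+ 18) :* y :+ con (+ 3) :* x
               r₁ = con (+ 27) :* w :+ con (+ 18) :* z :+ con (+ 3) :* y
               r₂ = con (+ 27) :* q :+ con (+ 18) :* w :+ con (+ 3) :* z
           in
           (c₄ :+ :- (t :* (con (+ 54) :* c₄ :+ con (+ 108) :* c₃ :+ con (+ 102) :* c₂ :+ con (+ 48) :* c₁ :+ con (+ 9) :* c₀)) :+ con (+ 729) :* (t :* (t :* (c₄ :+ con (+ 4) :* c₃ :+ con (+ 6) :* c₂ :+ con (+ 4) :* c₁ :+ c₀))))
           -- The cofactors come from division, highest derivative first. The operator has leading
           -- coefficient (1 - 27 t)², the equation for h4 has 1 - 27 t, and the cube contributes 3
           -- h² h4, so the last cofactor is 3 h² (1 - 27 t); matching h3 and then h2 gives the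
           -- other two.
           := (con (+ 36) :* y :* y :+ con (+ 18) :* x :* z :+ con (-[1+ 971 ]) :* t :* y :* y :+ con (-[1+ 485 ]) :* t :* x :* z :+ con (-[1+ 539 ]) :* t :* x :* y :+ con (-[1+ 53 ]) :* t :* x :* x) :* (z :+ :- (t :* r₀))
           :+ (con (+ 24) :* x :* y :+ con (-[1+ 647 ]) :* t :* x :* y :+ con (-[1+ 107 ]) :* t :* x :* x) :* (w :+ :- (t :* (r₀ :+ r₁)))
           :+ (con (+ 3) :* x :* x :+ con (-[1+ 80 ]) :* t :* x :* x) :* (q :+ :- (t :* (r₀ :+ r₁ :+ (r₁ :+ r₂)))))
         ≗-refl t h h1 h2 h3 h4)
        (combination-zero
           (k (+ 36) ⊛ h1 ⊛ h1 ⊕ k (+ 18) ⊛ h ⊛ h2 ⊕ k -[1+ 971 ] ⊛ t ⊛ h1 ⊛ h1 ⊕ k -[1+ 485 ] ⊛ t ⊛ h ⊛ h2 ⊕ k -[1+ 539 ] ⊛ t ⊛ h ⊛ h1 ⊕ k -[1+ 53 ] ⊛ t ⊛ h ⊛ h)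
           (k (+ 24) ⊛ h ⊛ h1 ⊕ k -[1+ 647 ] ⊛ t ⊛ h ⊛ h1 ⊕ k -[1+ 107 ] ⊛ t ⊛ h ⊛ h)
           (k (+ 3) ⊛ h ⊛ h ⊕ k -[1+ 80 ] ⊛ t ⊛ h ⊛ h)
           (difference-zero (ode 1)) (difference-zero (ode₃ 1)) (difference-zero (ode₄ 1)))))
      where
      d₁ = ϑ-cube
      d₂ = ≗-trans (ϑ-cong d₁) ϑ-cube₁
      d₃ = ≗-trans (ϑ-cong d₂) ϑ-cube₂
      d₄ = ≗-trans (ϑ-cong d₃) ϑ-cube₃

  ϑ-⊖ : ∀ u → ϑ (⊖ u) ≗ ⊖ ϑ u
  ϑ-⊖ u n = solveK 2 (λ a b → a ⊠ ⊟ b :≡ ⊟ (a ⊠ b)) refl _ _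

  ϑ-twist : ∀ x y → ϑ (x ⊕ ⊖ (k (+ 27) ⊛ (t ⊛ y))) ≗ ϑ x ⊕ ⊖ (k (+ 27) ⊛ (t ⊛ (y ⊕ ϑ y)))
  ϑ-twist x y = ≗-trans (ϑ-⊕ _ _) (⊕-cong ≗-refl (≗-trans (ϑ-⊖ _)
    (λ n → cong -_ (≗-trans (ϑ-k (+ 27) _) (⊛-cong {u = k (+ 27)} ≗-refl (ϑ-t⊛ y)) n))))

  module _ where
    private
      h  = hyp 2
      h1 = ϑ h
      h2 = ϑ h1
      h3 = ϑ h2
      h4 = ϑ h3
    open Cube h

    -- Euler's transformation reads ₂F₁(1/3, 1/3; 1; z) = (1 - z)^(1/3) ₂F₁(2/3, 2/3; 1; z). Cubing
    -- makes the power of 1 - z polynomial, and here z = 27 t.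
    twisted : S
    twisted = cube ⊕ ⊖ (k (+ 27) ⊛ (t ⊛ cube))

    private
      g₁ g₂ g₃ g₄ : S
      g₁ = cube₁ ⊕ ⊖ (k (+ 27) ⊛ (t ⊛ (k (+ 1) ⊛ cube ⊕ k (+ 1) ⊛ cube₁)))
      g₂ = cube₂ ⊕ ⊖ (k (+ 27) ⊛ (t ⊛ (k (+ 1) ⊛ cube ⊕ k (+ 2) ⊛ cube₁ ⊕ k (+ 1) ⊛ cube₂)))
      g₃ = cube₃ ⊕ ⊖ (k (+ 27) ⊛ (t ⊛ (k (+ 1) ⊛ cube ⊕ k (+ 3) ⊛ cube₁ ⊕ k (+ 3) ⊛ cube₂ ⊕ k (+ 1) ⊛ cube₃)))
      g₄ = cube₄ ⊕ ⊖ (k (+ 27) ⊛ (t ⊛ (k (+ 1) ⊛ cube ⊕ k (+ 4) ⊛ cube₁ ⊕ k (+ 6) ⊛ cube₂ ⊕ k (+ 4) ⊛ cube₃ ⊕ k (+ 1) ⊛ cube₄)))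

      twist-cong : ∀ {x x′ y y′} → x ≗ x′ → y ≗ y′ →
        x ⊕ ⊖ (k (+ 27) ⊛ (t ⊛ y)) ≗ x′ ⊕ ⊖ (k (+ 27) ⊛ (t ⊛ y′))
      twist-cong e d = ⊕-cong e (λ n → cong -_ (⊛-cong {u = k (+ 27)} ≗-refl (⊛-cong {u = t} ≗-refl d) n))

      d₁ : ϑ twisted ≗ g₁
      d₁ = ≗-trans (ϑ-twist _ _) (twist-cong ϑ-cube
        (≗-trans (⊕-cong ≗-refl ϑ-cube)
          (solve 2 (λ a b → a :+ b := con (+ 1) :* a :+ con (+ 1) :* b) ≗-refl cube cube₁)))

      d₂ : ϑ (ϑ twisted) ≗ g₂
      d₂ = ≗-trans (ϑ-cong d₁) (≗-trans (ϑ-twist _ _) (twist-cong ϑ-cube₁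
        (≗-trans (⊕-cong ≗-refl (≗-trans (ϑ-⊕ _ _) (⊕-cong
            (≗-trans (ϑ-k (+ 1) _) (⊛-cong {u = k (+ 1)} ≗-refl ϑ-cube))
            (≗-trans (ϑ-k (+ 1) _) (⊛-cong {u = k (+ 1)} ≗-refl ϑ-cube₁)))))
          (solve 3 (λ a b c → (con (+ 1) :* a :+ con (+ 1) :* b) :+ (con (+ 1) :* b :+ con (+ 1) :* c)
             := con (+ 1) :* a :+ con (+ 2) :* b :+ con (+ 1) :* c) ≗-refl cube cube₁ cube₂))))

      d₃ : ϑ (ϑ (ϑ twisted)) ≗ g₃
      d₃ = ≗-trans (ϑ-cong d₂) (≗-trans (ϑ-twist _ _) (twist-cong ϑ-cube₂
        (≗-trans (⊕-cong ≗-refl (≗-trans (ϑ-⊕ _ _) (⊕-cong (≗-trans (ϑ-⊕ _ _) (⊕-cong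
            (≗-trans (ϑ-k (+ 1) _) (⊛-cong {u = k (+ 1)} ≗-refl ϑ-cube))
            (≗-trans (ϑ-k (+ 2) _) (⊛-cong {u = k (+ 2)} ≗-refl ϑ-cube₁))))
            (≗-trans (ϑ-k (+ 1) _) (⊛-cong {u = k (+ 1)} ≗-refl ϑ-cube₂)))))
          (solve 4 (λ a b c d → (con (+ 1) :* a :+ con (+ 2) :* b :+ con (+ 1) :* c)
                             :+ (con (+ 1) :* b :+ con (+ 2) :* c :+ con (+ 1) :* d)
             := con (+ 1) :* a :+ con (+ 3) :* b :+ con (+ 3) :* c :+ con (+ 1) :* d)
             ≗-refl cube cube₁ cube₂ cube₃))))

      d₄ : ϑ (ϑ (ϑ (ϑ twisted))) ≗ g₄
      d₄ = ≗-trans (ϑ-cong d₃) (≗-trans (ϑ-twist _ _) (twist-cong ϑ-cube₃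
        (≗-trans (⊕-cong ≗-refl (≗-trans (ϑ-⊕ _ _) (⊕-cong (≗-trans (ϑ-⊕ _ _) (⊕-cong (≗-trans (ϑ-⊕ _ _) (⊕-cong
            (≗-trans (ϑ-k (+ 1) _) (⊛-cong {u = k (+ 1)} ≗-refl ϑ-cube))
            (≗-trans (ϑ-k (+ 3) _) (⊛-cong {u = k (+ 3)} ≗-refl ϑ-cube₁))))
            (≗-trans (ϑ-k (+ 3) _) (⊛-cong {u = k (+ 3)} ≗-refl ϑ-cube₂))))
            (≗-trans (ϑ-k (+ 1) _) (⊛-cong {u = k (+ 1)} ≗-refl ϑ-cube₃)))))
          (solve 5 (λ a b c d e → (con (+ 1) :* a :+ con (+ 3) :* b :+ con (+ 3) :* c :+ con (+ 1) :* d)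
                               :+ (con (+ 1) :* b :+ con (+ 3) :* c :+ con (+ 3) :* d :+ con (+ 1) :* e)
             := con (+ 1) :* a :+ con (+ 4) :* b :+ con (+ 6) :* c :+ con (+ 4) :* d :+ con (+ 1) :* e)
             ≗-refl cube cube₁ cube₂ cube₃ cube₄))))

    twisted-recurrent : Recurrent twisted
    twisted-recurrent = recurrence twisted (≗-trans
      (operator-cong twisted d₁ d₂ d₃ d₄)
      (≗-trans
        (solve 6 (λ t x y z w q →
           let c₀ = x :* (x :* x)
               c₁ = con (+ 3) :* (x :* (x :* y))
               c₂ = con (+ 6) :* (x :* (y :* y)) :+ con (+ 3) :* (x :* (x :* z))
               c₃ = con (+ 6) :* (y :* (y :* y)) :+ con (+ 18) :* (x :* (y :* z)) :+ con (+ 3) :* (x :* (x :* w))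
               c₄ = con (+ 36) :* (y :* (y :* z)) :+ con (+ 18) :* (x :* (z :* z)) :+ con (+ 24) :* (x :* (y :* w)) :+ con (+ 3) :* (x :* (x :* q))
               r₀ = con (+ 27) :* z :+ con (+ 36) :* y :+ con (+ 12) :* x
               r₁ = con (+ 27) :* w :+ con (+ 36) :* z :+ con (+ 12) :* y
               r₂ = con (+ 27) :* q :+ con (+ 36) :* w :+ con (+ 12) :* z
               g₀ = c₀ :+ :- (con (+ 27) :* (t :* c₀))
               g₁ = c₁ :+ :- (con (+ 27) :* (t :* (con (+ 1) :* c₀ :+ con (+ 1) :* c₁)))
               g₂ = c₂ :+ :- (con (+ 27) :* (t :* (con (+ 1) :* c₀ :+ con (+ 2) :* c₁ :+ con (+ 1) :* c₂)))
               g₃ = c₃ :+ :- (con (+ 27) :* (t :* (con (+ 1) :* c₀ :+ con (+ 3) :* c₁ :+ con (+ 3) :* c₂ :+ con (+ 1) :* c₃)))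
               g₄ = c₄ :+ :- (con (+ 27) :* (t :* (con (+ 1) :* c₀ :+ con (+ 4) :* c₁ :+ con (+ 6) :* c₂ :+ con (+ 4) :* c₃ :+ con (+ 1) :* c₄)))
           in
           (g₄ :+ :- (t :* (con (+ 54) :* g₄ :+ con (+ 108) :* g₃ :+ con (+ 102) :* g₂ :+ con (+ 48) :* g₁ :+ con (+ 9) :* g₀)) :+ con (+ 729) :* (t :* (t :* (g₄ :+ con (+ 4) :* g₃ :+ con (+ 6) :* g₂ :+ con (+ 4) :* g₁ :+ g₀))))
           := (con (+ 36) :* y :* y :+ con (+ 18) :* x :* z :+ con (-[1+ 1943 ]) :* t :* y :* y :+ con (-[1+ 971 ]) :* t :* x :* z :+ con (-[1+ 1727 ]) :* t :* x :* y :+ con (-[1+ 242 ]) :* t :* x :* x :+ con (+ 26244) :* t :* t :* y :* y :+ con (+ 13122) :* t :* t :* x :* z :+ con (+ 46656) :* t :* t :* x :* y :+ con (+ 13851) :* t :* t :* x :* x) :* (z :+ :- (t :* r₀))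
           :+ (con (+ 24) :* x :* y :+ con (-[1+ 1295 ]) :* t :* x :* y :+ con (-[1+ 377 ]) :* t :* x :* x :+ con (+ 17496) :* t :* t :* x :* y :+ con (+ 10206) :* t :* t :* x :* x) :* (w :+ :- (t :* (r₀ :+ r₁)))
           :+ (con (+ 3) :* x :* x :+ con (-[1+ 161 ]) :* t :* x :* x :+ con (+ 2187) :* t :* t :* x :* x) :* (q :+ :- (t :* (r₀ :+ r₁ :+ (r₁ :+ r₂)))))
         ≗-refl t h h1 h2 h3 h4)
        (combination-zero
           (k (+ 36) ⊛ h1 ⊛ h1 ⊕ k (+ 18) ⊛ h ⊛ h2 ⊕ k -[1+ 1943 ] ⊛ t ⊛ h1 ⊛ h1 ⊕ k -[1+ 971 ] ⊛ t ⊛ h ⊛ h2 ⊕ k -[1+ 1727 ] ⊛ t ⊛ h ⊛ h1 ⊕ k -[1+ 242 ] ⊛ t ⊛ h ⊛ h ⊕ k (+ 26244) ⊛ t ⊛ t ⊛ h1 ⊛ h1 ⊕ k (+ 13122) ⊛ t ⊛ t ⊛ h ⊛ h2 ⊕ k (+ 46656) ⊛ t ⊛ t ⊛ h ⊛ h1 ⊕ k (+ 13851) ⊛ t ⊛ t ⊛ h ⊛ h)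
           (k (+ 24) ⊛ h ⊛ h1 ⊕ k -[1+ 1295 ] ⊛ t ⊛ h ⊛ h1 ⊕ k -[1+ 377 ] ⊛ t ⊛ h ⊛ h ⊕ k (+ 17496) ⊛ t ⊛ t ⊛ h ⊛ h1 ⊕ k (+ 10206) ⊛ t ⊛ t ⊛ h ⊛ h)
           (k (+ 3) ⊛ h ⊛ h ⊕ k -[1+ 161 ] ⊛ t ⊛ h ⊛ h ⊕ k (+ 2187) ⊛ t ⊛ t ⊛ h ⊛ h)
           (difference-zero (ode 2)) (difference-zero (ode₃ 2)) (difference-zero (ode₄ 2)))))

  4th-inv : ∀ n x y → 4th (n̂ (suc n)) * x ≡ 4th (n̂ (suc n)) * y → x ≡ y
  4th-inv n x y e = trans (sym (undo x)) (trans (cong (4th (inv (+ suc n)) *_) e) (undo y))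
    where
    undo : ∀ x → 4th (inv (+ suc n)) * (4th (n̂ (suc n)) * x) ≡ x
    undo x = trans
      (solveK 3 (λ m i x → i ⊠ i ⊠ (i ⊠ i) ⊠ (m ⊠ m ⊠ (m ⊠ m) ⊠ x)
                        :≡ (m ⊠ i) ⊠ (m ⊠ i) ⊠ ((m ⊠ i) ⊠ (m ⊠ i)) ⊠ x) refl (n̂ (suc n)) (inv (+ suc n)) x)
      (trans (cong (λ z → z * z * (z * z) * x) (n̂-inv n))
        (trans (*-congʳ (trans (cong (λ z → z * z) (*-identityˡ 1#)) (*-identityˡ 1#))) (*-identityˡ x)))

  -- The recurrence has order two, but its lowest term is absent at n = 0, so the constant
  -- coefficient starts it alone; the leading factor (n + 1)⁴ is always invertible.
  recurrent-unique : ∀ {u v} → Recurrent u → Recurrent v → u 0 ≡ v 0 → u ≗ v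
  recurrent-unique {u} {v} ru rv e n = proj₁ (pair n)
    where
    step : ∀ n → u n ≡ v n → shift u n ≡ shift v n → u (suc n) ≡ v (suc n)
    step n e d = 4th-inv n _ _ (trans (sym (move u ru)) (trans
        (cong₂ (λ a b → P (n̂ n) * a + - (ι (+ 729) * (4th (n̂ n) * b))) e d) (move v rv)))
      where
      move : ∀ w → Recurrent w → P (n̂ n) * w n + - (ι (+ 729) * (4th (n̂ n) * shift w n)) ≡ 4th (n̂ (suc n)) * w (suc n)
      move w r = trans (+-congʳ (sym (r n))) (solveK 2 (λ a b → a ⊞ b ⊞ ⊟ b :≡ a) refl _ _)
    pair : ∀ n → u n ≡ v n × shift u n ≡ shift v n
    pair zero    = e , refl
    pair (suc n) = step n (proj₁ (pair n)) (proj₂ (pair n)) , proj₁ (pair n)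

  -- Both sides satisfy the same recurrence and have constant term 1. No fractional power of a
  -- series has to be defined.
  euler : Cube.cube (hyp 1) ≗ twisted
  euler = recurrent-unique cube-recurrent twisted-recurrent (sym (trans
    (cong (λ z → 1# * (1# * 1#) + - z) (trans (*-congˡ (zeroˡ _)) (zeroʳ _)))
    (trans (+-congˡ -0#≡0#) (+-identityʳ _))))

  module _ where
    private
      f = hyp 1
      f1 = ϑ f
      f2 = ϑ f1
      f3 = ϑ f2

    -- X = (3ϑ + 1)² f, so that the differential equation of f reads ϑ² f = 3 t X.
    X β₁ β₂ : S
    X  = k (+ 9) ⊛ f2 ⊕ k (+ 6) ⊛ f1 ⊕ f
    β₁ = X ⊛ (f ⊛ f)
    β₂ = k (+ 3) ⊛ (ϑ X ⊛ (f ⊛ f))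

    ode-X : f2 ≗ k (+ 3) ⊛ (t ⊛ X)
    ode-X = ≗-trans (ode 1)
      (solve 4 (λ t x y z → t :* (con (+ 27) :* z :+ con (+ 18) :* y :+ con (+ 3) :* x)
                         := con (+ 3) :* (t :* (con (+ 9) :* z :+ con (+ 6) :* y :+ x))) ≗-refl t f f1 f2)

    ode-ϑX : f3 ≗ k (+ 3) ⊛ (t ⊛ (X ⊕ ϑ X))
    ode-ϑX = ≗-trans (ϑ-cong ode-X) (≗-trans (ϑ-k (+ 3) _) (⊛-cong {u = k (+ 3)} ≗-refl (ϑ-t⊛ X)))

    private
      ϑX : ϑ X ≗ k (+ 9) ⊛ f3 ⊕ k (+ 6) ⊛ f2 ⊕ f1
      ϑX = ≗-trans (ϑ-⊕ _ _) (⊕-cong (≗-trans (ϑ-⊕ _ _) (⊕-cong (ϑ-k (+ 9) _) (ϑ-k (+ 6) _))) ≗-refl)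

      F = Cube.cube f
      F1 = Cube.cube₁ f

      β₁-series : β₁ ≗ k (+ 27) ⊛ (t ⊛ β₁) ⊕ k (+ 2) ⊛ F1 ⊕ F
      β₁-series = ≗-trans (⊛-cong (⊕-cong (⊕-cong (⊛-cong {u = k (+ 9)} ≗-refl ode-X) ≗-refl) ≗-refl) ≗-refl)
        (solve 4 (λ t x y X → (con (+ 9) :* (con (+ 3) :* (t :* X)) :+ con (+ 6) :* y :+ x) :* (x :* x)
           := con (+ 27) :* (t :* (X :* (x :* x))) :+ con (+ 2) :* (con (+ 3) :* (x :* (x :* y))) :+ x :* (x :* x))
           ≗-refl t f f1 X)

      β₂-series : β₂ ≗ k (+ 27) ⊛ (t ⊛ β₂) ⊕ k (+ 135) ⊛ (t ⊛ β₁) ⊕ F1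
      β₂-series = ≗-trans (⊛-cong {u = k (+ 3)} ≗-refl (⊛-cong (≗-trans ϑX
          (⊕-cong (⊕-cong (⊛-cong {u = k (+ 9)} ≗-refl ode-ϑX) (⊛-cong {u = k (+ 6)} ≗-refl ode-X)) ≗-refl)) ≗-refl))
        (solve 5 (λ t x y X Y → con (+ 3) :* ((con (+ 9) :* (con (+ 3) :* (t :* (X :+ Y)))
              :+ con (+ 6) :* (con (+ 3) :* (t :* X)) :+ y) :* (x :* x))
           := con (+ 27) :* (t :* (con (+ 3) :* (Y :* (x :* x)))) :+ con (+ 135) :* (t :* (X :* (x :* x)))
              :+ con (+ 3) :* (x :* (x :* y)))
           ≗-refl t f f1 X (ϑ X))

      F1-coefficient : ∀ n → F1 n ≡ n̂ n * F n
      F1-coefficient n = sym (Cube.ϑ-cube f n)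

    -- The differential equation gives X = 27 t X + 6 ϑf + f, and 6 f² ϑf is twice the derivative of
    -- the cube. So β₁, and similarly β₂, is computable from the coefficients of F by a first-order
    -- recursion.
    β₁-step : ∀ n → β₁ n ≡ ι (+ 27) * shift β₁ n + (ι (+ 2) * n̂ n + 1#) * F n
    β₁-step n = trans (β₁-series n) (trans
      (+-congʳ (cong₂ _+_ (trans (const-⊛ _ _ n) (*-congˡ (t-⊛ β₁ n)))
        (trans (const-⊛ _ _ n) (*-congˡ (F1-coefficient n)))))
      (trans (cong (λ z → ι (+ 27) * shift β₁ n + ι (+ 2) * (n̂ n * F n) + z) (sym (*-identityˡ (F n))))
       (solveK 5 (λ a b m o x → a ⊞ b ⊠ (m ⊠ x) ⊞ o ⊠ x :≡ a ⊞ (b ⊠ m ⊞ o) ⊠ x) refl _ _ _ _ _)))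

    β₂-step : ∀ n → β₂ n ≡ ι (+ 27) * shift β₂ n + ι (+ 135) * shift β₁ n + n̂ n * F n
    β₂-step n = trans (β₂-series n) (cong₂ _+_
      (cong₂ _+_ (trans (const-⊛ _ _ n) (*-congˡ (t-⊛ β₂ n))) (trans (const-⊛ _ _ n) (*-congˡ (t-⊛ β₁ n))))
      (F1-coefficient n))

-- Congruences in ℤ localised at p.

module Localisation (𝔾 : Ground) (p : ℕ) (p-prime : Prime p) where
  open Scalars 𝔾
  open Scalars.Solver 𝔾 using (solve; _:=_; _:+_; _:*_; _:-_; :-_)

  record Unit (d : ℤ) : Set where
    constructor unit
    field
      indivisible : p ∤ ∣ d ∣
  open Unit public

  1<p : 1 ℕ.< p
  1<p = ℕ.nonTrivial⇒n>1 p {{prime⇒nonTrivial p-prime}}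

  unit-1 : Unit (+ 1)
  unit-1 = unit (λ h → ℕP.<⇒≱ 1<p (∣⇒≤ h))

  unit-* : ∀ {d e} → Unit d → Unit e → Unit (d ℤ.* e)
  unit-* {d} {e} (unit ud) (unit ue) = unit (λ h →
    [ ud , ue ]′ (euclidsLemma ∣ d ∣ ∣ e ∣ p-prime (subst (p ∣_) (ℤP.abs-* d e) h)))

  unit≢0 : ∀ {d} → Unit d → d ≢ + 0
  unit≢0 (unit u) refl = u (p ∣0)

  -- Membership in ℤ localised at p, with x = u / d written without division.
  Loc : K → Set
  Loc x = ∃[ d ] ∃[ u ] Unit d × ι d * x ≡ ι u

  loc-ι : ∀ i → Loc (ι i)
  loc-ι i = + 1 , i , unit-1 , trans (*-congʳ ι-1) (*-identityˡ _)

  loc-0 : Loc 0#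
  loc-0 = subst Loc ι-0 (loc-ι (+ 0))

  loc-1 : Loc 1#
  loc-1 = subst Loc ι-1 (loc-ι (+ 1))

  loc-+ : ∀ {x y} → Loc x → Loc y → Loc (x + y)
  loc-+ {x} {y} (d , u , ud , ex) (e , v , ue , ey) =
    d ℤ.* e , e ℤ.* u ℤ.+ d ℤ.* v , unit-* ud ue ,
    trans (*-congʳ (ι-* d e)) (trans
      (solve 4 (λ d e x y → d :* e :* (x :+ y) := e :* (d :* x) :+ d :* (e :* y)) refl (ι d) (ι e) x y)
      (trans (cong₂ (λ a b → ι e * a + ι d * b) ex ey)
        (sym (trans (ι-+ _ _) (cong₂ _+_ (ι-* e u) (ι-* d v))))))

  loc-* : ∀ {x y} → Loc x → Loc y → Loc (x * y)
  loc-* {x} {y} (d , u , ud , ex) (e , v , ue , ey) =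
    d ℤ.* e , u ℤ.* v , unit-* ud ue ,
    trans (*-congʳ (ι-* d e)) (trans
      (solve 4 (λ d e x y → d :* e :* (x :* y) := d :* x :* (e :* y)) refl (ι d) (ι e) x y)
      (trans (cong₂ _*_ ex ey) (sym (ι-* u v))))

  loc-neg : ∀ {x} → Loc x → Loc (- x)
  loc-neg {x} (d , u , ud , ex) = d , ℤ.- u , ud ,
    trans (solve 2 (λ d x → d :* :- x := :- (d :* x)) refl (ι d) x)
      (trans (cong -_ ex) (sym (ι-neg u)))

  loc-inv : ∀ {d} → Unit d → Loc (inv d)
  loc-inv {d} ud = d , + 1 , ud , trans (ι-inv d (unit≢0 ud)) (sym ι-1)

  ϖ : K
  ϖ = ι (+ p)

  π : ℕ → K
  π zero    = 1#
  π (suc k) = ϖ * π k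

  π-+ : ∀ j k → π (j ℕ.+ k) ≡ π j * π k
  π-+ zero    k = sym (*-identityˡ _)
  π-+ (suc j) k = trans (*-congˡ (π-+ j k)) (sym (*-assoc _ _ _))

  loc-π : ∀ k → Loc (π k)
  loc-π zero    = loc-1
  loc-π (suc k) = loc-* (loc-ι (+ p)) (loc-π k)

  infix 4 _≈[_]_
  record _≈[_]_ (x : K) (k : ℕ) (y : K) : Set where
    constructor congruent
    field
      quotient : K
      local    : Loc quotient
      equation : x ≡ y + π k * quotient
  open _≈[_]_ public

  ≡⇒≈ : ∀ {k x y} → x ≡ y → x ≈[ k ] y
  ≡⇒≈ {k} {x} refl = congruent 0# loc-0 (sym (trans (+-congˡ (zeroʳ _)) (+-identityʳ x)))

  ≈-refl : ∀ {k x} → x ≈[ k ] x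
  ≈-refl = ≡⇒≈ refl

  ≈-sym : ∀ {k x y} → x ≈[ k ] y → y ≈[ k ] x
  ≈-sym {k} {x} {y} (congruent q l e) = congruent (- q) (loc-neg l) (sym (trans (+-congʳ e)
    (solve 3 (λ y π q → y :+ π :* q :+ π :* :- q := y) refl y (π k) q)))

  ≈-trans : ∀ {k x y z} → x ≈[ k ] y → y ≈[ k ] z → x ≈[ k ] z
  ≈-trans {k} {z = z} (congruent q l e) (congruent r m d) = congruent (r + q) (loc-+ m l)
    (trans e (trans (+-congʳ d)
      (solve 4 (λ z π q r → z :+ π :* r :+ π :* q := z :+ π :* (r :+ q)) refl z (π k) q r)))

  ≈-+ : ∀ {k x x′ y y′} → x ≈[ k ] x′ → y ≈[ k ] y′ → x + y ≈[ k ] x′ + y′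
  ≈-+ {k} {x′ = x} {y′ = y} (congruent q l e) (congruent r m d) = congruent (q + r) (loc-+ l m)
    (trans (cong₂ _+_ e d)
      (solve 5 (λ x y π q r → (x :+ π :* q) :+ (y :+ π :* r) := (x :+ y) :+ π :* (q :+ r)) refl x y (π k) q r))

  ≈-neg : ∀ {k x y} → x ≈[ k ] y → - x ≈[ k ] - y
  ≈-neg {k} {y = y} (congruent q l e) = congruent (- q) (loc-neg l) (trans (cong -_ e)
    (solve 3 (λ y π q → :- (y :+ π :* q) := :- y :+ π :* :- q) refl y (π k) q))

  ≈-loc : ∀ {k x y} → x ≈[ k ] y → Loc y → Loc x
  ≈-loc {k} (congruent q l e) ly = subst Loc (sym e) (loc-+ ly (loc-* (loc-π k) l))

  ≈-*ˡ : ∀ {k z x y} → Loc z → x ≈[ k ] y → z * x ≈[ k ] z * y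
  ≈-*ˡ {k} {z} {y = y} lz (congruent q l e) = congruent (z * q) (loc-* lz l) (trans (*-congˡ e)
    (solve 4 (λ z y π q → z :* (y :+ π :* q) := z :* y :+ π :* (z :* q)) refl z y (π k) q))

  ≈-*ʳ : ∀ {k z x y} → Loc z → x ≈[ k ] y → x * z ≈[ k ] y * z
  ≈-*ʳ {k} lz e = subst₂ (_≈[ k ]_) (*-comm _ _) (*-comm _ _) (≈-*ˡ lz e)

  ≈-* : ∀ {k x x′ y y′} → Loc x′ → Loc y → x ≈[ k ] x′ → y ≈[ k ] y′ → x * y ≈[ k ] x′ * y′
  ≈-* lx ly e d = ≈-trans (≈-*ʳ ly e) (≈-*ˡ lx d)

  ≈-weaken : ∀ j {k x y} → x ≈[ j ℕ.+ k ] y → x ≈[ k ] y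
  ≈-weaken j {k} {y = y} (congruent q l e) = congruent (π j * q) (loc-* (loc-π j) l) (trans e
    (+-congˡ (trans (*-congʳ (π-+ j k))
      (solve 3 (λ a b q → a :* b :* q := b :* (a :* q)) refl (π j) (π k) q))))

  ≈-π : ∀ j {k x y} → x ≈[ k ] y → π j * x ≈[ j ℕ.+ k ] π j * y
  ≈-π j {k} {y = y} (congruent q l e) = congruent q l (trans (*-congˡ e) (trans
    (solve 4 (λ a b y q → a :* (y :+ b :* q) := a :* y :+ a :* b :* q) refl (π j) (π k) y q)
    (+-congˡ (*-congʳ (sym (π-+ j k))))))

  π-null : ∀ k {x} → Loc x → π k * x ≈[ k ] 0#
  π-null k l = congruent _ l (sym (+-identityˡ _))

  π-cancel : ∀ j {x y} → π j * x ≡ π j * y → x ≡ y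
  π-cancel zero e = trans (sym (*-identityˡ _)) (trans e (*-identityˡ _))
  π-cancel (suc j) {x} {y} e = π-cancel j (trans (sym (undo (π j * x)))
      (trans (*-congˡ (trans (sym (*-assoc _ _ _)) (trans e (*-assoc _ _ _)))) (undo (π j * y))))
    where
    p≢0 : + p ≢ + 0
    p≢0 eq = ℕP.<⇒≢ (ℕP.<-trans ℕP.0<1+n 1<p) (sym (ℤP.+-injective eq))
    undo : ∀ z → inv (+ p) * (ϖ * z) ≡ z
    undo z = trans (solve 3 (λ i w z → i :* (w :* z) := w :* i :* z) refl (inv (+ p)) ϖ z)
      (trans (*-congʳ (ι-inv (+ p) p≢0)) (*-identityˡ z))

  ≈-cancel : ∀ j {k x y} → π j * x ≈[ j ℕ.+ k ] π j * y → x ≈[ k ] y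
  ≈-cancel j {k} {x} {y} (congruent q l e) = congruent q l (π-cancel j (trans e (trans
    (+-congˡ (*-congʳ (π-+ j k)))
    (solve 4 (λ a b y q → a :* y :+ a :* b :* q := a :* (y :+ b :* q)) refl (π j) (π k) y q))))

  unit-cancel : ∀ {k d x y} → Unit d → ι d * x ≈[ k ] ι d * y → x ≈[ k ] y
  unit-cancel {k} {d} {x} {y} ud e = subst₂ (_≈[ k ]_) (undo x) (undo y) (≈-*ˡ (loc-inv ud) e)
    where
    undo : ∀ z → inv d * (ι d * z) ≡ z
    undo z = trans (solve 3 (λ i w z → i :* (w :* z) := w :* i :* z) refl (inv d) (ι d) z)
      (trans (*-congʳ (ι-inv d (unit≢0 ud))) (*-identityˡ z))

  unit-small : ∀ n → suc n ℕ.< p → Unit (+ suc n)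
  unit-small n lt = unit (λ h → ℕP.<⇒≱ lt (∣⇒≤ h))

  module Halves (5≤p : 5 ℕ.≤ p) where

    unit-2 : Unit (+ 2)
    unit-2 = unit-small 1 (ℕP.≤-trans (ℕ.s≤s (ℕ.s≤s (ℕ.s≤s ℕ.z≤n))) 5≤p)

    unit-4 : Unit (+ 4)
    unit-4 = unit-small 3 5≤p

    half : K
    half = inv (+ 2)

    half-2 : ∀ x → half * (ι (+ 2) * x) ≡ x
    half-2 x = trans (solve 3 (λ i w z → i :* (w :* z) := w :* i :* z) refl half (ι (+ 2)) x)
      (trans (*-congʳ (ι-inv (+ 2) (λ ()))) (*-identityˡ x))

-- Finite products.

module Products (𝔾 : Ground) where
  open Scalars 𝔾
  open Scalars.Solver 𝔾 using (solve; _:=_; _:*_; _:-_; :-_)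

  ∏ : ℕ → (ℕ → K) → K
  ∏ zero    g = 1#
  ∏ (suc n) g = g 0 * ∏ n (λ i → g (suc i))

  ∏-cong : ∀ n {g h : ℕ → K} → (∀ i → g i ≡ h i) → ∏ n g ≡ ∏ n h
  ∏-cong zero    e = refl
  ∏-cong (suc n) e = cong₂ _*_ (e 0) (∏-cong n (λ i → e (suc i)))

  ∏-* : ∀ n g h → ∏ n (λ i → g i * h i) ≡ ∏ n g * ∏ n h
  ∏-* zero    g h = sym (*-identityˡ _)
  ∏-* (suc n) g h = trans (*-congˡ (∏-* n _ _))
    (solve 4 (λ a b x y → a :* b :* (x :* y) := a :* x :* (b :* y)) refl _ _ _ _)

  ∏-split : ∀ a b g → ∏ (a ℕ.+ b) g ≡ ∏ a g * ∏ b (λ i → g (a ℕ.+ i))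
  ∏-split zero    b g = sym (*-identityˡ _)
  ∏-split (suc a) b g = trans (*-congˡ (∏-split a b _)) (sym (*-assoc _ _ _))

  ∏-last : ∀ n g → ∏ (suc n) g ≡ ∏ n g * g n
  ∏-last zero    g = *-comm _ _
  ∏-last (suc n) g = trans (*-congˡ (∏-last n _)) (sym (*-assoc _ _ _))

  ∏-reverse : ∀ n g h → (∀ i j → i ℕ.+ suc j ≡ n → g i ≡ h j) → ∏ n g ≡ ∏ n h
  ∏-reverse zero    g h e = refl
  ∏-reverse (suc n) g h e = trans
    (cong₂ _*_ (e 0 n refl) (∏-reverse n _ h (λ i j q → e (suc i) j (cong suc q))))
    (trans (*-comm _ _) (sym (∏-last n h)))

  ∏-group : ∀ n g → ∏ (n ℕ.* 3) g
    ≡ ∏ n (λ r → g (r ℕ.* 3) * (g (1 ℕ.+ r ℕ.* 3) * g (2 ℕ.+ r ℕ.* 3)))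
  ∏-group zero    g = refl
  ∏-group (suc n) g = trans
    (solve 4 (λ a b c d → a :* (b :* (c :* d)) := a :* (b :* c) :* d) refl (g 0) (g 1) (g 2) _)
    (*-congˡ (∏-group n (λ i → g (3 ℕ.+ i))))

  ∏-inverse : ∀ n g h → (∀ i → i ℕ.< n → g i * h i ≡ 1#) → ∏ n g * ∏ n h ≡ 1#
  ∏-inverse zero    g h e = *-identityˡ _
  ∏-inverse (suc n) g h e = trans
    (solve 4 (λ a b x y → a :* b :* (x :* y) := a :* x :* (b :* y)) refl _ _ _ _)
    (trans (cong₂ _*_ (e 0 (ℕ.s≤s ℕ.z≤n)) (∏-inverse n _ _ (λ i lt → e (suc i) (ℕ.s≤s lt)))) (*-identityˡ _))

  ∏-square-neg : ∀ n g → ∏ n (λ i → - g i) * ∏ n (λ i → - g i) ≡ ∏ n g * ∏ n g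
  ∏-square-neg zero    g = refl
  ∏-square-neg (suc n) g = trans
    (solve 2 (λ a b → (:- a) :* b :* ((:- a) :* b) := a :* a :* (b :* b)) refl _ _)
    (trans (*-congˡ (∏-square-neg n _))
      (solve 2 (λ a b → a :* a :* (b :* b) := a :* b :* (a :* b)) refl _ _))

-- Functions of m that are p-adically polynomial in p m.

module Representable (𝔾 : Ground) (p : ℕ) (p-prime : Prime p) where
  open Scalars 𝔾
  open Series 𝔾 using (S; tail; _⊛_; _⊕_; const)
  open Localisation 𝔾 p p-prime
  open Products 𝔾
  open Scalars.Solver 𝔾 using (solve; _:=_; _:+_; _:*_; _:-_; :-_; _:^_; con)

  eval : ℕ → S → K → K
  eval zero    c x = 0#
  eval (suc N) c x = c 0 + x * eval N (tail c) x

  eval-cong : ∀ N {c d} x → (∀ i → c i ≡ d i) → eval N c x ≡ eval N d x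
  eval-cong zero    x e = refl
  eval-cong (suc N) x e = cong₂ _+_ (e 0) (*-congˡ (eval-cong N x (λ i → e (suc i))))

  eval-loc : ∀ N {c x} → (∀ i → Loc (c i)) → Loc x → Loc (eval N c x)
  eval-loc zero    lc lx = loc-0
  eval-loc (suc N) lc lx = loc-+ (lc 0) (loc-* lx (eval-loc N (λ i → lc (suc i)) lx))

  eval-+ : ∀ N c d x → eval N (c ⊕ d) x ≡ eval N c x + eval N d x
  eval-+ zero    c d x = sym (+-identityˡ _)
  eval-+ (suc N) c d x = trans (+-congˡ (*-congˡ (eval-+ N (tail c) (tail d) x)))
    (solve 5 (λ a b x u v → (a :+ b) :+ x :* (u :+ v) := (a :+ x :* u) :+ (b :+ x :* v)) refl _ _ x _ _)

  eval-scale : ∀ N a c x → eval N (λ n → a * c n) x ≡ a * eval N c x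
  eval-scale zero    a c x = sym (zeroʳ _)
  eval-scale (suc N) a c x = trans (+-congˡ (*-congˡ (eval-scale N a (tail c) x)))
    (solve 4 (λ a c x e → a :* c :+ x :* (a :* e) := a :* (c :+ x :* e)) refl a _ x _)

  eval-zero : ∀ N x → eval N (λ _ → 0#) x ≡ 0#
  eval-zero zero    x = refl
  eval-zero (suc N) x = trans (+-identityˡ _) (trans (*-congˡ (eval-zero N x)) (zeroʳ x))

  eval-scaled : ∀ N c x → eval N c (ϖ * x) ≡ eval N (λ i → π i * c i) x
  eval-scaled zero    c x = refl
  eval-scaled (suc N) c x = cong₂ _+_ (sym (*-identityˡ (c 0))) (trans (*-congˡ (eval-scaled N (tail c) x))
    (trans (solve 3 (λ w x e → w :* x :* e := x :* (w :* e)) refl ϖ x _)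
      (*-congˡ (trans (sym (eval-scale N ϖ _ x)) (eval-cong N x (λ i → sym (*-assoc _ _ _)))))))

  eval₄ : ∀ c x → eval 4 c x ≡ c 0 + x * (c 1 + x * (c 2 + x * c 3))
  eval₄ c x = cong (λ z → c 0 + x * (c 1 + x * (c 2 + x * z))) (trans (+-congˡ (zeroʳ x)) (+-identityʳ (c 3)))

  private
    ≈-ϖ : ∀ {k x x′} y → Loc y → x ≈[ k ] x′ → ϖ * y * x ≈[ suc k ] ϖ * y * x′
    ≈-ϖ {x = x} {x′} y ly e = subst₂ (_≈[ _ ]_) (rearrange x) (rearrange x′) (≈-*ˡ ly (≈-π 1 e))
      where
      rearrange : ∀ x → y * (ϖ * 1# * x) ≡ ϖ * y * x
      rearrange x = trans (*-congˡ (*-congʳ (*-identityʳ ϖ)))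
        (solve 3 (λ y w x → y :* (w :* x) := w :* y :* x) refl y ϖ x)

  -- At an argument divisible by p the term of degree N is a multiple of p to the N. This is why N
  -- can serve both as the number of coefficients and as the exponent of the modulus, and why
  -- truncated products are harmless in `eval-⊛`.
  eval-drop : ∀ N {c y} → (∀ i → Loc (c i)) → Loc y → eval (suc N) c (ϖ * y) ≈[ N ] eval N c (ϖ * y)
  eval-drop zero    {c} {y} lc ly = congruent _ (eval-loc 1 lc (loc-* (loc-ι (+ p)) ly))
    (sym (trans (+-identityˡ _) (*-identityˡ _)))
  eval-drop (suc N) {c} {y} lc ly = ≈-+ ≈-refl (≈-ϖ y ly (eval-drop N (λ i → lc (suc i)) ly))

  ⊛-loc : ∀ {c d} → (∀ i → Loc (c i)) → (∀ i → Loc (d i)) → ∀ i → Loc ((c ⊛ d) i)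
  ⊛-loc lc ld zero    = loc-* (lc 0) (ld 0)
  ⊛-loc lc ld (suc i) = loc-+ (loc-* (lc 0) (ld (suc i))) (⊛-loc (λ j → lc (suc j)) ld i)

  eval-⊛ : ∀ N {c d y} → (∀ i → Loc (c i)) → (∀ i → Loc (d i)) → Loc y →
    eval N c (ϖ * y) * eval N d (ϖ * y) ≈[ N ] eval N (c ⊛ d) (ϖ * y)
  eval-⊛ zero    lc ld ly = ≡⇒≈ (zeroˡ _)
  eval-⊛ (suc N) {c} {d} {y} lc ld ly = subst₂ (_≈[ suc N ]_)
    (solve 5 (λ c0 d0 x d′ r → c0 :* d0 :+ x :* (c0 :* d′ :+ r :* (d0 :+ x :* d′))
                            := (c0 :+ x :* r) :* (d0 :+ x :* d′))
       refl (c 0) (d 0) x (eval N (tail d) x) (eval N (tail c) x))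
    (cong (λ z → c 0 * d 0 + x * z) (sym (trans
      (eval-+ N (λ i → c 0 * d (suc i)) (tail c ⊛ d) x) (+-congʳ (eval-scale N (c 0) (tail d) x)))))
    (≈-+ ≈-refl (≈-ϖ y ly (≈-+ ≈-refl (≈-trans
      (≈-*ˡ (eval-loc N (λ i → lc (suc i)) lx) (eval-drop N ld ly))
      (eval-⊛ N (λ i → lc (suc i)) ld ly)))))
    where
    x = ϖ * y
    lx = loc-* (loc-ι (+ p)) ly

  -- Functions of m that are polynomials in p m, up to a multiple of p ^ N.
  record Rep (N : ℕ) (f : ℤ → K) : Set where
    constructor rep
    field
      coefficient : S
      loc         : ∀ i → Loc (coefficient i)
      approximate : ∀ m → f m ≈[ N ] eval N coefficient (ϖ * ι m)
  open Rep public

  private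
    x-loc : ∀ m → Loc (ϖ * ι m)
    x-loc m = loc-* (loc-ι (+ p)) (loc-ι m)

  rep-loc : ∀ {N f} → Rep N f → ∀ m → Loc (f m)
  rep-loc {N} (rep c lc e) m = ≈-loc (e m) (eval-loc N lc (x-loc m))

  rep-ext : ∀ {N f g} → (∀ m → g m ≡ f m) → Rep N f → Rep N g
  rep-ext e (rep c lc a) = rep c lc (λ m → ≈-trans (≡⇒≈ (e m)) (a m))

  rep-approx : ∀ {N f g} → (∀ m → g m ≈[ N ] f m) → Rep N f → Rep N g
  rep-approx e (rep c lc a) = rep c lc (λ m → ≈-trans (e m) (a m))

  rep-const : ∀ {N x} → Loc x → Rep N (λ _ → x)
  rep-const {N} {x} lx = rep (const x) (λ { zero → lx ; (suc _) → loc-0 }) (λ m → go N m)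
    where
    go : ∀ N m → x ≈[ N ] eval N (const x) (ϖ * ι m)
    go zero    m = congruent x lx (sym (trans (+-identityˡ _) (*-identityˡ _)))
    go (suc N) m = ≡⇒≈ (sym (trans (+-congˡ (trans (*-congˡ (eval-zero N _)) (zeroʳ _))) (+-identityʳ x)))

  rep-var : ∀ {N} → Rep N (λ m → ϖ * ι m)
  rep-var {N} = rep variable′ (λ { zero → loc-0 ; 1 → loc-1 ; (suc (suc _)) → loc-0 }) (go N)
    where
    variable′ : S
    variable′ zero          = 0#
    variable′ (suc zero)    = 1#
    variable′ (suc (suc _)) = 0#
    go : ∀ N m → ϖ * ι m ≈[ N ] eval N variable′ (ϖ * ι m)
    go zero          m = congruent _ (x-loc m) (sym (trans (+-identityˡ _) (*-identityˡ _)))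
    go (suc zero)    m = congruent (ι m) (loc-ι m)
      (trans (sym (+-identityˡ _)) (cong₂ _+_ (sym (trans (+-identityˡ _) (zeroʳ _))) (*-congʳ (sym (*-identityʳ _)))))
    go (suc (suc N)) m = ≡⇒≈ (sym (trans (+-identityˡ _) (trans
      (*-congˡ (trans (+-congˡ (trans (*-congˡ (eval-zero N _)) (zeroʳ _))) (+-identityʳ _))) (*-identityʳ _))))

  rep-+ : ∀ {N f g} → Rep N f → Rep N g → Rep N (λ m → f m + g m)
  rep-+ {N} (rep c lc a) (rep d ld b) = rep (c ⊕ d) (λ i → loc-+ (lc i) (ld i))
    (λ m → ≈-trans (≈-+ (a m) (b m)) (≡⇒≈ (sym (eval-+ N c d _))))

  rep-* : ∀ {N f g} → Rep N f → Rep N g → Rep N (λ m → f m * g m)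
  rep-* {N} F@(rep c lc a) G@(rep d ld b) = rep (c ⊛ d) (⊛-loc lc ld)
    (λ m → ≈-trans (≈-* (eval-loc N lc (x-loc m)) (rep-loc G m) (a m) (b m)) (eval-⊛ N lc ld (loc-ι m)))

  rep-neg : ∀ {N f} → Rep N f → Rep N (λ m → - f m)
  rep-neg F = rep-ext (λ m → solve 1 (λ x → :- x := con (ℤ.- (+ 1)) :* x) refl _)
                      (rep-* (rep-const (loc-ι (ℤ.- (+ 1)))) F)

  rep-∏ : ∀ {N} n (f : ℕ → ℤ → K) → (∀ i → i ℕ.< n → Rep N (f i)) → Rep N (λ m → ∏ n (λ i → f i m))
  rep-∏ zero    f F = rep-const loc-1
  rep-∏ (suc n) f F = rep-* (F 0 (ℕ.s≤s ℕ.z≤n)) (rep-∏ n (λ i → f (suc i)) (λ i lt → F (suc i) (ℕ.s≤s lt)))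

  loc-∏ : ∀ n g → (∀ i → i ℕ.< n → Loc (g i)) → Loc (∏ n g)
  loc-∏ zero    g l = loc-1
  loc-∏ (suc n) g l = loc-* (l 0 (ℕ.s≤s ℕ.z≤n)) (loc-∏ n _ (λ i lt → l (suc i) (ℕ.s≤s lt)))

  rep-eval : ∀ {N f} n c → (∀ i → Loc (c i)) → Rep N f → Rep N (λ m → eval n c (f m))
  rep-eval zero    c lc F = rep-const loc-0
  rep-eval (suc n) c lc F = rep-+ (rep-const (lc 0)) (rep-* F (rep-eval n (tail c) (λ i → lc (suc i)) F))

  rep-∘ : ∀ {N f} (g : ℤ → ℤ) → Rep N (λ m → ϖ * ι (g m)) → Rep N f → Rep N (λ m → f (g m))
  rep-∘ {N} g G (rep c lc a) = rep-approx (λ m → a (g m)) (rep-eval N c lc G)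

  rep-constant : ∀ {N f} → Rep (suc N) f → ∀ m → f m ≈[ 1 ] f (+ 0)
  rep-constant {N} {f} (rep c lc a) m = ≈-trans (at m) (≈-sym (at (+ 0)))
    where
    at : ∀ m → f m ≈[ 1 ] c 0
    at m = ≈-trans (≈-weaken N (subst (f m ≈[_] eval (suc N) c (ϖ * ι m)) (sym (ℕP.+-comm N 1)) (a m)))
      (congruent (ι m * eval N (tail c) (ϖ * ι m))
        (loc-* (loc-ι m) (eval-loc N (λ i → lc (suc i)) (x-loc m)))
        (+-congˡ (trans (*-assoc _ _ _) (*-congʳ (sym (*-identityʳ ϖ))))))

  private
    power : K → ℕ → K
    power u zero    = 1#
    power u (suc n) = u * power u n

    geometric : K → ℕ → K
    geometric u zero    = 0#
    geometric u (suc n) = 1# + u * geometric u n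

    geometric-sum : ∀ u n → (1# + - u) * geometric u n + power u n ≡ 1#
    geometric-sum u zero    = trans (+-congʳ (zeroʳ _)) (+-identityˡ _)
    geometric-sum u (suc n) = trans
      (solve 3 (λ u g w → (u :^ 0 :+ :- u) :* (u :^ 0 :+ u :* g) :+ u :* w
         := (u :^ 0 :+ :- u) :+ u :* ((u :^ 0 :+ :- u) :* g :+ w)) refl u (geometric u n) (power u n))
      (trans (+-congˡ (*-congˡ (geometric-sum u n)))
        (solve 1 (λ u → (u :^ 0 :+ :- u) :+ u :* u :^ 0 := u :^ 0) refl u))

    rep-geometric : ∀ {N} n {u} → Rep N u → Rep N (λ m → geometric (u m) n)
    rep-geometric zero    U = rep-const loc-0
    rep-geometric (suc n) U = rep-+ (rep-const loc-1) (rep-* U (rep-geometric n U))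

    power-null : ∀ n {u} → u ≈[ 1 ] 0# → power u n ≈[ n ] 0#
    power-null zero    e = congruent 1# loc-1 (sym (trans (+-identityˡ _) (*-identityˡ _)))
    power-null (suc n) (congruent q l e) with power-null n (congruent q l e)
    ... | congruent r l′ e′ = congruent (q * r) (loc-* l l′) (trans (cong₂ _*_ e e′)
      (trans (cong₂ _*_ (trans (+-identityˡ _) (*-congʳ (*-identityʳ ϖ))) (+-identityˡ _))
        (trans (solve 4 (λ w q a r → w :* q :* (a :* r) := w :* a :* (q :* r)) refl ϖ q (π n) r)
          (sym (+-identityˡ _)))))

  -- With u = 1 − g(0) f divisible by p, g = g(0) / (1 − u) is a truncated geometric series.
  rep-inverse : ∀ {N f g} → (∀ m → f m * g m ≡ 1#) → (∀ m → Loc (g m)) → Rep (suc N) f → Rep (suc N) g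
  rep-inverse {N} {f} {g} fg lg F = rep-approx approx
      (rep-* (rep-const (lg (+ 0))) (rep-geometric (suc N) {u} U))
    where
    u : ℤ → K
    u m = 1# + - (g (+ 0) * f m)
    U : Rep (suc N) u
    U = rep-+ (rep-const loc-1) (rep-neg (rep-* (rep-const (lg (+ 0))) F))
    u-null : ∀ m → u m ≈[ 1 ] 0#
    u-null m = ≈-trans (≈-+ ≈-refl (≈-neg (≈-*ˡ (lg (+ 0)) (rep-constant F m))))
      (≡⇒≈ (trans (+-congˡ (cong -_ (trans (*-comm _ _) (fg (+ 0))))) (-‿inverseʳ 1#)))
    approx : ∀ m → g m ≈[ suc N ] g (+ 0) * geometric (u m) (suc N)
    approx m = ≈-trans (≡⇒≈ (sym split)) (≈-trans
        (≈-+ ≈-refl (≈-*ˡ (lg m) (power-null (suc N) (u-null m))))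
        (≡⇒≈ (trans (+-congˡ (zeroʳ _)) (+-identityʳ _))))
      where
      split : g (+ 0) * geometric (u m) (suc N) + g m * power (u m) (suc N) ≡ g m
      split = trans (+-congʳ (sym (*-identityˡ _))) (trans (+-congʳ (*-congʳ (sym (fg m))))
        (trans (solve 5 (λ f g g0 s w → f :* g :* (g0 :* s) :+ g :* w
              := g :* ((f :^ 0 :+ :- (f :^ 0 :+ :- (g0 :* f))) :* s :+ w)) refl
              (f m) (g m) (g (+ 0)) (geometric (u m) (suc N)) (power (u m) (suc N)))
          (trans (*-congˡ (geometric-sum (u m) (suc N))) (*-identityʳ _))))

  -- Congruence modulo p of the polynomials themselves, not only of their values.
  infix 4 _∼[_]_
  record _∼[_]_ (f : ℤ → K) (N : ℕ) (g : ℤ → K) : Set where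
    constructor similar
    field
      difference : ℤ → K
      rep-diff   : Rep N difference
      relation   : ∀ m → f m ≡ g m + ϖ * difference m

  ∼-* : ∀ {N f f′ g g′} → Rep N f′ → Rep N g′ → f ∼[ N ] f′ → g ∼[ N ] g′ →
    (λ m → f m * g m) ∼[ N ] (λ m → f′ m * g′ m)
  ∼-* {f′ = f′} {g′ = g′} F G (similar r R e) (similar s T d) = similar
    (λ m → f′ m * s m + (r m * g′ m + ϖ * (r m * s m)))
    (rep-+ (rep-* F T) (rep-+ (rep-* R G) (rep-* (rep-const (loc-ι (+ p))) (rep-* R T))))
    (λ m → trans (cong₂ _*_ (e m) (d m))
      (solve 5 (λ f r g s w → (f :+ w :* r) :* (g :+ w :* s) := f :* g :+ w :* (f :* s :+ (r :* g :+ w :* (r :* s))))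
         refl (f′ m) (r m) (g′ m) (s m) ϖ))

  ∼-∏ : ∀ {N} n (f g : ℕ → ℤ → K) → (∀ i → Rep N (g i)) → (∀ i → f i ∼[ N ] g i) →
    (λ m → ∏ n (λ i → f i m)) ∼[ N ] (λ m → ∏ n (λ i → g i m))
  ∼-∏ zero    f g G e = similar (λ _ → 0#) (rep-const loc-0)
    (λ _ → sym (trans (+-congˡ (zeroʳ ϖ)) (+-identityʳ _)))
  ∼-∏ (suc n) f g G e = ∼-* (G 0) (rep-∏ n _ (λ i _ → G (suc i))) (e 0)
    (∼-∏ n (λ i → f (suc i)) (λ i → g (suc i)) (λ i → G (suc i)) (λ i → e (suc i)))

  ∼-≡ : ∀ {N f g h} → f ∼[ N ] g → (∀ m → g m ≡ h m) → f ∼[ N ] h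
  ∼-≡ (similar r R e) d = similar r R (λ m → trans (e m) (+-congʳ (d m)))

-- One period of p consecutive hypergeometric coefficients.

module Block (𝔾 : Ground) (q : ℕ) (p-prime : Prime (suc q)) where
  open Scalars 𝔾
  open Hypergeometric 𝔾
  open Products 𝔾
  open Scalars.Solver 𝔾 using (solve; _:=_; _:+_; _:*_; _:-_; :-_; _:^_; con)

  p : ℕ
  p = suc q

  open Localisation 𝔾 p p-prime public
  open Representable 𝔾 p p-prime public

  -- The denominator met at step i of the period that starts at p m. It is prime to p for i < q, and
  -- equals p (m + 1) for i = q. Negative m are allowed because the reflection m ↦ -1 - m leaves ℕ.
  residue : ℕ → ℤ → ℤ
  residue i m = + suc i ℤ.+ + p ℤ.* m

  residue-unit : ∀ i m → i ℕ.< q → Unit (residue i m)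
  residue-unit i m lt = unit (λ h → ℕP.<⇒≱ (ℕ.s≤s lt) (∣⇒≤ (ℤD.∣⇒∣ᵤ {+ p} {+ suc i}
    (ℤD.∣m+n∣n⇒∣m (ℤD.∣ᵤ⇒∣ {+ p} {residue i m} h) (ℤD.∣m⇒∣m*n m ℤD.∣-refl)))))

  ι-residue : ∀ i m → ι (residue i m) ≡ ϖ * ι m + n̂ (suc i)
  ι-residue i m = trans (ι-+ (+ suc i) (+ p ℤ.* m)) (trans (+-congˡ (ι-* (+ p) m)) (+-comm _ _))

  n̂-+ : ∀ i j → n̂ (i ℕ.+ j) ≡ n̂ i + n̂ j
  n̂-+ i j = ι-+ (+ i) (+ j)

  n̂-* : ∀ i j → n̂ (i ℕ.* j) ≡ n̂ i * n̂ j
  n̂-* i j = trans (cong ι (ℤP.pos-* i j)) (ι-* (+ i) (+ j))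

  -- The polynomial (x + 1) ⋯ (x + p − 1) and its inverse at multiples of p.
  w : K → K
  w x = ∏ q (λ i → x + n̂ (suc i))

  winv : ℤ → K
  winv m = ∏ q (λ i → inv (residue i m))

  w-winv : ∀ m → w (ϖ * ι m) * winv m ≡ 1#
  w-winv m = ∏-inverse q _ _ (λ i lt → trans (*-congʳ (sym (ι-residue i m)))
    (ι-inv (residue i m) (unit≢0 (residue-unit i m lt))))

  winv-loc : ∀ m → Loc (winv m)
  winv-loc m = loc-∏ q _ (λ i lt → loc-inv (residue-unit i m lt))

  rep-w : ∀ {N} → Rep N (λ m → w (ϖ * ι m))
  rep-w = rep-∏ q _ (λ i _ → rep-+ rep-var (rep-const (loc-ι (+ suc i))))

  rep-winv : ∀ {N} → Rep (suc N) winv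
  rep-winv = rep-inverse w-winv winv-loc rep-w

  rep-inv-residue : ∀ {N} i → i ℕ.< q → Rep (suc N) (λ m → inv (residue i m))
  rep-inv-residue i lt = rep-inverse
    (λ m → ι-inv (residue i m) (unit≢0 (residue-unit i m lt)))
    (λ m → loc-inv (residue-unit i m lt))
    (rep-ext (ι-residue i) (rep-+ rep-var (rep-const (loc-ι (+ suc i)))))

  3^q : K
  3^q = ∏ q (λ _ → ι (+ 3))

  loc-3^q : Loc 3^q
  loc-3^q = loc-∏ q _ (λ _ _ → loc-ι (+ 3))

  reflect : K → K
  reflect x = - ϖ + - x

  -- Under x ↦ -p - x the factor x + j becomes -(x + p - j). Squaring disposes of the sign, so its
  -- parity never has to be discussed.
  w-reflect : ∀ x → w (reflect x) * w (reflect x) ≡ w x * w x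
  w-reflect x = trans (cong (λ z → z * z) (∏-reverse q _ (λ j → - (x + n̂ (suc j))) opposite)) (∏-square-neg q _)
    where
    opposite : ∀ i j → i ℕ.+ suc j ≡ q → reflect x + n̂ (suc i) ≡ - (x + n̂ (suc j))
    opposite i j e = trans (cong (λ z → - z + - x + n̂ (suc i)) (trans (cong n̂ (cong suc (sym e))) (n̂-+ (suc i) (suc j))))
      (solve 3 (λ a b x → :- (a :+ b) :+ :- x :+ a := :- (x :+ b)) refl (n̂ (suc i)) (n̂ (suc j)) x)

  mirror : ℤ → ℤ
  mirror m = ℤ.- (+ 1 ℤ.+ m)

  ι-mirror : ∀ m → ι (mirror m) ≡ - (ι (+ 1) + ι m)
  ι-mirror m = trans (ι-neg _) (cong -_ (ι-+ (+ 1) m))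

  reflect-mirror : ∀ m → ϖ * ι (mirror m) ≡ reflect (ϖ * ι m)
  reflect-mirror m = trans (*-congˡ (ι-mirror m))
    (solve 2 (λ w m → w :* :- (con (+ 1) :+ m) := :- w :+ :- (w :* m)) refl ϖ (ι m))

  W : ℤ → K
  W m = w (ϖ * ι m) * w (ϖ * ι m)

  rep-W : ∀ {N} → Rep N W
  rep-W = rep-* rep-w rep-w

  W-mirror : ∀ m → W (mirror m) ≡ W m
  W-mirror m = trans (cong (λ z → w z * w z) (reflect-mirror m)) (w-reflect (ϖ * ι m))

  W-inverse : ∀ m → W m * (winv m * winv m) ≡ 1#
  W-inverse m = trans (solve 2 (λ a b → a :* a :* (b :* b) := a :* b :* (a :* b)) refl (w (ϖ * ι m)) (winv m))
    (trans (cong (λ z → z * z) (w-winv m)) (*-identityˡ 1#))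

  pronic : K → K
  pronic m = m * (m + ι (+ 1))

  -- Parameters of the series with numerators 3 n + c: the numerator at n₀ is c⋆ p.
  module Numerator (n₀ n₁ c c⋆ : ℕ) (size : n₀ ℕ.+ n₁ ≡ q) (balance : 3 ℕ.* n₀ ℕ.+ c ≡ c⋆ ℕ.* p) where

    p-split : p ≡ n₀ ℕ.+ suc n₁
    p-split = trans (cong suc (sym size)) (sym (ℕP.+-suc n₀ n₁))

    line : ℕ → K → K
    line r x = ι (+ 3) * (x + n̂ r) + n̂ c

    -- The line with index n₀ is left out: at x = p m it equals p (3 m + c⋆), the only one divisible
    -- by p, and it supplies the numerator of `hyp c⋆`.
    num : K → K
    num x = ∏ n₀ (λ r → line r x) * ∏ n₁ (λ r → line (suc n₀ ℕ.+ r) x)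

    line-n₀ : ∀ x → line n₀ x ≡ ι (+ 3) * x + n̂ c⋆ * ϖ
    line-n₀ x = trans (solve 3 (λ x n c → con (+ 3) :* (x :+ n) :+ c := con (+ 3) :* x :+ (con (+ 3) :* n :+ c)) refl x (n̂ n₀) (n̂ c))
      (+-congˡ (trans (sym (trans (n̂-+ (3 ℕ.* n₀) c) (+-congʳ (n̂-* 3 n₀)))) (trans (cong n̂ balance) (n̂-* c⋆ p))))

    ∏-line : ∀ x → ∏ p (λ r → line r x) ≡ num x * (ι (+ 3) * x + n̂ c⋆ * ϖ)
    ∏-line x = trans (cong (λ k → ∏ k (λ r → line r x)) p-split)
      (trans (∏-split n₀ (suc n₁) (λ r → line r x))
      (trans (*-congˡ (cong₂ _*_ (trans (cong (λ k → line k x) (ℕP.+-identityʳ n₀)) (line-n₀ x))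
                                 (∏-cong n₁ (λ i → cong (λ k → line k x) (ℕP.+-suc n₀ i)))))
        (solve 3 (λ a b d → a :* (b :* d) := a :* d :* b) refl _ _ _)))

    rep-line : ∀ {N} r → Rep N (λ m → line r (ϖ * ι m))
    rep-line r = rep-+ (rep-* (rep-const (loc-ι (+ 3))) (rep-+ rep-var (rep-const (loc-ι (+ r)))))
                       (rep-const (loc-ι (+ c)))

    rep-num : ∀ {N} → Rep N (λ m → num (ϖ * ι m))
    rep-num = rep-* (rep-∏ n₀ _ (λ i _ → rep-line i)) (rep-∏ n₁ _ (λ i _ → rep-line (suc n₀ ℕ.+ i)))

    -- Modulo p the lines 3 (x + r) + c, r ≠ n₀, are the 3 (x + j), 0 < j < p.
    num∼w : ∀ {N} → (λ m → num (ϖ * ι m)) ∼[ N ] (λ m → 3^q * w (ϖ * ι m))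
    num∼w {N} = ∼-≡ both join
      where
      three : ℕ → ℤ → K
      three i m = ι (+ 3) * (ϖ * ι m + n̂ (suc i))
      rep-three : ∀ i → Rep N (three i)
      rep-three i = rep-* (rep-const (loc-ι (+ 3))) (rep-+ rep-var (rep-const (loc-ι (+ suc i))))
      3n₀ : ι (+ 3) * n̂ n₀ + n̂ c ≡ n̂ c⋆ * ϖ
      3n₀ = trans (sym (trans (n̂-+ (3 ℕ.* n₀) c) (+-congʳ (n̂-* 3 n₀)))) (trans (cong n̂ balance) (n̂-* c⋆ p))
      split : ϖ ≡ n̂ n₀ + n̂ (suc n₁)
      split = trans (cong n̂ p-split) (n̂-+ n₀ (suc n₁))
      high-eq : ∀ i m → line (suc n₀ ℕ.+ i) (ϖ * ι m) ≡ three i m + ϖ * n̂ c⋆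
      high-eq i m = trans
        (cong (λ z → ι (+ 3) * (ϖ * ι m + z) + n̂ c)
          (trans (cong n̂ (sym (ℕP.+-suc n₀ i))) (n̂-+ n₀ (suc i))))
        (trans (solve 4 (λ x n s c → con (+ 3) :* (x :+ (n :+ s)) :+ c := con (+ 3) :* (x :+ s) :+ (con (+ 3) :* n :+ c))
                 refl (ϖ * ι m) (n̂ n₀) (n̂ (suc i)) (n̂ c))
          (+-congˡ (trans 3n₀ (*-comm _ _))))
      -- For r < n₀ the difference r - n₀ is negative, so p is added to it to land in 1, ..., p - 1,
      -- at n₁ + 1 + r. The correction -3 p joins the c⋆ p from `balance`.
      low-eq : ∀ i m → line i (ϖ * ι m) ≡ three (n₁ ℕ.+ i) m + ϖ * (n̂ c⋆ + - ι (+ 3))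
      low-eq i m = sym (trans
        (cong₂ (λ u v → ι (+ 3) * (ϖ * ι m + u) + v)
           (n̂-+ (suc n₁) i)
           (trans (distribˡ ϖ (n̂ c⋆) (- ι (+ 3))) (+-congʳ (trans (*-comm _ _) (sym 3n₀)))))
        (trans (cong (λ z → ι (+ 3) * (ϖ * ι m + (n̂ (suc n₁) + n̂ i)) + (ι (+ 3) * n̂ n₀ + n̂ c + z * - ι (+ 3))) split)
          (solve 5 (λ x u i n c → con (+ 3) :* (x :+ (u :+ i)) :+ (con (+ 3) :* n :+ c :+ (n :+ u) :* :- con (+ 3))
               := con (+ 3) :* (x :+ i) :+ c) refl (ϖ * ι m) (n̂ (suc n₁)) (n̂ i) (n̂ n₀) (n̂ c))))
      high : ∀ i → (λ m → line (suc n₀ ℕ.+ i) (ϖ * ι m)) ∼[ N ] three i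
      high i = similar (λ _ → n̂ c⋆) (rep-const (loc-ι (+ c⋆))) (high-eq i)
      low : ∀ i → (λ m → line i (ϖ * ι m)) ∼[ N ] three (n₁ ℕ.+ i)
      low i = similar (λ _ → n̂ c⋆ + - ι (+ 3)) (rep-const (loc-+ (loc-ι (+ c⋆)) (loc-neg (loc-ι (+ 3))))) (low-eq i)
      lows : (λ m → ∏ n₀ (λ r → line r (ϖ * ι m))) ∼[ N ] (λ m → ∏ n₀ (λ i → three (n₁ ℕ.+ i) m))
      lows = ∼-∏ n₀ (λ r m → line r (ϖ * ι m)) (λ i → three (n₁ ℕ.+ i)) (λ i → rep-three (n₁ ℕ.+ i)) low
      highs : (λ m → ∏ n₁ (λ r → line (suc n₀ ℕ.+ r) (ϖ * ι m))) ∼[ N ] (λ m → ∏ n₁ (λ i → three i m))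
      highs = ∼-∏ n₁ (λ r m → line (suc n₀ ℕ.+ r) (ϖ * ι m)) three rep-three high
      both : (λ m → num (ϖ * ι m)) ∼[ N ] (λ m → ∏ n₀ (λ i → three (n₁ ℕ.+ i) m) * ∏ n₁ (λ i → three i m))
      both = ∼-* (rep-∏ n₀ (λ i → three (n₁ ℕ.+ i)) (λ i _ → rep-three (n₁ ℕ.+ i)))
                 (rep-∏ n₁ three (λ i _ → rep-three i)) lows highs
      join : ∀ m → ∏ n₀ (λ i → three (n₁ ℕ.+ i) m) * ∏ n₁ (λ i → three i m) ≡ 3^q * w (ϖ * ι m)
      join m = trans (*-comm _ _) (trans (sym (∏-split n₁ n₀ (λ i → three i m)))
        (trans (cong (λ k → ∏ k (λ i → three i m)) (trans (ℕP.+-comm n₁ n₀) size))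
          (∏-* q (λ _ → ι (+ 3)) (λ i → ϖ * ι m + n̂ (suc i)))))

    ε : ℤ → K
    ε m = 3^q * (num (ϖ * ι m) * num (ϖ * ι m)) * (winv m * winv m)

    rep-ε : ∀ {N} → Rep (suc N) ε
    rep-ε = rep-* (rep-* (rep-const loc-3^q) (rep-* rep-num rep-num)) (rep-* rep-winv rep-winv)

    -- Modulo p each `num` is 3^q w, and w cancels against `winv`. Having the congruence for
    -- polynomials in p m, not only for values, gives every nonconstant coefficient a further factor
    -- p; this produces the p² in `ε-near`.
    ε∼const : ∀ {N} → ε ∼[ suc N ] (λ _ → 3^q * (3^q * 3^q))
    ε∼const {N} = go num∼w
      where
      go : (λ m → num (ϖ * ι m)) ∼[ suc N ] (λ m → 3^q * w (ϖ * ι m)) → ε ∼[ suc N ] (λ _ → 3^q * (3^q * 3^q))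
      go (similar r R e) = similar
        (λ m → 3^q * (r m * winv m * (ι (+ 2) * 3^q + ϖ * (r m * winv m))))
        (rep-* (rep-const loc-3^q) (rep-* (rep-* R rep-winv) (rep-+ (rep-const (loc-* (loc-ι (+ 2)) loc-3^q))
          (rep-* (rep-const (loc-ι (+ p))) (rep-* R rep-winv)))))
        (λ m → trans (cong (λ z → 3^q * (z * z) * (winv m * winv m)) (e m)) (trans
          (solve 5 (λ t w v r k → t :* ((t :* w :+ k :* r) :* (t :* w :+ k :* r)) :* (v :* v)
              := t :* ((t :* (w :* v) :+ k :* (r :* v)) :* (t :* (w :* v) :+ k :* (r :* v))))
             refl 3^q (w (ϖ * ι m)) (winv m) (r m) ϖ)
          (trans (cong (λ z → 3^q * ((3^q * z + ϖ * (r m * winv m)) * (3^q * z + ϖ * (r m * winv m)))) (w-winv m))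
            (solve 3 (λ t s k → t :* ((t :* s :^ 0 :+ k :* s) :* (t :* s :^ 0 :+ k :* s))
                := t :* (t :* t) :+ k :* (t :* (s :* (con (+ 2) :* t :+ k :* s)))) refl 3^q (r m * winv m) ϖ))))

    step : ℕ → ℤ → K
    step r m = ι (+ 3) * (line r (ϖ * ι m) * line r (ϖ * ι m)) * (inv (residue r m) * inv (residue r m))

    hyp-prod : ∀ r m → hyp c (r ℕ.+ m ℕ.* p) ≡ hyp c (m ℕ.* p) * ∏ r (λ i → step i (+ m))
    hyp-prod zero    m = sym (*-identityʳ _)
    hyp-prod (suc r) m = trans (cong₂ _*_ (cong₂ _*_ (hyp-prod r m)
        (cong (λ z → ι (+ 3) * (z * z)) (cong (λ z → ι (+ 3) * z + n̂ c) index)))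
        (cong (λ z → inv z * inv z) index′))
      (trans (solve 4 (λ h a b d → h :* a :* b :* d := h :* (a :* (b :* d))) refl
                (hyp c (m ℕ.* p)) (∏ r (λ i → step i (+ m))) _ _)
             (*-congˡ (sym (∏-last r (λ i → step i (+ m))))))
      where
      index : n̂ (r ℕ.+ m ℕ.* p) ≡ ϖ * ι (+ m) + n̂ r
      index = trans (n̂-+ r (m ℕ.* p)) (trans (+-comm _ _) (+-congʳ (trans (n̂-* m p) (*-comm _ _))))
      index′ : + suc (r ℕ.+ m ℕ.* p) ≡ residue r (+ m)
      index′ = trans (cong (λ z → + suc (r ℕ.+ z)) (ℕP.*-comm m p)) (cong (ℤ._+_ (+ suc r)) (ℤP.pos-* p m))

    private
      inv-unique : ∀ i x → i ≢ + 0 → ι i * x ≡ 1# → x ≡ inv i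
      inv-unique i x nz e = trans (sym (*-identityʳ x)) (trans (*-congˡ (sym (ι-inv i nz)))
        (trans (solve 3 (λ x a b → x :* (a :* b) := a :* x :* b) refl x (ι i) (inv i))
          (trans (*-congʳ e) (*-identityˡ _))))

      inv-last : ∀ m → inv (residue q (+ m)) ≡ inv (+ suc m) * inv (+ p)
      inv-last m = sym (inv-unique (residue q (+ m)) _ nz (trans (*-congʳ value)
          (trans (solve 4 (λ a b x y → a :* b :* (x :* y) := b :* x :* (a :* y)) refl ϖ (n̂ (suc m)) _ _)
            (trans (cong₂ _*_ (n̂-inv m) (ι-inv (+ p) (λ ()))) (*-identityˡ _)))))
        where
        nat : residue q (+ m) ≡ + (p ℕ.* suc m)
        nat = trans (cong (ℤ._+_ (+ p)) (sym (ℤP.pos-* p m))) (cong +_ (sym (ℕP.*-suc p m)))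
        nz : residue q (+ m) ≢ + 0
        nz eq with trans (sym nat) eq
        ... | ()
        value : ι (residue q (+ m)) ≡ ϖ * n̂ (suc m)
        value = trans (cong ι nat) (n̂-* p (suc m))

    -- One period contributes ε, up to the factor by which the series with parameter c⋆ advances.
    hyp-block : ∀ m → hyp c (suc m ℕ.* p)
      ≡ hyp c (m ℕ.* p) * (ι (+ 3) * (linear c⋆ m * linear c⋆ m) * (inv (+ suc m) * inv (+ suc m))) * ε (+ m)
    hyp-block m = trans (hyp-prod p m) (trans (*-congˡ product) (sym (*-assoc _ _ _)))
      where
      x = ϖ * ι (+ m)
      product : ∏ p (λ i → step i (+ m))
        ≡ ι (+ 3) * (linear c⋆ m * linear c⋆ m) * (inv (+ suc m) * inv (+ suc m)) * ε (+ m)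
      product = trans (trans (∏-* p (λ i → ι (+ 3) * (ℓ i * ℓ i)) (λ i → ν i * ν i)) (cong₂ _*_
            (trans (∏-* p (λ _ → ι (+ 3)) (λ i → ℓ i * ℓ i)) (cong₂ _*_ (∏-last q (λ _ → ι (+ 3)))
              (trans (∏-* p ℓ ℓ) (cong₂ _*_ (∏-line x) (∏-line x)))))
            (trans (∏-* p ν ν) (cong₂ _*_ invs invs))))
        (trans (cong (λ z → 3^q * ι (+ 3) * (num x * z * (num x * z))
                       * (winv (+ m) * (inv (+ suc m) * inv (+ p)) * (winv (+ m) * (inv (+ suc m) * inv (+ p))))) last)
        (trans (solve 8 (λ t n l k v i j o →
              t :* con (+ 3) :* (n :* (k :* l) :* (n :* (k :* l))) :* (v :* (i :* j) :* (v :* (i :* j)))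
              := (k :* j) :* (k :* j) :* (con (+ 3) :* (l :* l) :* (i :* i) :* (t :* (n :* n) :* (v :* v))))
              refl 3^q (num x) (linear c⋆ m) ϖ (winv (+ m)) (inv (+ suc m)) (inv (+ p)) 1#)
          (trans (*-congʳ (trans (cong (λ z → z * z) (ι-inv (+ p) (λ ()))) (*-identityˡ _))) (*-identityˡ _))))
        where
        ℓ ν : ℕ → K
        ℓ i = line i x
        ν i = inv (residue i (+ m))
        invs : ∏ p ν ≡ winv (+ m) * (inv (+ suc m) * inv (+ p))
        invs = trans (∏-last q ν) (*-congˡ (inv-last m))
        last : ι (+ 3) * x + n̂ c⋆ * ϖ ≡ ϖ * linear c⋆ m
        last = solve 3 (λ k m c → con (+ 3) :* (k :* m) :+ c :* k := k :* (con (+ 3) :* m :+ c)) refl ϖ (n̂ m) (n̂ c⋆)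

    G : ℕ → K
    G zero    = 1#
    G (suc m) = G m * ε (+ m)

    -- Telescopes `hyp-block`. In Dwork's terminology c⋆/3 is the prime of c/3: the difference p
    -- c⋆/3 - c/3 is the integer n₀, which lies between 0 and p - 1.
    hyp-G : ∀ m → hyp c (m ℕ.* p) ≡ hyp c⋆ m * G m
    hyp-G zero    = sym (*-identityˡ _)
    hyp-G (suc m) = trans (hyp-block m) (trans (*-congʳ (*-congʳ (hyp-G m)))
      (solve 5 (λ h g a b e → h :* g :* (a :* b) :* e := h :* a :* b :* (g :* e)) refl
        (hyp c⋆ m) (G m) _ _ (ε (+ m))))

    hyp-section : ∀ r m → hyp c (r ℕ.+ m ℕ.* p) ≡ hyp c⋆ m * (G m * ∏ r (λ i → step i (+ m)))
    hyp-section r m = trans (hyp-prod r m) (trans (*-congʳ (hyp-G m)) (*-assoc _ _ _))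

    rep-step : ∀ {N} r → r ℕ.< q → Rep (suc N) (step r)
    rep-step r lt = rep-* (rep-* (rep-const (loc-ι (+ 3))) (rep-* (rep-line r) (rep-line r)))
      (rep-* (rep-inv-residue r lt) (rep-inv-residue r lt))

    loc-G : ∀ m → Loc (G m)
    loc-G zero    = loc-1
    loc-G (suc m) = loc-* (loc-G m) (rep-loc (rep-ε {0}) (+ m))

    loc-section : ∀ r m → r ℕ.≤ q → Loc (G m * ∏ r (λ i → step i (+ m)))
    loc-section r m le = loc-* (loc-G m)
      (loc-∏ r _ (λ i lt → rep-loc (rep-step {0} i (ℕP.<-≤-trans lt le)) (+ m)))

-- Reflection and triplication; the factor G modulo p⁴.

module Reflection (𝔾 : Ground) (q : ℕ) (p-prime : Prime (suc q))
  (n₀ n₁ c c′ : ℕ) (size : n₀ ℕ.+ n₁ ≡ q)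
  (balance : 3 ℕ.* n₀ ℕ.+ c ≡ 1 ℕ.* suc q) (balance′ : 3 ℕ.* n₁ ℕ.+ c′ ≡ 2 ℕ.* suc q)
  (c+c′ : c ℕ.+ c′ ≡ 3) where

  open Scalars 𝔾
  open Hypergeometric 𝔾 hiding (X; rhs)
  open Products 𝔾
  open Block 𝔾 q p-prime
  open Scalars.Solver 𝔾 using (solve; _:=_; _:+_; _:*_; _:-_; :-_; _:^_; con)

  module N  = Numerator n₀ n₁ c 1 size balance
  module N′ = Numerator n₁ n₀ c′ 2 (trans (ℕP.+-comm n₁ n₀) size) balance′

  -- When r + r′ = p - 1 and c + c′ = 3, replacing x by -p - x turns 3 (x + r) + c into -(3 (x + r′)
  -- + c′). The omitted index n₀ goes to the omitted index n₁, and squaring removes the signs.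
  num-reflect : ∀ x → N.num (reflect x) * N.num (reflect x) ≡ N′.num x * N′.num x
  num-reflect x = trans
    (solve 2 (λ a b → a :* b :* (a :* b) := b :* b :* (a :* a)) refl
      (∏ n₀ (λ r → N.line r (reflect x))) (∏ n₁ (λ r → N.line (suc n₀ ℕ.+ r) (reflect x))))
    (trans (cong₂ _*_ (flip n₁ _ _ high) (flip n₀ _ _ low))
      (solve 2 (λ a b → a :* a :* (b :* b) := a :* b :* (a :* b)) refl _ _))
    where
    flip : ∀ n (g h : ℕ → K) → (∀ i j → i ℕ.+ suc j ≡ n → g i ≡ - h j) → ∏ n g * ∏ n g ≡ ∏ n h * ∏ n h
    flip n g h e = trans (cong (λ z → z * z) (∏-reverse n g (λ j → - h j) e)) (∏-square-neg n h)
    opposite : ∀ r r′ → r ℕ.+ suc r′ ≡ p → N.line r (reflect x) ≡ - N′.line r′ x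
    opposite r r′ e = trans
      (solve 7 (λ w x r s o c d → con (+ 3) :* ((:- w :+ :- x) :+ r) :+ c
            := (con (+ 3) :* (r :+ s :+ :- w) :+ (c :+ d)) :+ :- (con (+ 3) :* (x :+ s) :+ d) )
            refl ϖ x (n̂ r) (n̂ r′) 1# (n̂ c) (n̂ c′))
      (trans (+-congʳ (trans (cong₂ (λ u v → ι (+ 3) * u + v) total (trans (sym (n̂-+ c c′)) (cong n̂ c+c′)))
          (trans (solve 1 (λ z → con (+ 3) :* (:- con (+ 1)) :+ con (+ 3) := z :+ :- z) refl 0#) (-‿inverseʳ 0#))))
        (+-identityˡ _))
      where
      total : n̂ r + n̂ r′ + - ϖ ≡ - ι (+ 1)
      total = trans (cong (λ z → n̂ r + n̂ r′ + - z) (trans (cong n̂ (sym e)) (trans (n̂-+ r (suc r′)) (+-congˡ (trans (n̂-suc r′) (+-congˡ (sym ι-1)))))))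
        (solve 2 (λ a b → a :+ b :+ :- (a :+ (b :+ con (+ 1))) := :- con (+ 1)) refl (n̂ r) (n̂ r′))
    high : ∀ i j → i ℕ.+ suc j ≡ n₁ → N.line (suc n₀ ℕ.+ i) (reflect x) ≡ - N′.line j x
    high i j e = opposite (suc n₀ ℕ.+ i) j (cong suc (trans (ℕP.+-assoc n₀ i (suc j)) (trans (cong (n₀ ℕ.+_) e) size)))
    low : ∀ i j → i ℕ.+ suc j ≡ n₀ → N.line i (reflect x) ≡ - N′.line (suc n₁ ℕ.+ j) x
    low i j e = opposite i (suc n₁ ℕ.+ j) (trans (cong (i ℕ.+_) (cong suc (sym (ℕP.+-suc n₁ j))))
      (trans (solveℕ i n₁ j) (trans (cong (λ z → suc (n₁ ℕ.+ z)) e) (cong suc (trans (ℕP.+-comm n₁ n₀) size)))))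
      where
      solveℕ : ∀ i n j → i ℕ.+ suc (n ℕ.+ suc j) ≡ suc (n ℕ.+ (i ℕ.+ suc j))
      solveℕ i n j = trans (ℕP.+-suc i _) (cong suc (trans (sym (ℕP.+-assoc i n (suc j)))
        (trans (cong (ℕ._+ suc j) (ℕP.+-comm i n)) (ℕP.+-assoc n i (suc j)))))

  -- The residues of 3 x + k, 0 < k ≤ 3 p, sorted by k modulo p and by k modulo 3.
  sorted : ∀ x → let X = ι (+ 3) * x in
    w X * (X + ϖ) * (w (X + ϖ) * (X + ϖ + ϖ) * (w (X + ϖ + ϖ) * (X + ϖ + ϖ + ϖ)))
    ≡ ∏ p (λ r → ι (+ 3) * (x + n̂ r) + n̂ 1) * ∏ p (λ r → ι (+ 3) * (x + n̂ r) + n̂ 2) * (3^q * ι (+ 3) * (w x * (x + ϖ)))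
  sorted x = trans (sym by-p) (trans (cong (λ k → ∏ k g) (ℕP.*-comm 3 p)) (trans (∏-group p g) by-3))
    where
    X = ι (+ 3) * x
    g : ℕ → K
    g k = X + n̂ (suc k)
    segment : ∀ Y h → (∀ i → h i ≡ Y + n̂ (suc i)) → ∏ p h ≡ w Y * (Y + ϖ)
    segment Y h e = trans (∏-cong p e) (∏-last q _)
    by-p : ∏ (3 ℕ.* p) g ≡ w X * (X + ϖ) * (w (X + ϖ) * (X + ϖ + ϖ) * (w (X + ϖ + ϖ) * (X + ϖ + ϖ + ϖ)))
    by-p = trans (∏-split p (p ℕ.+ (p ℕ.+ 0)) g) (cong₂ _*_ (segment X g (λ _ → refl))
      (trans (∏-split p (p ℕ.+ 0) (λ i → g (p ℕ.+ i))) (cong₂ _*_ (segment (X + ϖ) _ (λ i → shift₁ i))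
        (trans (∏-split p 0 (λ i → g (p ℕ.+ (p ℕ.+ i)))) (trans (*-identityʳ _) (segment (X + ϖ + ϖ) _ shift₂))))))
      where
      up : ∀ i → n̂ (suc (p ℕ.+ i)) ≡ ϖ + n̂ (suc i)
      up i = trans (cong n̂ (sym (ℕP.+-suc p i))) (n̂-+ p (suc i))
      shift₁ : ∀ i → g (p ℕ.+ i) ≡ X + ϖ + n̂ (suc i)
      shift₁ i = trans (+-congˡ (up i)) (sym (+-assoc _ _ _))
      shift₂ : ∀ i → g (p ℕ.+ (p ℕ.+ i)) ≡ X + ϖ + ϖ + n̂ (suc i)
      shift₂ i = trans (+-congˡ (trans (up (p ℕ.+ i)) (+-congˡ (up i))))
        (solve 3 (λ x w i → x :+ (w :+ (w :+ i)) := x :+ w :+ w :+ i) refl X ϖ (n̂ (suc i)))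
    by-3 : ∏ p (λ r → g (r ℕ.* 3) * (g (1 ℕ.+ r ℕ.* 3) * g (2 ℕ.+ r ℕ.* 3)))
      ≡ ∏ p (λ r → ι (+ 3) * (x + n̂ r) + n̂ 1) * ∏ p (λ r → ι (+ 3) * (x + n̂ r) + n̂ 2) * (3^q * ι (+ 3) * (w x * (x + ϖ)))
    by-3 = trans (∏-cong p (λ r → trans
        (cong₂ _*_ (at 1 r) (cong₂ _*_ (at 2 r) (at 3 r)))
        (sym (*-assoc _ _ _))))
      (trans (∏-* p (λ r → l₁ r * l₂ r) l₃) (cong₂ _*_ (∏-* p l₁ l₂)
        (trans (∏-cong p (λ r → trans (solve 2 (λ x r → con (+ 3) :* (x :+ r) :+ con (+ 3) := con (+ 3) :* (x :+ (r :+ con (+ 1)))) refl x (n̂ r))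
              (cong (λ z → ι (+ 3) * (x + z)) (trans (+-congˡ ι-1) (sym (n̂-suc r))))))
          (trans (∏-* p (λ _ → ι (+ 3)) (λ r → x + n̂ (suc r))) (cong₂ _*_ (∏-last q (λ _ → ι (+ 3))) (∏-last q (λ r → x + n̂ (suc r))))))))
      where
      l₁ l₂ l₃ : ℕ → K
      l₁ r = ι (+ 3) * (x + n̂ r) + n̂ 1
      l₂ r = ι (+ 3) * (x + n̂ r) + n̂ 2
      l₃ r = ι (+ 3) * (x + n̂ r) + n̂ 3
      at : ∀ a r → X + n̂ (a ℕ.+ r ℕ.* 3) ≡ ι (+ 3) * (x + n̂ r) + n̂ a
      at a r = trans (+-congˡ (trans (n̂-+ a (r ℕ.* 3)) (+-congˡ (n̂-* r 3))))
        (solve 3 (λ x r a → con (+ 3) :* x :+ (a :+ r :* con (+ 3)) := con (+ 3) :* (x :+ r) :+ a) refl x (n̂ r) (n̂ a))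

  module _ (lines : ∀ x → ∏ p (λ r → ι (+ 3) * (x + n̂ r) + n̂ 1) * ∏ p (λ r → ι (+ 3) * (x + n̂ r) + n̂ 2)
                        ≡ ∏ p (λ r → N.line r x) * ∏ p (λ r → N′.line r x)) where

    -- `sorted` after cancelling the three factors that are divisible by p on each side. Their
    -- product `D` is a nonzero integer because m is a natural number, which is why x is restricted
    -- to multiples p m.
    triplication : ∀ m → let x = ϖ * n̂ m ; X = ι (+ 3) * x in
      3^q * (N.num x * N′.num x) * w x ≡ w X * w (X + ϖ) * w (X + ϖ + ϖ)
    triplication m = unit-free (trans (sym rhs′) (trans (sym (trans (sorted x) (*-congʳ (trans (lines x) (cong₂ _*_ (N.∏-line x) (N′.∏-line x))))) ) lhs))
      where
      x = ϖ * n̂ m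
      X = ι (+ 3) * x
      D : K
      D = (X + ϖ) * (X + ϖ + ϖ) * (X + ϖ + ϖ + ϖ)
      lhs : w X * (X + ϖ) * (w (X + ϖ) * (X + ϖ + ϖ) * (w (X + ϖ + ϖ) * (X + ϖ + ϖ + ϖ))) ≡ D * (w X * w (X + ϖ) * w (X + ϖ + ϖ))
      lhs = solve 6 (λ a b c d e f → a :* b :* (c :* d :* (e :* f)) := b :* d :* f :* (a :* c :* e)) refl _ _ _ _ _ _
      rhs′ : N.num x * (ι (+ 3) * x + n̂ 1 * ϖ) * (N′.num x * (ι (+ 3) * x + n̂ 2 * ϖ)) * (3^q * ι (+ 3) * (w x * (x + ϖ)))
          ≡ D * (3^q * (N.num x * N′.num x) * w x)
      rhs′ = solve 6 (λ a b t w x k → a :* (con (+ 3) :* x :+ con (+ 1) :* k) :* (b :* (con (+ 3) :* x :+ con (+ 2) :* k)) :* (t :* con (+ 3) :* (w :* (x :+ k)))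
          := ((con (+ 3) :* x :+ k) :* (con (+ 3) :* x :+ k :+ k) :* (con (+ 3) :* x :+ k :+ k :+ k)) :* (t :* (a :* b) :* w))
          refl (N.num x) (N′.num x) 3^q (w x) x ϖ
      d : ℕ
      d = (p ℕ.* (1 ℕ.+ 3 ℕ.* m)) ℕ.* (p ℕ.* (2 ℕ.+ 3 ℕ.* m)) ℕ.* (p ℕ.* (3 ℕ.+ 3 ℕ.* m))
      factor : ∀ a → n̂ (p ℕ.* (a ℕ.+ 3 ℕ.* m)) ≡ ϖ * (n̂ a + ι (+ 3) * n̂ m)
      factor a = trans (n̂-* p _) (*-congˡ (trans (n̂-+ a (3 ℕ.* m)) (+-congˡ (n̂-* 3 m))))
      D≡ : n̂ d ≡ D
      D≡ = trans (n̂-* _ (p ℕ.* (3 ℕ.+ 3 ℕ.* m))) (trans (*-congʳ (n̂-* (p ℕ.* (1 ℕ.+ 3 ℕ.* m)) _))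
        (trans (cong₂ _*_ (cong₂ _*_ (factor 1) (factor 2)) (factor 3))
          (solve 2 (λ k m → (k :* (con (+ 1) :+ con (+ 3) :* m)) :* (k :* (con (+ 2) :+ con (+ 3) :* m)) :* (k :* (con (+ 3) :+ con (+ 3) :* m))
            := (con (+ 3) :* (k :* m) :+ k) :* (con (+ 3) :* (k :* m) :+ k :+ k) :* (con (+ 3) :* (k :* m) :+ k :+ k :+ k)) refl ϖ (n̂ m))))
      unit-free : ∀ {y z} → D * y ≡ D * z → y ≡ z
      unit-free {y} {z} e = trans (sym (undo y)) (trans (*-congˡ e) (undo z))
        where
        undo : ∀ y → inv (+ d) * (D * y) ≡ y
        undo y = trans (cong (λ u → inv (+ d) * (u * y)) (sym D≡))
          (trans (solve 3 (λ i w z → i :* (w :* z) := w :* i :* z) refl (inv (+ d)) (n̂ d) y)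
            (trans (*-congʳ (ι-inv (+ d) (λ ()))) (*-identityˡ y)))

    E : ℕ → K
    E m = N.ε (+ m) * N.ε (mirror (+ m))

    -- By `num-reflect` the mirrored ε has the numerator `N′.num` in place of `N.num`, so the
    -- product of the two ε contains the square of the left side of `triplication`. Thus E, unlike
    -- ε, is expressed through W alone.
    E-W : ∀ m → E m * (W (+ m) * W (+ m) * W (+ m)) ≡ W (+ (3 ℕ.* m)) * W (+ (1 ℕ.+ 3 ℕ.* m)) * W (+ (2 ℕ.+ 3 ℕ.* m))
    E-W m = trans
      (solve 6 (λ t n v n′ v′ W → t :* n :* v :* (t :* n′ :* v′) :* (W :* W :* W)
          := t :* t :* (n :* n′) :* W :* ((W :* v) :* (W :* v′)))
        refl 3^q (N.num x * N.num x) (winv (+ m) * winv (+ m)) (N.num (ϖ * ι (mirror (+ m))) * N.num (ϖ * ι (mirror (+ m))))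
        (winv (mirror (+ m)) * winv (mirror (+ m))) (W (+ m)))
      (trans (cong₂ (λ a b → 3^q * 3^q * (N.num x * N.num x * a) * W (+ m) * b)
          (trans (cong (λ z → N.num z * N.num z) (reflect-mirror (+ m))) (num-reflect x))
          (trans (cong₂ _*_ (W-inverse (+ m)) (trans (*-congʳ (sym (W-mirror (+ m)))) (W-inverse (mirror (+ m))))) (*-identityˡ 1#)))
      (trans (solve 5 (λ t n n′ w o → t :* t :* (n :* n :* (n′ :* n′)) :* (w :* w) :* o
            := (t :* (n :* n′) :* w) :* (t :* (n :* n′) :* w) :* o)
          refl 3^q (N.num x) (N′.num x) (w x) 1#)
      (trans (*-identityʳ _) (trans (cong (λ z → z * z) (triplication m))
      (trans (solve 3 (λ a b c → a :* b :* c :* (a :* b :* c) := a :* a :* (b :* b) :* (c :* c)) refl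
                (w (ι (+ 3) * x)) (w (ι (+ 3) * x + ϖ)) (w (ι (+ 3) * x + ϖ + ϖ)))
        (cong₂ _*_ (cong₂ _*_ (at 0 (solve 2 (λ w m → con (+ 3) :* (w :* m) := w :* (con (+ 0) :+ con (+ 3) :* m)) refl ϖ (n̂ m)))
          (at 1 (solve 2 (λ w m → con (+ 3) :* (w :* m) :+ w := w :* (con (+ 1) :+ con (+ 3) :* m)) refl ϖ (n̂ m))))
          (at 2 (solve 2 (λ w m → con (+ 3) :* (w :* m) :+ w :+ w := w :* (con (+ 2) :+ con (+ 3) :* m)) refl ϖ (n̂ m)))))))))
      where
      x = ϖ * n̂ m
      at : ∀ a {y} → y ≡ ϖ * (n̂ a + ι (+ 3) * n̂ m) → w y * w y ≡ W (+ (a ℕ.+ 3 ℕ.* m))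
      at a e = cong (λ z → w z * w z) (trans e (*-congˡ (sym (trans (n̂-+ a (3 ℕ.* m)) (+-congˡ (n̂-* 3 m))))))

    -- 1 + p² a, modulo p⁴; such numbers multiply by adding the a's.
    Near : K → K → Set
    Near a x = x ≈[ 4 ] 1# + π 2 * a

    near-loc : ∀ {a x} → Loc a → Near a x → Loc x
    near-loc la n = ≈-loc n (loc-+ loc-1 (loc-* (loc-π 2) la))

    near-* : ∀ {a b x y} → Loc a → Loc b → Near a x → Near b y → Near (a + b) (x * y)
    near-* {a} {b} la lb nx ny = ≈-trans
      (≈-* (loc-+ loc-1 (loc-* (loc-π 2) la)) (near-loc lb ny) nx ny)
      (congruent (a * b) (loc-* la lb)
        (trans (solve 4 (λ a b w o → (w :^ 0 :+ w :* (w :* w :^ 0) :* a) :* (w :^ 0 :+ w :* (w :* w :^ 0) :* b)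
           := (w :^ 0 :+ w :* (w :* w :^ 0) :* (a :+ b)) :+ w :* (w :* (w :* (w :* w :^ 0))) :* (a :* b)) refl a b ϖ 1#) refl))

    near-unique : ∀ {a b x} → Near a x → Near b x → a ≈[ 2 ] b
    near-unique {a} {b} na nb = ≈-cancel 2 (subst₂ (_≈[ 4 ]_) (drop a) (drop b)
      (≈-+ (≈-trans (≈-sym na) nb) (≈-refl { x = - 1# })))
      where
      drop : ∀ a → 1# + π 2 * a + - 1# ≡ π 2 * a
      drop a = solve 2 (λ o x → o :+ x :+ :- o := x) refl 1# (π 2 * a)

    near-shift : ∀ {a b x} → a ≈[ 2 ] b → Near a x → Near b x
    near-shift e n = ≈-trans n (≈-+ ≈-refl (≈-π 2 e))

    module Estimate (5≤p : 5 ℕ.≤ p) where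
      open Halves 5≤p

      -- Modulo p⁴, W is a cubic polynomial in x = p m. It equals the mean of itself and its mirror
      -- image, and x ↦ -p - x leaves in that mean only a constant and a multiple of p² m (m + 1).
      -- Dividing by W(0) makes the constant 1.
      W-quadratic : ∃[ β ] Loc β × ∀ m → Near (β * pronic (ι m)) (W m * (winv (+ 0) * winv (+ 0)))
      W-quadratic = go rep-W
        where
        v = winv (+ 0) * winv (+ 0)
        lv : Loc v
        lv = loc-* (winv-loc (+ 0)) (winv-loc (+ 0))
        go : Rep 4 W → ∃[ β ] Loc β × ∀ m → Near (β * pronic (ι m)) (W m * v)
        go (rep k lk a) = half * b * v , loc-* (loc-* (loc-inv unit-2) lb) lv , near
          where
          s b : K
          s = ι (+ 2) * k 0 + - (ϖ * k 1) + ϖ * ϖ * k 2 + - (ϖ * ϖ * ϖ * k 3)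
          b = ι (+ 2) * k 2 + - (ι (+ 3) * ϖ * k 3)
          lb : Loc b
          lb = loc-+ (loc-* (loc-ι (+ 2)) (lk 2)) (loc-neg (loc-* (loc-* (loc-ι (+ 3)) (loc-ι (+ p))) (lk 3)))
          double : ∀ m → ι (+ 2) * W m ≈[ 4 ] s + π 2 * (b * pronic (ι m))
          double m = ≈-trans
            (≡⇒≈ (trans (solve 1 (λ x → con (+ 2) :* x := x :+ x) refl (W m)) (+-congˡ (sym (W-mirror m)))))
            (≈-trans (≈-+ (a m) (a (mirror m))) (≡⇒≈ (trans
              (cong₂ _+_ (eval₄ k (ϖ * ι m)) (trans (eval₄ k _)
                (cong (λ z → k 0 + z * (k 1 + z * (k 2 + z * k 3))) (*-congˡ (ι-mirror m)))))
              (solve 6 (λ w m a b c d →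
                 let x = w :* m ; y = w :* :- (con (+ 1) :+ m) in
                 (a :+ x :* (b :+ x :* (c :+ x :* d))) :+ (a :+ y :* (b :+ y :* (c :+ y :* d)))
                 := (con (+ 2) :* a :+ :- (w :* b) :+ w :* w :* c :+ :- (w :* w :* w :* d))
                    :+ w :* (w :* w :^ 0) :* ((con (+ 2) :* c :+ :- (con (+ 3) :* w :* d)) :* (m :* (m :+ con (+ 1)))))
                 refl ϖ (ι m) (k 0) (k 1) (k 2) (k 3)))))
          at-0 : ι (+ 2) * W (+ 0) ≈[ 4 ] s
          at-0 = ≈-trans (double (+ 0)) (≡⇒≈ (trans
            (cong (λ z → s + π 2 * (b * (z * (z + ι (+ 1))))) ι-0)
            (trans (+-congˡ (trans (*-congˡ (trans (*-congˡ (zeroˡ _)) (zeroʳ b))) (zeroʳ _))) (+-identityʳ s))))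
          near : ∀ m → Near (half * b * v * pronic (ι m)) (W m * v)
          near m = subst₂ (_≈[ 4 ]_)
            (trans (solve 4 (λ h W v t → h :* v :* (t :* W) := h :* (t :* (W :* v))) refl half (W m) v (ι (+ 2))) (half-2 (W m * v)))
            (trans (solve 6 (λ h v t W P x → h :* v :* (t :* W :+ P :* x) := h :* (t :* (W :* v)) :+ P :* (h :* v :* x)) refl
                half v (ι (+ 2)) (W (+ 0)) (π 2) (b * pronic (ι m)))
              (cong₂ _+_ (trans (half-2 (W (+ 0) * v)) (W-inverse (+ 0)))
                (cong (π 2 *_) (solve 4 (λ h v b y → h :* v :* (b :* y) := h :* b :* v :* y) refl half v b (pronic (ι m))))))
            (≈-*ˡ (loc-* (loc-inv unit-2) lv) (≈-trans (double m) (≈-+ (≈-sym at-0) ≈-refl)))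

      private
        β : K
        β = proj₁ W-quadratic
        lβ : Loc β
        lβ = proj₁ (proj₂ W-quadratic)
        U : ℤ → K
        U m = W m * (winv (+ 0) * winv (+ 0))
        U-near : ∀ m → Near (β * pronic (ι m)) (U m)
        U-near = proj₂ (proj₂ W-quadratic)
        lpr : ∀ m → Loc (β * pronic (ι m))
        lpr m = loc-* lβ (loc-* (loc-ι m) (loc-+ (loc-ι m) (loc-ι (+ 1))))

      E-near : ∀ m → let n = ι (+ m) in
        Near (β * (pronic (ι (+ (3 ℕ.* m))) + pronic (ι (+ (1 ℕ.+ 3 ℕ.* m))) + pronic (ι (+ (2 ℕ.+ 3 ℕ.* m)))
                   + - (ι (+ 3) * pronic n))) (E m)
      E-near m = subst (λ a → Near a (E m)) gather (≈-trans (≈-sym E≈) (≈-trans (≡⇒≈ regroup) prod-near))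
        where
        P₀ = pronic (ι (+ (3 ℕ.* m)))
        P₁ = pronic (ι (+ (1 ℕ.+ 3 ℕ.* m)))
        P₂ = pronic (ι (+ (2 ℕ.+ 3 ℕ.* m)))
        y  = pronic (ι (+ m))
        γ  = - (β * y + β * y + β * y)
        -- `ν` is 1 - 3 p² β m (m + 1), an inverse of (W(m) / W(0))³ modulo p⁴; multiplying by it
        -- isolates E without dividing a congruence.
        ν : K
        ν = 1# + π 2 * γ
        lγ : Loc γ
        lγ = loc-neg (loc-+ (loc-+ (lpr (+ m)) (lpr (+ m))) (lpr (+ m)))
        loc-E : Loc (E m)
        loc-E = loc-* (rep-loc (N.rep-ε {0}) (+ m)) (rep-loc (N.rep-ε {0}) (mirror (+ m)))
        three : Near (β * y + β * y + β * y + γ) (U (+ m) * U (+ m) * U (+ m) * ν)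
        three = near-* (loc-+ (loc-+ (lpr (+ m)) (lpr (+ m))) (lpr (+ m))) lγ
          (near-* (loc-+ (lpr (+ m)) (lpr (+ m))) (lpr (+ m)) (near-* (lpr (+ m)) (lpr (+ m)) (U-near (+ m)) (U-near (+ m))) (U-near (+ m)))
          ≈-refl
        one : U (+ m) * U (+ m) * U (+ m) * ν ≈[ 4 ] 1#
        one = ≈-trans three (≡⇒≈ (trans (+-congˡ (trans (*-congˡ (-‿inverseʳ _)) (zeroʳ _))) (+-identityʳ 1#)))
        E≈ : E m * (U (+ m) * U (+ m) * U (+ m) * ν) ≈[ 4 ] E m
        E≈ = ≈-trans (≈-*ˡ loc-E one) (≡⇒≈ (*-identityʳ (E m)))
        regroup : E m * (U (+ m) * U (+ m) * U (+ m) * ν)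
          ≡ U (+ (3 ℕ.* m)) * U (+ (1 ℕ.+ 3 ℕ.* m)) * U (+ (2 ℕ.+ 3 ℕ.* m)) * ν
        regroup = trans (solve 4 (λ e w v n → e :* ((w :* v) :* (w :* v) :* (w :* v) :* n) := (e :* (w :* w :* w)) :* (v :* v :* v) :* n)
            refl (E m) (W (+ m)) (winv (+ 0) * winv (+ 0)) ν)
          (trans (cong (λ z → z * (v * v * v) * ν) (E-W m))
            (solve 5 (λ a b c v n → a :* b :* c :* (v :* v :* v) :* n := (a :* v) :* (b :* v) :* (c :* v) :* n) refl _ _ _ v ν))
          where
          v = winv (+ 0) * winv (+ 0)
        prod-near : Near (β * P₀ + β * P₁ + β * P₂ + γ) (U (+ (3 ℕ.* m)) * U (+ (1 ℕ.+ 3 ℕ.* m)) * U (+ (2 ℕ.+ 3 ℕ.* m)) * ν)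
        prod-near = near-* (loc-+ (loc-+ (lpr _) (lpr _)) (lpr _)) lγ
          (near-* (loc-+ (lpr _) (lpr _)) (lpr _) (near-* (lpr _) (lpr _) (U-near _) (U-near _)) (U-near _)) ≈-refl
        gather : β * P₀ + β * P₁ + β * P₂ + γ ≡ β * (P₀ + P₁ + P₂ + - (ι (+ 3) * y))
        gather = solve 5 (λ b x y z u → b :* x :+ b :* y :+ b :* z :+ :- (b :* u :+ b :* u :+ b :* u)
            := b :* (x :+ y :+ z :+ :- (con (+ 3) :* u))) refl β P₀ P₁ P₂ y

      -- The bracket in `E-near` is 24 m (m + 1) + 8, hence 8 at m = 0 and 56 at m = 1. Two values
      -- suffice because ε(m) ε(-1 - m) depends on m only through m (m + 1).
      E₀-near : Near (ι (+ 8) * β) (E 0)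
      E₀-near = subst (λ a → Near a (E 0)) (solve 1 (λ b →
          b :* (con (+ 0) :* (con (+ 0) :+ con (+ 1)) :+ con (+ 1) :* (con (+ 1) :+ con (+ 1)) :+ con (+ 2) :* (con (+ 2) :+ con (+ 1)) :+ :- (con (+ 3) :* (con (+ 0) :* (con (+ 0) :+ con (+ 1)))))
          := con (+ 8) :* b) refl β) (E-near 0)

      E₁-near : Near (ι (+ 56) * β) (E 1)
      E₁-near = subst (λ a → Near a (E 1)) (solve 1 (λ b →
          b :* (con (+ 3) :* (con (+ 3) :+ con (+ 1)) :+ con (+ 4) :* (con (+ 4) :+ con (+ 1)) :+ con (+ 5) :* (con (+ 5) :+ con (+ 1)) :+ :- (con (+ 3) :* (con (+ 1) :* (con (+ 1) :+ con (+ 1)))))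
          := con (+ 56) :* b) refl β) (E-near 1)

      private
        κ : K
        κ = 3^q * (3^q * 3^q)

      -- Fermat's congruence for 27, obtained from `triplication` at m = 0: modulo p both `num` are
      -- 3^q w and all values of w agree, and w(0) is a unit.
      κ-unit : κ ≈[ 1 ] 1#
      κ-unit = subst₂ (_≈[ 1 ]_)
        (trans (solve 3 (λ t w v → v :* v :* v :* (t :* (t :* w :* (t :* w)) :* w) := t :* (t :* t) :* ((w :* v) :* (w :* v) :* (w :* v)))
            refl 3^q w₀ v₀)
          (trans (*-congˡ w₀v₀³) (*-identityʳ κ)))
        (trans (solve 2 (λ w v → v :* v :* v :* (w :* w :* w) := (w :* v) :* (w :* v) :* (w :* v)) refl w₀ v₀) w₀v₀³)
        (≈-*ˡ (loc-* (loc-* lv lv) lv) core)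
        where
        w₀ = w (ϖ * ι (+ 0))
        v₀ = winv (+ 0)
        lv = winv-loc (+ 0)
        lw : ∀ m → Loc (w (ϖ * ι m))
        lw = rep-loc (rep-w {0})
        w₀v₀³ : (w₀ * v₀) * (w₀ * v₀) * (w₀ * v₀) ≡ 1#
        w₀v₀³ = trans (cong (λ z → z * z * z) (w-winv (+ 0))) (trans (*-congʳ (*-identityˡ 1#)) (*-identityˡ 1#))
        similar⇒≈ : ∀ {f g} → f ∼[ 1 ] g → ∀ m → f m ≈[ 1 ] g m
        similar⇒≈ (similar d D e) m = congruent (d m) (rep-loc D m) (trans (e m) (+-congˡ (*-congʳ (sym (*-identityʳ ϖ)))))
        w≈ : ∀ m {y} → y ≡ ϖ * ι m → w y ≈[ 1 ] w₀
        w≈ m e = ≈-trans (≡⇒≈ (cong w e)) (rep-constant {0} rep-w m)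
        left : 3^q * (N.num (ϖ * n̂ 0) * N′.num (ϖ * n̂ 0)) * w₀ ≈[ 1 ] 3^q * (3^q * w₀ * (3^q * w₀)) * w₀
        left = ≈-*ʳ (lw (+ 0)) (≈-*ˡ loc-3^q (≈-* (loc-* loc-3^q (lw (+ 0))) (rep-loc (N′.rep-num {0}) (+ 0))
          (similar⇒≈ (N.num∼w {1}) (+ 0)) (similar⇒≈ (N′.num∼w {1}) (+ 0))))
        X₀ = ι (+ 3) * (ϖ * n̂ 0)
        right : w X₀ * w (X₀ + ϖ) * w (X₀ + ϖ + ϖ) ≈[ 1 ] w₀ * w₀ * w₀
        right = ≈-* (loc-* (lw (+ 0)) (lw (+ 0))) (≈-loc w2 (lw (+ 0)))
            (≈-* (lw (+ 0)) (≈-loc w1 (lw (+ 0)))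
              (w≈ (+ 0) (solve 1 (λ w → con (+ 3) :* (w :* con (+ 0)) := w :* con (+ 0)) refl ϖ)) w1) w2
          where
          w1 = w≈ (+ 1) (solve 1 (λ w → con (+ 3) :* (w :* con (+ 0)) :+ w := w :* con (+ 1)) refl ϖ)
          w2 = w≈ (+ 2) (solve 1 (λ w → con (+ 3) :* (w :* con (+ 0)) :+ w :+ w := w :* con (+ 2)) refl ϖ)
        core : 3^q * (3^q * w₀ * (3^q * w₀)) * w₀ ≈[ 1 ] w₀ * w₀ * w₀
        core = ≈-trans (≈-sym left) (≈-trans (≡⇒≈ (triplication 0)) right)

      private
        2-cancel : ∀ {k x y} → ι (+ 2) * x ≈[ k ] ι (+ 2) * y → x ≈[ k ] y
        2-cancel = unit-cancel unit-2

        -- With e = 1 + p g, the square is 1 + 2 p g modulo p², so p divides g.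
        root-one : ∀ {e} → e ≈[ 1 ] 1# → e * e ≈[ 2 ] 1# → ∃[ f ] Loc f × e ≡ 1# + π 2 * f
        root-one {e} (congruent g lg eq) sq = finish (2-cancel (≈-cancel 1 (subst₂ (_≈[ 2 ]_)
            (trans (cong (λ z → z * z + - 1# + - (π 2 * (g * g))) eq)
              (solve 2 (λ g w → (w :^ 0 :+ (w :* w :^ 0) :* g) :* (w :^ 0 :+ (w :* w :^ 0) :* g) :+ :- (w :^ 0) :+ :- (w :* (w :* w :^ 0) :* (g :* g))
                 := (w :* w :^ 0) :* (con (+ 2) :* g)) refl g ϖ))
            (solve 2 (λ w z → w :^ 0 :+ :- (w :^ 0) :+ :- (z :* con (+ 0)) := (w :* w :^ 0) :* (con (+ 2) :* con (+ 0))) refl ϖ (π 2))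
            (≈-+ (≈-+ sq ≈-refl) (≈-neg (≈-trans (π-null 2 (loc-* lg lg)) (≡⇒≈ (sym (trans (*-congˡ ι-0) (zeroʳ _))))))))))
          where
          finish : g ≈[ 1 ] ι (+ 0) → ∃[ f ] Loc f × e ≡ 1# + π 2 * f
          finish (congruent f lf d) = f , lf , trans eq (+-congˡ (trans (*-congˡ d)
            (solve 2 (λ w f → (w :* w :^ 0) :* (con (+ 0) :+ (w :* w :^ 0) :* f) := w :* (w :* w :^ 0) :* f) refl ϖ f)))

      -- `ε∼const` makes ε constant modulo p², with value e. Then e² ≡ ε(0) ε(-1) = E(0) ≡ 1 modulo
      -- p², and e ≡ κ ≡ 1 modulo p selects the right square root.
      ε-near : ∃[ f ] ∃[ d₁ ] ∃[ d₂ ] Loc f × Loc d₁ × Loc d₂ ×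
        (∀ m → Near (f + d₁ * ι m + ϖ * d₂ * (ι m * ι m)) (N.ε m))
      ε-near = go (N.ε∼const {2})
        where
        go : N.ε ∼[ 3 ] (λ _ → κ) → ∃[ f ] ∃[ d₁ ] ∃[ d₂ ] Loc f × Loc d₁ × Loc d₂ ×
          (∀ m → Near (f + d₁ * ι m + ϖ * d₂ * (ι m * ι m)) (N.ε m))
        go (similar d (rep k lk a) rel) = finish (root-one e-unit e-square)
          where
          e : K
          e = κ + ϖ * k 0
          le : Loc e
          le = loc-+ (loc-* loc-3^q (loc-* loc-3^q loc-3^q)) (loc-* (loc-ι (+ p)) (lk 0))
          e-unit : e ≈[ 1 ] 1#
          e-unit = ≈-trans (≈-+ κ-unit (≈-trans (≡⇒≈ (*-congʳ (sym (*-identityʳ ϖ)))) (π-null 1 (lk 0)))) (≡⇒≈ (+-identityʳ 1#))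
          slope : ℤ → K
          slope m = k 1 * ι m + ϖ * k 2 * (ι m * ι m)
          lslope : ∀ m → Loc (slope m)
          lslope m = loc-+ (loc-* (lk 1) (loc-ι m)) (loc-* (loc-* (loc-ι (+ p)) (lk 2)) (loc-* (loc-ι m) (loc-ι m)))
          value : ∀ m → N.ε m ≈[ 4 ] e + π 2 * slope m
          value m = ≈-trans (≡⇒≈ (rel m)) (≈-trans (≈-+ ≈-refl (≈-trans (≡⇒≈ (*-congʳ (sym (*-identityʳ ϖ)))) (≈-π 1 (a m))))
            (≡⇒≈ (trans (cong (λ z → κ + π 1 * (k 0 + ϖ * ι m * (k 1 + ϖ * ι m * z))) (trans (+-congˡ (zeroʳ _)) (+-identityʳ (k 2))))
              (solve 6 (λ κ w m a b c → κ :+ (w :* w :^ 0) :* (a :+ w :* m :* (b :+ w :* m :* c))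
                 := κ :+ w :* a :+ w :* (w :* w :^ 0) :* (b :* m :+ w :* c :* (m :* m))) refl κ ϖ (ι m) (k 0) (k 1) (k 2)))))
          constant : ∀ m → N.ε m ≈[ 2 ] e
          constant m = ≈-trans (≈-weaken 2 (value m)) (≈-trans (≈-+ ≈-refl (π-null 2 (lslope m))) (≡⇒≈ (+-identityʳ e)))
          e-square : e * e ≈[ 2 ] 1#
          e-square = ≈-trans (≈-sym (≈-* le (rep-loc (N.rep-ε {0}) (mirror (+ 0))) (constant (+ 0)) (constant (mirror (+ 0)))))
            (≈-trans (≈-weaken 2 E₀-near) (≈-trans (≈-+ ≈-refl (π-null 2 (loc-* (loc-ι (+ 8)) lβ))) (≡⇒≈ (+-identityʳ 1#))))
          finish : ∃[ f ] Loc f × e ≡ 1# + π 2 * f → ∃[ f ] ∃[ d₁ ] ∃[ d₂ ] Loc f × Loc d₁ × Loc d₂ ×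
            (∀ m → Near (f + d₁ * ι m + ϖ * d₂ * (ι m * ι m)) (N.ε m))
          finish (f , lf , ef) = f , k 1 , k 2 , lf , lk 1 , lk 2 , λ m → ≈-trans (value m)
            (≡⇒≈ (trans (+-congʳ ef) (solve 5 (λ o P f a b → o :+ P :* f :+ P :* (a :+ b) := o :+ P :* (f :+ a :+ b)) refl 1# (π 2) f _ _)))

      -- E(0) and E(1) determine ε: its quadratic coefficient is 12 β.
      G-near : ∃[ a ] ∃[ b ] Loc a × Loc b × (∀ m → Near (a * (n̂ m * n̂ m) + b * (n̂ m * n̂ m * n̂ m)) (N.G m))
      G-near = go ε-near
        where
        go : ∃[ f ] ∃[ d₁ ] ∃[ d₂ ] Loc f × Loc d₁ × Loc d₂ × (∀ m → Near (f + d₁ * ι m + ϖ * d₂ * (ι m * ι m)) (N.ε m)) →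
          ∃[ a ] ∃[ b ] Loc a × Loc b × (∀ m → Near (a * (n̂ m * n̂ m) + b * (n̂ m * n̂ m * n̂ m)) (N.G m))
        go (f , d₁ , d₂ , lf , l₁ , l₂ , ε≈) = a , b , la , lb , grow
          where
          -- Summing f + d₁ j + 12 β j² over j < m gives a cubic in m without constant term. Its
          -- linear coefficient is f - (a + b), which `start` shows to vanish modulo p²; `a` and `b`
          -- are the coefficients of m² and m³.
          a b : K
          a = half * (d₁ + - (ι (+ 12) * β))
          b = ι (+ 4) * β
          la : Loc a
          la = loc-* (loc-inv unit-2) (loc-+ l₁ (loc-neg (loc-* (loc-ι (+ 12)) lβ)))
          lb : Loc b
          lb = loc-* (loc-ι (+ 4)) lβ
          lwd₂ : Loc (ϖ * d₂)
          lwd₂ = loc-* (loc-ι (+ p)) l₂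
          form : K → K
          form x = f + d₁ * x + ϖ * d₂ * (x * x)
          lform : ∀ m → Loc (form (ι m))
          lform m = loc-+ (loc-+ lf (loc-* l₁ (loc-ι m))) (loc-* lwd₂ (loc-* (loc-ι m) (loc-ι m)))
          both : ∀ m → Near (form (ι (+ m)) + form (ι (mirror (+ m)))) (E m)
          both m = near-* (lform (+ m)) (lform (mirror (+ m))) (ε≈ (+ m)) (ε≈ (mirror (+ m)))
          at-0 : ι (+ 2) * f + - d₁ + ϖ * d₂ ≈[ 2 ] ι (+ 8) * β
          at-0 = ≈-trans (≡⇒≈ (solve 3 (λ f a b → con (+ 2) :* f :+ :- a :+ b
              := (f :+ a :* con (+ 0) :+ b :* (con (+ 0) :* con (+ 0))) :+ (f :+ a :* con (ℤ.- + 1) :+ b :* (con (ℤ.- + 1) :* con (ℤ.- + 1)))) refl f d₁ (ϖ * d₂)))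
            (near-unique (both 0) E₀-near)
          at-1 : ι (+ 2) * f + - d₁ + ι (+ 5) * (ϖ * d₂) ≈[ 2 ] ι (+ 56) * β
          at-1 = ≈-trans (≡⇒≈ (solve 3 (λ f a b → con (+ 2) :* f :+ :- a :+ con (+ 5) :* b
              := (f :+ a :* con (+ 1) :+ b :* (con (+ 1) :* con (+ 1))) :+ (f :+ a :* con (ℤ.- + 2) :+ b :* (con (ℤ.- + 2) :* con (ℤ.- + 2)))) refl f d₁ (ϖ * d₂)))
            (near-unique (both 1) E₁-near)
          quad : ϖ * d₂ ≈[ 2 ] ι (+ 12) * β
          quad = unit-cancel unit-4 (subst₂ (_≈[ 2 ]_)
            (solve 3 (λ f a b → con (+ 2) :* f :+ :- a :+ con (+ 5) :* b :+ :- (con (+ 2) :* f :+ :- a :+ b) := con (+ 4) :* b) refl f d₁ (ϖ * d₂))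
            (solve 1 (λ b → con (+ 56) :* b :+ :- (con (+ 8) :* b) := con (+ 4) :* (con (+ 12) :* b)) refl β)
            (≈-+ at-1 (≈-neg at-0)))
          start : f ≈[ 2 ] a + b
          start = 2-cancel (≈-trans (≡⇒≈ (solve 3 (λ f a b → con (+ 2) :* f := con (+ 2) :* f :+ :- a :+ b :+ (a :+ :- b)) refl f d₁ (ϖ * d₂)))
            (≈-trans (≈-+ at-0 (≈-+ ≈-refl (≈-neg quad))) (≡⇒≈ (trans
              (solve 2 (λ a b → con (+ 8) :* b :+ (a :+ :- (con (+ 12) :* b)) := (a :+ :- (con (+ 12) :* b)) :+ con (+ 2) :* (con (+ 4) :* b)) refl d₁ β)
              (trans (+-congʳ (trans (sym (half-2 (d₁ + - (ι (+ 12) * β)))) (solve 3 (λ h t x → h :* (t :* x) := t :* (h :* x)) refl half (ι (+ 2)) _)))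
                (sym (distribˡ (ι (+ 2)) a b)))))))
          slope : d₁ ≡ ι (+ 2) * a + ι (+ 12) * β
          slope = trans (solve 2 (λ a b → a := (a :+ :- b) :+ b) refl d₁ (ι (+ 12) * β))
            (+-congʳ (trans (sym (half-2 _)) (solve 3 (λ h t x → h :* (t :* x) := t :* (h :* x)) refl half (ι (+ 2)) _)))
          step : ∀ m → form (n̂ m) ≈[ 2 ] a + b + (ι (+ 2) * a + ι (+ 12) * β) * n̂ m + ι (+ 12) * β * (n̂ m * n̂ m)
          step m = ≈-+ (≈-+ start (≡⇒≈ (*-congʳ slope))) (≈-*ʳ (loc-* (loc-ι (+ m)) (loc-ι (+ m))) quad)
          poly : ℕ → K
          poly m = a * (n̂ m * n̂ m) + b * (n̂ m * n̂ m * n̂ m)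
          lpoly : ∀ m → Loc (poly m)
          lpoly m = loc-+ (loc-* la (loc-* (loc-ι (+ m)) (loc-ι (+ m)))) (loc-* lb (loc-* (loc-* (loc-ι (+ m)) (loc-ι (+ m))) (loc-ι (+ m))))
          grow : ∀ m → Near (poly m) (N.G m)
          grow zero = ≡⇒≈ (sym (trans (+-congˡ (trans (*-congˡ (trans
            (cong (λ z → a * (z * z) + b * (z * z * z)) ι-0)
              (trans (cong₂ (λ u v → a * u + b * v) (zeroˡ 0#) (trans (*-congʳ (zeroˡ 0#)) (zeroˡ 0#)))
                (trans (cong₂ _+_ (zeroʳ a) (zeroʳ b)) (+-identityˡ 0#))))) (zeroʳ _))) (+-identityʳ 1#)))
          grow (suc m) = subst (λ z → Near z (N.G (suc m)))
            (trans (solve 5 (λ a β m o z → a :* (m :* m) :+ (con (+ 4) :* β) :* (m :* m :* m)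
                 :+ (a :+ con (+ 4) :* β :+ (con (+ 2) :* a :+ con (+ 12) :* β) :* m :+ con (+ 12) :* β :* (m :* m))
               := a :* ((m :+ con (+ 1)) :* (m :+ con (+ 1))) :+ (con (+ 4) :* β) :* ((m :+ con (+ 1)) :* (m :+ con (+ 1)) :* (m :+ con (+ 1))))
              refl a β (n̂ m) 1# 1#)
              (cong (λ z → a * (z * z) + b * (z * z * z)) (trans (+-congˡ ι-1) (sym (n̂-suc m)))))
            (near-* (lpoly m) (≈-loc (≈-sym (step m)) (lform (+ m))) (grow m) (near-shift (step m) (ε≈ (+ m))))

-- Sections of a series by the residue of the exponent, and products.

module Dissection (𝔾 : Ground) (q : ℕ) where
  open Scalars 𝔾
  open Series 𝔾
  open Scalars.Solver 𝔾 using (solve; _:=_; _:+_)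

  private
    p = suc q

  section : ℕ → S → S
  section s u m = u (s ℕ.+ m ℕ.* p)

  -- The argument counts terms: the pairs have i + j = k - 1, and k = 0 is the empty sum. Hence
  -- `suc s` in `straight`, and `e` with s + e = q in `wrap`.
  antidiagonal : ℕ → (ℕ → ℕ → K) → K
  antidiagonal zero    φ = 0#
  antidiagonal (suc k) φ = φ 0 k + antidiagonal k (λ i j → φ (suc i) j)

  antidiagonal-cong : ∀ k {φ ψ} → (∀ i j → suc (i ℕ.+ j) ≡ k → φ i j ≡ ψ i j) → antidiagonal k φ ≡ antidiagonal k ψ
  antidiagonal-cong zero    e = refl
  antidiagonal-cong (suc k) e = cong₂ _+_ (e 0 k refl) (antidiagonal-cong k (λ i j d → e (suc i) j (cong suc d)))

  antidiagonal-zero : ∀ k {φ} → (∀ i j → suc (i ℕ.+ j) ≡ k → φ i j ≡ 0#) → antidiagonal k φ ≡ 0#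
  antidiagonal-zero zero    e = refl
  antidiagonal-zero (suc k) e = trans (cong₂ _+_ (e 0 k refl) (antidiagonal-zero k (λ i j d → e (suc i) j (cong suc d))))
    (+-identityˡ 0#)

  antidiagonal-+ : ∀ k φ ψ → antidiagonal k (λ i j → φ i j + ψ i j) ≡ antidiagonal k φ + antidiagonal k ψ
  antidiagonal-+ zero    φ ψ = sym (+-identityˡ 0#)
  antidiagonal-+ (suc k) φ ψ = trans (+-congˡ (antidiagonal-+ k _ _))
    (solve 4 (λ a b x y → (a :+ b) :+ (x :+ y) := (a :+ x) :+ (b :+ y)) refl _ _ _ _)

  antidiagonal-split : ∀ a b φ → antidiagonal (a ℕ.+ b) φ
    ≡ antidiagonal a (λ i j → φ i (j ℕ.+ b)) + antidiagonal b (λ i j → φ (a ℕ.+ i) j)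
  antidiagonal-split zero    b φ = sym (+-identityˡ _)
  antidiagonal-split (suc a) b φ = trans (+-congˡ (antidiagonal-split a b _)) (sym (+-assoc _ _ _))

  private
    drop : ℕ → S → S
    drop k u n = u (k ℕ.+ n)

    ⊛-split : ∀ k u v n → (u ⊛ v) (k ℕ.+ n) ≡ antidiagonal k (λ i j → u i * v (suc j ℕ.+ n)) + (drop k u ⊛ v) n
    ⊛-split zero    u v n = sym (+-identityˡ _)
    ⊛-split (suc k) u v n = trans (+-congˡ (⊛-split k (tail u) v n)) (sym (+-assoc _ _ _))

    ⊛-initial : ∀ s u v → (u ⊛ v) s ≡ antidiagonal (suc s) (λ i j → u i * v j)
    ⊛-initial zero    u v = sym (+-identityʳ _)
    ⊛-initial (suc s) u v = +-congˡ (⊛-initial s (tail u) v)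

  -- The sections indexed by i < p of u ⊛ v, without and with a carry.
  wrap : ℕ → ℕ → S → S → ℕ → K
  wrap s e u v m = antidiagonal e (λ i j → shift (section (suc s ℕ.+ i) u ⊛ section (suc s ℕ.+ j) v) m)

  straight : ℕ → S → S → ℕ → K
  straight s u v m = antidiagonal (suc s) (λ i j → (section i u ⊛ section j v) m)

  -- Residues i and j combine to s either as i + j = s, or as i + j = s + p with a carry into m,
  -- which is the `shift`. In the second case both exceed s, which leaves e = q - s pairs. The
  -- induction on m strips p coefficients from the left factor.
  section-⊛ : ∀ s e → s ℕ.+ e ≡ q → ∀ m u v → section s (u ⊛ v) m ≡ straight s u v m + wrap s e u v m
  section-⊛ s e size zero u v = trans (cong (u ⊛ v) (ℕP.+-identityʳ s))
    (trans (⊛-initial s u v) (trans (antidiagonal-cong (suc s) (λ i j _ → cong₂ _*_ (at u i) (at v j)))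
      (sym (trans (+-congˡ (antidiagonal-zero e (λ i j _ → refl))) (+-identityʳ _)))))
    where
    at : ∀ (w : S) i → w i ≡ section i w 0
    at w i = cong w (sym (ℕP.+-identityʳ i))
  section-⊛ s e size (suc m) u v = trans (cong (u ⊛ v) index) (trans (⊛-split p u v (s ℕ.+ m ℕ.* p))
      (trans (cong₂ _+_ first rest)
        (trans (solve 4 (λ a b c d → (a :+ b) :+ (c :+ d) := (a :+ c) :+ (b :+ d)) refl _ _ _ _)
          (cong₂ _+_ (sym (antidiagonal-+ (suc s) (λ i j → section i u 0 * section j v (suc m)) (λ i j → (tail (section i u) ⊛ section j v) m)))
            (trans (sym (antidiagonal-+ e (λ i j → section (suc s ℕ.+ i) u 0 * section (suc s ℕ.+ j) v m) _))
              (antidiagonal-cong e (λ i j _ → shifted (section (suc s ℕ.+ i) u) (section (suc s ℕ.+ j) v) m)))))))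
    where
    swap : ∀ a b c → a ℕ.+ (b ℕ.+ c) ≡ b ℕ.+ (a ℕ.+ c)
    swap a b c = trans (sym (ℕP.+-assoc a b c)) (trans (cong (ℕ._+ c) (ℕP.+-comm a b)) (ℕP.+-assoc b a c))
    index : s ℕ.+ suc m ℕ.* p ≡ p ℕ.+ (s ℕ.+ m ℕ.* p)
    index = swap s p (m ℕ.* p)
    p-split : suc s ℕ.+ e ≡ p
    p-split = cong suc size
    shifted : ∀ a b m → a 0 * b m + shift (tail a ⊛ b) m ≡ (a ⊛ b) m
    shifted a b zero    = +-identityʳ _
    shifted a b (suc m) = refl
    φ : ℕ → ℕ → K
    φ i j = u i * v (suc j ℕ.+ (s ℕ.+ m ℕ.* p))
    first : antidiagonal p φ ≡ antidiagonal (suc s) (λ i j → section i u 0 * section j v (suc m))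
                             + antidiagonal e (λ i j → section (suc s ℕ.+ i) u 0 * section (suc s ℕ.+ j) v m)
    first = trans (cong (λ k → antidiagonal k φ) (sym p-split)) (trans (antidiagonal-split (suc s) e φ) (cong₂ _+_
      (antidiagonal-cong (suc s) (λ i j _ → cong₂ _*_ (cong u (sym (ℕP.+-identityʳ i))) (cong v (low j))))
      (antidiagonal-cong e (λ i j _ → cong₂ _*_ (cong u (sym (ℕP.+-identityʳ _))) (cong v (high j))))))
      where
      low : ∀ j → suc (j ℕ.+ e) ℕ.+ (s ℕ.+ m ℕ.* p) ≡ j ℕ.+ suc m ℕ.* p
      low j = trans (cong suc (trans (ℕP.+-assoc j e _) (cong (j ℕ.+_) (sym (ℕP.+-assoc e s _)))))
        (trans (sym (ℕP.+-suc j _)) (cong (λ z → j ℕ.+ suc (z ℕ.+ m ℕ.* p)) (trans (ℕP.+-comm e s) size)))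
      high : ∀ j → suc j ℕ.+ (s ℕ.+ m ℕ.* p) ≡ suc s ℕ.+ j ℕ.+ m ℕ.* p
      high j = cong suc (trans (sym (ℕP.+-assoc j s _)) (cong (ℕ._+ m ℕ.* p) (ℕP.+-comm j s)))
    tails : ∀ i n → section i (drop p u) n ≡ tail (section i u) n
    tails i n = cong u (swap p i (n ℕ.* p))
    rest : (drop p u ⊛ v) (s ℕ.+ m ℕ.* p) ≡ antidiagonal (suc s) (λ i j → (tail (section i u) ⊛ section j v) m)
           + antidiagonal e (λ i j → shift (tail (section (suc s ℕ.+ i) u) ⊛ section (suc s ℕ.+ j) v) m)
    rest = trans (section-⊛ s e size m (drop p u) v) (cong₂ _+_
      (antidiagonal-cong (suc s) (λ i j _ → ⊛-cong {v = section j v} (tails i) (λ _ → refl) m))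
      (antidiagonal-cong e (λ i j _ → shift-cong (⊛-cong {v = section (suc s ℕ.+ j) v} (tails (suc s ℕ.+ i)) (λ _ → refl)) m)))
      where
      shift-cong : ∀ {a b} → a ≗ b → shift a ≗ shift b
      shift-cong e zero    = refl
      shift-cong e (suc n) = e n

  Supported : ℕ → S → Set
  Supported a u = ∀ r m → a ℕ.< r → r ℕ.< p → section r u m ≡ 0#

  private
    ⊛-nullˡ : ∀ u v → (∀ n → u n ≡ 0#) → ∀ n → (u ⊛ v) n ≡ 0#
    ⊛-nullˡ u v e n = trans (⊛-zeroˡ u v (λ n → trans (e n) (sym (const-0 n))) n) (const-0 n)

    shift-null : ∀ u → (∀ n → u n ≡ 0#) → ∀ n → shift u n ≡ 0#
    shift-null u e zero    = refl
    shift-null u e (suc n) = e n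

  module _ {a b u v} (su : Supported a u) (sv : Supported b v) where

    private
      product-null : ∀ i j → i ℕ.< p → j ℕ.< p → a ℕ.+ b ℕ.< i ℕ.+ j → ∀ m → (section i u ⊛ section j v) m ≡ 0#
      product-null i j i<p j<p lt m = go (ℕP.<-≤-connex a i)
        where
        go : a ℕ.< i ⊎ i ℕ.≤ a → (section i u ⊛ section j v) m ≡ 0#
        go (inj₁ a<i) = ⊛-nullˡ _ (section j v) (λ n → su i n a<i i<p) m
        go (inj₂ i≤a) = trans (⊛-comm (section i u) (section j v) m) (⊛-nullˡ _ (section i u) (λ n → sv j n b<j j<p) m)
          where
          b<j : b ℕ.< j
          b<j = ℕP.+-cancelˡ-< a b j (ℕP.<-≤-trans lt (ℕP.+-monoˡ-≤ j i≤a))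

    -- No carries occur when the supports are short.
    section-straight : a ℕ.+ b ℕ.< p → ∀ s → s ℕ.< p → ∀ m → section s (u ⊛ v) m ≡ straight s u v m
    section-straight short s s<p m = trans (section-⊛ s e size m u v)
      (trans (+-congˡ (antidiagonal-zero e wrapped)) (+-identityʳ _))
      where
      e = q ℕ.∸ s
      size : s ℕ.+ e ≡ q
      size = ℕP.m+[n∸m]≡n (ℕ.s≤s⁻¹ s<p)
      wrapped : ∀ i j → suc (i ℕ.+ j) ≡ e → shift (section (suc s ℕ.+ i) u ⊛ section (suc s ℕ.+ j) v) m ≡ 0#
      wrapped i j d = shift-null _ (product-null _ _ (bound i (ℕP.m≤m+n i j)) (bound j (ℕP.m≤n+m j i))
          (ℕP.<-≤-trans short big)) m
        where
        total : s ℕ.+ suc (i ℕ.+ j) ≡ q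
        total = trans (cong (s ℕ.+_) d) size
        bound : ∀ k → k ℕ.≤ i ℕ.+ j → suc s ℕ.+ k ℕ.< p
        bound k le = ℕ.s≤s (ℕP.≤-trans (ℕP.≤-reflexive (sym (ℕP.+-suc s k))) (ℕP.≤-trans (ℕP.+-monoʳ-≤ s (ℕ.s≤s le)) (ℕP.≤-reflexive total)))
        big : p ℕ.≤ suc s ℕ.+ i ℕ.+ (suc s ℕ.+ j)
        big = ℕ.s≤s (ℕP.≤-trans (ℕP.≤-reflexive (trans (sym total) (trans (ℕP.+-suc s (i ℕ.+ j)) (trans (cong suc (sym (ℕP.+-assoc s i j)))
          (sym (ℕP.+-suc (s ℕ.+ i) j)))))) (ℕP.+-monoʳ-≤ (s ℕ.+ i) (ℕ.s≤s (ℕP.m≤n+m j s))))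

    supported-⊛ : a ℕ.+ b ℕ.< p → Supported (a ℕ.+ b) (u ⊛ v)
    supported-⊛ short s m lt s<p = trans (section-straight short s s<p m) (antidiagonal-zero (suc s) (λ i j d →
      let i+j = ℕP.suc-injective d in
      product-null i j (ℕP.≤-<-trans (ℕP.≤-trans (ℕP.m≤m+n i j) (ℕP.≤-reflexive i+j)) s<p)
                       (ℕP.≤-<-trans (ℕP.≤-trans (ℕP.m≤n+m j i) (ℕP.≤-reflexive i+j)) s<p)
                       (subst (a ℕ.+ b ℕ.<_) (sym i+j) lt) m))

    section-head : a ℕ.+ b ℕ.< p → section 0 (u ⊛ v) ≗ section 0 u ⊛ section 0 v
    section-head short m = trans (section-straight short 0 (ℕ.s≤s ℕ.z≤n) m) (+-identityʳ _)

-- Linear spans of series modulo p².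

module Spans (𝔾 : Ground) (p : ℕ) (p-prime : Prime p) where
  open Scalars 𝔾
  open Series 𝔾
  open Localisation 𝔾 p p-prime
  open Representable 𝔾 p p-prime using (⊛-loc)
  open Scalars.Solver 𝔾 using (solve; _:=_; _:+_; _:*_; _:^_; con)
  open SeriesSolver using () renaming (solve to solveS; _:=_ to _:≗_; _:+_ to _⊞_; _:*_ to _⊠_; con to lit)
  open CommutativeRing seriesRing using () renaming (refl to ≗-refl)

  infix 4 _≋[_]_
  _≋[_]_ : S → ℕ → S → Set
  u ≋[ k ] v = ∀ n → u n ≈[ k ] v n

  Integral : S → Set
  Integral u = ∀ n → Loc (u n)

  ⊛-≋ : ∀ {k u u′ v v′} → Integral u′ → Integral v → u ≋[ k ] u′ → v ≋[ k ] v′ → u ⊛ v ≋[ k ] u′ ⊛ v′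
  ⊛-≋ lu lv e d zero    = ≈-* (lu 0) (lv 0) (e 0) (d 0)
  ⊛-≋ lu lv e d (suc n) = ≈-+ (≈-* (lu 0) (lv (suc n)) (e 0) (d (suc n))) (⊛-≋ (λ i → lu (suc i)) lv (λ i → e (suc i)) d n)

  cube-expand : ∀ {u x y} → Integral x → Integral y → u ≋[ 4 ] (λ n → x n + π 2 * y n) →
    u ⊛ (u ⊛ u) ≋[ 4 ] (λ n → (x ⊛ (x ⊛ x)) n + π 2 * (ι (+ 3) * ((x ⊛ x) ⊛ y) n))
  cube-expand {u} {x} {y} lx ly e n = ≈-trans
    (⊛-≋ lz (⊛-loc lu lu) e (⊛-≋ lz lu e e) n)
    (≈-trans (≡⇒≈ (trans (⊛-cong zc (⊛-cong zc zc) n) (trans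
      (solveS 3 (λ x P y → (x ⊞ P ⊠ y) ⊠ ((x ⊞ P ⊠ y) ⊠ (x ⊞ P ⊠ y))
        :≗ x ⊠ (x ⊠ x) ⊞ P ⊠ (lit (+ 3) ⊠ (x ⊠ x ⊠ y)) ⊞ P ⊠ (P ⊠ (lit (+ 3) ⊠ (x ⊠ (y ⊠ y)) ⊞ P ⊠ (y ⊠ (y ⊠ y)))))
        ≗-refl x (const (π 2)) y n)
      (cong₂ _+_ (+-congˡ (trans (const-⊛ (π 2) _ n) (*-congˡ (const-⊛ _ _ n))))
                 (trans (const-⊛ (π 2) _ n) (trans (*-congˡ (const-⊛ (π 2) _ n)) (sym (*-assoc (π 2) (π 2) _))))))))
    (≈-trans (≈-+ ≈-refl (≈-trans (≡⇒≈ (*-congʳ (sym (π-+ 2 2)))) (π-null 4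
        (loc-+ (subst Loc (sym (const-⊛ _ _ n)) (loc-* (loc-ι (+ 3)) (⊛-loc lx (⊛-loc ly ly) n)))
               (subst Loc (sym (const-⊛ _ _ n)) (loc-* (loc-π 2) (⊛-loc ly (⊛-loc ly ly) n)))))))
      (≡⇒≈ (+-identityʳ _))))
    where
    z : S
    z n = x n + π 2 * y n
    lz : Integral z
    lz n = loc-+ (lx n) (loc-* (loc-π 2) (ly n))
    lu : Integral u
    lu n = ≈-loc (e n) (lz n)
    zc : z ≗ x ⊕ const (π 2) ⊛ y
    zc n = +-congˡ (sym (const-⊛ _ y n))

  -- A slowly varying factor is a + p b m modulo p², and multiplying coefficients by m is ϑ, so x
  -- times such a factor lies in the span with y = ϑ x. The third generator is there for products,
  -- which produce x ⊛ y′ and y ⊛ x′; the term y ⊛ y′ carries p².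
  record Span (x y z u : S) : Set where
    constructor span
    field
      {a b c} : K
      la : Loc a
      lb : Loc b
      lc : Loc c
      approximate : u ≋[ 2 ] (λ n → a * x n + ϖ * b * y n + ϖ * c * z n)

  null : S
  null _ = 0#

  span-null : ∀ {x y z u} → (∀ n → u n ≡ 0#) → Span x y z u
  span-null e = span loc-0 loc-0 loc-0 (λ n → ≡⇒≈ (trans (e n)
    (trans (sym ι-0) (trans (solve 4 (λ x y z w → con (+ 0) := con (+ 0) :* x :+ w :* con (+ 0) :* y :+ w :* con (+ 0) :* z) refl _ _ _ ϖ)
      (cong (λ o → o * _ + ϖ * o * _ + ϖ * o * _) ι-0)))))

  span-+ : ∀ {x y z u v} → Span x y z u → Span x y z v → Span x y z (u ⊕ v)
  span-+ (span la lb lc e) (span la′ lb′ lc′ e′) = span (loc-+ la la′) (loc-+ lb lb′) (loc-+ lc lc′)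
    (λ n → ≈-trans (≈-+ (e n) (e′ n)) (≡⇒≈ (solve 10 (λ a b c a′ b′ c′ w x y z →
        (a :* x :+ w :* b :* y :+ w :* c :* z) :+ (a′ :* x :+ w :* b′ :* y :+ w :* c′ :* z)
        := (a :+ a′) :* x :+ w :* (b :+ b′) :* y :+ w :* (c :+ c′) :* z) refl _ _ _ _ _ _ ϖ _ _ _)))

  span-ext : ∀ {x y z u v} → (∀ n → v n ≡ u n) → Span x y z u → Span x y z v
  span-ext e (span la lb lc d) = span la lb lc (λ n → ≈-trans (≡⇒≈ (e n)) (d n))

  span-integral : ∀ {x y z u} → Integral x → Integral y → Integral z → Span x y z u → Integral u
  span-integral lx ly lz (span la lb lc e) n = ≈-loc (e n)
    (loc-+ (loc-+ (loc-* la (lx n)) (loc-* (loc-* (loc-ι (+ p)) lb) (ly n))) (loc-* (loc-* (loc-ι (+ p)) lc) (lz n)))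

  span-⊛ : ∀ {x y x′ y′ u v} → Integral x → Integral y → Integral x′ → Integral y′ →
    Span x y null u → Span x′ y′ null v → Span (x ⊛ x′) (x ⊛ y′) (y ⊛ x′) (u ⊛ v)
  span-⊛ {x} {y} {x′} {y′} {u} {v} lx ly lx′ ly′ U@(span {a} {b} la lb _ e) V@(span {a′} {b′} la′ lb′ _ e′) =
    span (loc-* la la′) (loc-* la lb′) (loc-* lb la′) approx
    where
    li : Integral (λ n → a * x n + ϖ * b * y n)
    li n = loc-+ (loc-* la (lx n)) (loc-* (loc-* (loc-ι (+ p)) lb) (ly n))
    two : ∀ {a b c w x y} → a * x + w * b * y + w * c * 0# ≡ a * x + w * b * y
    two = trans (+-congˡ (zeroʳ _)) (+-identityʳ _)
    c⊕ : ∀ a w x y → (λ n → a * x n + w * y n) ≗ const a ⊛ x ⊕ const w ⊛ y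
    c⊕ a w x y n = cong₂ _+_ (sym (const-⊛ a x n)) (sym (const-⊛ w y n))
    c² : ∀ s t z n → ((const s ⊛ const t) ⊛ z) n ≡ s * t * z n
    c² s t z n = trans (⊛-assoc (const s) (const t) z n) (trans (const-⊛ s _ n) (trans (*-congˡ (const-⊛ t z n)) (sym (*-assoc _ _ _))))
    approx : u ⊛ v ≋[ 2 ] (λ n → a * a′ * (x ⊛ x′) n + ϖ * (a * b′) * (x ⊛ y′) n + ϖ * (b * a′) * (y ⊛ x′) n)
    approx n = ≈-trans (⊛-≋ li (span-integral lx′ ly′ (λ _ → loc-0) V) (λ n → ≈-trans (e n) (≡⇒≈ two)) (λ n → ≈-trans (e′ n) (≡⇒≈ two)) n)
      (≈-trans (≡⇒≈ (trans (⊛-cong (c⊕ a (ϖ * b) x y) (c⊕ a′ (ϖ * b′) x′ y′) n)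
         (trans (solveS 8 (λ A W A′ W′ x y x′ y′ → (A ⊠ x ⊞ W ⊠ y) ⊠ (A′ ⊠ x′ ⊞ W′ ⊠ y′)
             :≗ (A ⊠ A′) ⊠ (x ⊠ x′) ⊞ (A ⊠ W′) ⊠ (x ⊠ y′) ⊞ (W ⊠ A′) ⊠ (y ⊠ x′) ⊞ (W ⊠ W′) ⊠ (y ⊠ y′))
             ≗-refl (const a) (const (ϖ * b)) (const a′) (const (ϖ * b′)) x y x′ y′ n)
           (cong₂ _+_ (cong₂ _+_ (cong₂ _+_ (c² _ _ _ n) (c² _ _ _ n)) (c² _ _ _ n)) (c² _ _ _ n)))))
      (congruent (b * b′ * (y ⊛ y′) n) (loc-* (loc-* lb lb′) (⊛-loc ly ly′ n))
        (solve 9 (λ a b a′ b′ w p q r s → a :* a′ :* p :+ a :* (w :* b′) :* q :+ w :* b :* a′ :* r :+ w :* b :* (w :* b′) :* s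
           := a :* a′ :* p :+ w :* (a :* b′) :* q :+ w :* (b :* a′) :* r :+ w :* (w :* w :^ 0) :* (b :* b′ :* s))
           refl a b a′ b′ ϖ _ _ _ _)))

  span-merge : ∀ {x y z u} → (∀ n → z n ≡ y n) → Span x y z u → Span x y null u
  span-merge {x} {y} {z} e (span la lb lc d) = span la (loc-+ lb lc) loc-0 (λ n → ≈-trans (d n) (≡⇒≈ (trans
    (+-congˡ (*-congˡ (e n))) (trans
      (solve 6 (λ a b c w x y → a :* x :+ w :* b :* y :+ w :* c :* y := a :* x :+ w :* (b :+ c) :* y) refl _ _ _ ϖ (x n) (y n))
      (sym (trans (+-congˡ (zeroʳ _)) (+-identityʳ _)))))))

  module _ (q : ℕ) where
    open Dissection 𝔾 q

    span-antidiagonal : ∀ {x y z} k (φ : ℕ → ℕ → S) → (∀ i j → suc (i ℕ.+ j) ≡ k → Span x y z (φ i j)) →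
      Span x y z (λ m → antidiagonal k (λ i j → φ i j m))
    span-antidiagonal zero    φ s = span-null (λ _ → refl)
    span-antidiagonal (suc k) φ s = span-+ (s 0 k refl) (span-antidiagonal k (λ i j → φ (suc i) j) (λ i j e → s (suc i) j (cong suc e)))

-- The shape of a_m modulo p⁴.

module Lifting (𝔾 : Ground) (q : ℕ) (p-prime : Prime (suc q))
  (n₀ n₁ c c′ : ℕ) (size : n₀ ℕ.+ n₁ ≡ q)
  (balance : 3 ℕ.* n₀ ℕ.+ c ≡ 1 ℕ.* suc q) (balance′ : 3 ℕ.* n₁ ℕ.+ c′ ≡ 2 ℕ.* suc q)
  (orientation : (c ≡ 1 × c′ ≡ 2) ⊎ (c ≡ 2 × c′ ≡ 1)) where

  open Scalars 𝔾
  open Series 𝔾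
  open Hypergeometric 𝔾 hiding (rhs)
  open Products 𝔾
  open Block 𝔾 q p-prime
  open Spans 𝔾 p p-prime
  open Dissection 𝔾 q
  open Scalars.Solver 𝔾 using (solve; _:=_; _:+_; _:*_; _:-_; :-_; _:^_; con)
  open SeriesSolver using () renaming (solve to solveS; _:=_ to _:≗_; _:+_ to _⊞_; _:*_ to _⊠_; con to lit)
  open CommutativeRing seriesRing using () renaming (refl to ≗-refl; trans to ≗-trans)

  private
    c+c′ : c ℕ.+ c′ ≡ 3
    c+c′ = go orientation
      where
      go : (c ≡ 1 × c′ ≡ 2) ⊎ (c ≡ 2 × c′ ≡ 1) → c ℕ.+ c′ ≡ 3
      go (inj₁ (refl , refl)) = refl
      go (inj₂ (refl , refl)) = refl

    both : ∀ (Q : ℕ → Set) → Q c → Q c′ → Q 1 × Q 2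
    both Q x y = go orientation
      where
      go : (c ≡ 1 × c′ ≡ 2) ⊎ (c ≡ 2 × c′ ≡ 1) → Q 1 × Q 2
      go (inj₁ (e , d)) = subst Q e x , subst Q d y
      go (inj₂ (e , d)) = subst Q d y , subst Q e x

  open Reflection 𝔾 q p-prime n₀ n₁ c c′ size balance balance′ c+c′ using (module N; module N′; module Estimate)

  private
    n≡ : ∀ n → n ≡ n ℕ.% p ℕ.+ n ℕ./ p ℕ.* p
    n≡ n = ℕD.m≡m%n+[m/n]*n n p

    residue≤q : ∀ n → n ℕ.% p ℕ.≤ q
    residue≤q n = ℕ.s≤s⁻¹ (ℕD.m%n<n n p)

  -- Strong induction from n to n / p. A section of `hyp c` leads to `hyp 1` and one of `hyp c′` to
  -- `hyp 2`, so neither series can be treated alone; the number `b` bounds n.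
  hyp-integral : ∀ n → Loc (hyp c n) × Loc (hyp c′ n)
  hyp-integral n = go n n ℕP.≤-refl
    where
    go : ∀ b n → n ℕ.≤ b → Loc (hyp c n) × Loc (hyp c′ n)
    go b       zero    _  = loc-1 , loc-1
    go (suc b) (suc n) le =
      subst Loc (sym (trans (cong (hyp c) (n≡ (suc n))) (N.hyp-section r m))) (loc-* (proj₁ IH) (N.loc-section r m (residue≤q (suc n)))) ,
      subst Loc (sym (trans (cong (hyp c′) (n≡ (suc n))) (N′.hyp-section r m))) (loc-* (proj₂ IH) (N′.loc-section r m (residue≤q (suc n))))
      where
      r = suc n ℕ.% p
      m = suc n ℕ./ p
      IH : Loc (hyp 1 m) × Loc (hyp 2 m)
      IH = both (λ c → Loc (hyp c m)) (proj₁ below) (proj₂ below)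
        where
        below = go b m (ℕ.s≤s⁻¹ (ℕP.<-≤-trans (ℕD.m/n<m (suc n) p (ℕ.s≤s (ℕ.s≤s⁻¹ 1<p))) le))

  integral-1 : Integral (hyp 1)
  integral-1 n = proj₁ (both (λ c → Loc (hyp c n)) (proj₁ (hyp-integral n)) (proj₂ (hyp-integral n)))

  module _ (5≤p : 5 ℕ.≤ p) where
    private
      lines : ∀ x → ∏ p (λ r → ι (+ 3) * (x + n̂ r) + n̂ 1) * ∏ p (λ r → ι (+ 3) * (x + n̂ r) + n̂ 2)
                  ≡ ∏ p (λ r → N.line r x) * ∏ p (λ r → N′.line r x)
      lines x = go orientation
        where
        L : ℕ → K
        L c = ∏ p (λ r → ι (+ 3) * (x + n̂ r) + n̂ c)
        go : (c ≡ 1 × c′ ≡ 2) ⊎ (c ≡ 2 × c′ ≡ 1) → L 1 * L 2 ≡ L c * L c′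
        go (inj₁ (e , d)) = cong₂ (λ a b → L a * L b) (sym e) (sym d)
        go (inj₂ (e , d)) = trans (*-comm _ _) (cong₂ (λ a b → L a * L b) (sym e) (sym d))

      open Estimate lines 5≤p using (G-near)
      open Halves 5≤p

      f h F : S
      f = hyp 1
      h = hyp c
      F = Cube.cube f

      lϑ : ∀ {u} → Integral u → Integral (ϑ u)
      lϑ l n = loc-* (loc-ι (+ n)) (l n)

      X-coefficient : ∀ m → X m ≡ (ι (+ 3) * n̂ m + ι (+ 1)) * (ι (+ 3) * n̂ m + ι (+ 1)) * f m
      X-coefficient m = trans (+-congʳ (cong₂ _+_ (const-⊛ _ _ m) (const-⊛ _ _ m)))
        (solve 2 (λ m f → con (+ 9) :* (m :* (m :* f)) :+ con (+ 6) :* (m :* f) :+ f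
          := (con (+ 3) :* m :+ con (+ 1)) :* (con (+ 3) :* m :+ con (+ 1)) :* f) refl (n̂ m) (f m))

      lX : Integral X
      lX m = subst Loc (sym (X-coefficient m)) (loc-* (loc-* l l) (integral-1 m))
        where l = loc-+ (loc-* (loc-ι (+ 3)) (loc-ι (+ m))) (loc-ι (+ 1))

      pick : ∀ {P : Set} → Dec P → K
      pick (yes _) = 1#
      pick (no _)  = 0#

      pick-yes : ∀ {P : Set} (d : Dec P) → P → pick d ≡ 1#
      pick-yes (yes _) _ = refl
      pick-yes (no ¬x) x = contradiction x ¬x

      pick-no : ∀ {P : Set} (d : Dec P) → ¬ P → pick d ≡ 0#
      pick-no (yes x) ¬x = contradiction x ¬x
      pick-no (no _)  _  = refl

      χ : ℕ → K
      χ n = pick (n ℕ.% p ℕ.≤? n₀)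

      residue-of : ∀ r m → r ℕ.< p → (r ℕ.+ m ℕ.* p) ℕ.% p ≡ r
      residue-of r m lt = trans (ℕD.[m+kn]%n≡m%n r m p) (ℕD.m<n⇒m%n≡m lt)

      χ-low : ∀ r m → r ℕ.≤ n₀ → r ℕ.< p → χ (r ℕ.+ m ℕ.* p) ≡ 1#
      χ-low r m le lt = pick-yes (_ ℕ.≤? n₀) (subst (ℕ._≤ n₀) (sym (residue-of r m lt)) le)

      χ-high : ∀ r m → n₀ ℕ.< r → r ℕ.< p → χ (r ℕ.+ m ℕ.* p) ≡ 0#
      χ-high r m gt lt = pick-no (_ ℕ.≤? n₀) (λ le → ℕP.<⇒≱ gt (subst (ℕ._≤ n₀) (residue-of r m lt) le))

      p⁻² : K
      p⁻² = inv (+ p) * inv (+ p)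

      π-p⁻² : ∀ x → π 2 * (x * p⁻²) ≡ x
      π-p⁻² x = trans (solve 3 (λ w i x → w :* (w :* w :^ 0) :* (x :* (i :* i)) := (w :* i) :* (w :* i) :* x) refl ϖ (inv (+ p)) x)
        (trans (cong (λ z → z * z * x) (ι-inv (+ p) (λ ()))) (trans (*-congʳ (*-identityˡ 1#)) (*-identityˡ x)))

      -- The terms of h with exponent congruent to r > n₀ contain the factor 3 n₀ + c ≡ 0 squared, so they are divisible by p².
      ρ θ : S
      ρ n = χ n * h n
      θ n = (1# + - χ n) * (h n * p⁻²)

      h-split : ∀ n → h n ≡ ρ n + π 2 * θ n
      h-split n = sym (trans (+-congˡ (trans (solve 3 (λ P c x → P :* (c :* x) := c :* (P :* x)) refl (π 2) (1# + - χ n) (h n * p⁻²))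
          (*-congˡ (π-p⁻² (h n)))))
        (trans (solve 3 (λ c h o → c :* h :+ (o :+ :- c) :* h := o :* h) refl (χ n) (h n) 1#) (*-identityˡ _)))

      ρ-low : ∀ r m → r ℕ.≤ n₀ → r ℕ.< p → section r ρ m ≡ f m * (N.G m * ∏ r (λ i → N.step i (+ m)))
      ρ-low r m le lt = trans (*-congʳ (χ-low r m le lt)) (trans (*-identityˡ _) (N.hyp-section r m))

      ρ-high : Supported n₀ ρ
      ρ-high r m gt lt = trans (*-congʳ (χ-high r m gt lt)) (zeroˡ _)

      θ-low : ∀ r m → r ℕ.≤ n₀ → r ℕ.< p → section r θ m ≡ 0#
      θ-low r m le lt = trans (*-congʳ (trans (+-congˡ (cong -_ (χ-low r m le lt))) (-‿inverseʳ 1#))) (zeroˡ _)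

      n₀≤q : n₀ ℕ.≤ q
      n₀≤q = subst (n₀ ℕ.≤_) size (ℕP.m≤m+n n₀ n₁)

      tail-product : ℕ → ℤ → K
      tail-product r m = ι (+ 3) * (inv (residue n₀ m) * inv (residue n₀ m))
        * (∏ n₀ (λ i → N.step i m) * ∏ r (λ i → N.step (n₀ ℕ.+ suc i) m))

      -- Beyond residue n₀ the product of steps has passed the line p (3 m + 1). Its square cancels
      -- `p⁻²` and turns f into X = (3 ϑ + 1)² f; all other factors are units or integral and stay
      -- in `tail-product`.
      θ-high : ∀ r m → n₀ ℕ.+ suc r ℕ.< p → section (n₀ ℕ.+ suc r) θ m ≡ X m * (N.G m * tail-product r (+ m))
      θ-high r m lt = trans
        (cong₂ (λ a b → (1# + - a) * (b * p⁻²)) (χ-high (n₀ ℕ.+ suc r) m (ℕP.m<m+n n₀ (ℕ.s≤s ℕ.z≤n)) lt)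
          (trans (N.hyp-section (n₀ ℕ.+ suc r) m) (cong (λ z → f m * (N.G m * z)) (trans (∏-split n₀ (suc r) (λ i → N.step i (+ m)))
            (*-congˡ (*-congʳ (trans (cong (λ k → N.step k (+ m)) (ℕP.+-identityʳ n₀))
              (cong (λ z → ι (+ 3) * (z * z) * (inv (residue n₀ (+ m)) * inv (residue n₀ (+ m)))) (N.line-n₀ _)))))))))
        (trans (solve 8 (λ z f g a b v o i → (o :+ :- z) :* (f :* (g :* (a :* b)) :* i) := (o :+ :- z) :* (f :* g :* a :* b :* i))
             refl 0# (f m) (N.G m) (∏ n₀ (λ i → N.step i (+ m))) _ 1# 1# p⁻²)
        (trans (*-congʳ (trans (+-congˡ -0#≡0#) (+-identityʳ 1#)))
        (trans (*-identityˡ _)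
        (trans (solve 8 (λ w m f g a b v i → f :* g :* a :* (con (+ 3) :* ((con (+ 3) :* (w :* m) :+ con (+ 1) :* w) :* (con (+ 3) :* (w :* m) :+ con (+ 1) :* w)) :* v :* b) :* (i :* i)
             := (w :* i) :* (w :* i) :* ((con (+ 3) :* m :+ con (+ 1)) :* (con (+ 3) :* m :+ con (+ 1)) :* f :* (g :* (con (+ 3) :* v :* (a :* b)))))
             refl ϖ (n̂ m) (f m) (N.G m) (∏ n₀ (λ i → N.step i (+ m))) (∏ r (λ i → N.step (n₀ ℕ.+ suc i) (+ m)))
             (inv (residue n₀ (+ m)) * inv (residue n₀ (+ m))) (inv (+ p)))
          (trans (*-congʳ (trans (cong (λ z → z * z) (ι-inv (+ p) (λ ()))) (*-identityˡ 1#)))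
          (trans (*-identityˡ _) (*-congʳ (sym (X-coefficient m)))))))))

      G-flat : ∀ m → N.G m ≈[ 2 ] 1#
      G-flat m = go G-near
        where
        go : ∃[ a ] ∃[ b ] Loc a × Loc b × (∀ m → N.G m ≈[ 4 ] 1# + π 2 * (a * (n̂ m * n̂ m) + b * (n̂ m * n̂ m * n̂ m))) → N.G m ≈[ 2 ] 1#
        go (a , b , la , lb , e) = ≈-trans (≈-weaken 2 (e m)) (≈-trans (≈-+ ≈-refl (π-null 2
          (loc-+ (loc-* la (loc-* l l)) (loc-* lb (loc-* (loc-* l l) l))))) (≡⇒≈ (+-identityʳ 1#)))
          where l = loc-ι (+ m)

      linear-span : ∀ {x u} {g : ℤ → K} → Integral x → Rep 2 g → (∀ m → u m ≡ x m * (N.G m * g (+ m))) → Span x (ϑ x) null u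
      linear-span {x} {u} {g} lx R@(rep k lk a) e = span (lk 0) (lk 1) loc-0 (λ m → ≈-trans (≡⇒≈ (e m)) (≈-trans
        (≈-*ˡ (lx m) (≈-* loc-1 (rep-loc R (+ m)) (G-flat m) (a (+ m))))
        (≡⇒≈ (trans (*-congˡ (*-identityˡ _)) (trans
          (cong (λ z → x m * (k 0 + ϖ * n̂ m * z)) (trans (+-congˡ (zeroʳ _)) (+-identityʳ (k 1))))
          (trans (solve 5 (λ x a b w m → x :* (a :+ w :* m :* b) := a :* x :+ w :* b :* (m :* x)) refl (x m) (k 0) (k 1) ϖ (n̂ m))
            (sym (trans (+-congˡ (zeroʳ _)) (+-identityʳ _)))))))))

      rep-product : ∀ r → r ℕ.≤ q → Rep 2 (λ m → ∏ r (λ i → N.step i m))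
      rep-product r le = rep-∏ r N.step (λ i lt → N.rep-step i (ℕP.<-≤-trans lt le))

      ρ-span : ∀ r → r ℕ.< p → Span f (ϑ f) null (section r ρ)
      ρ-span r lt = go (r ℕ.≤? n₀)
        where
        go : Dec (r ℕ.≤ n₀) → Span f (ϑ f) null (section r ρ)
        go (yes le) = linear-span integral-1 (rep-product r (ℕP.≤-trans le n₀≤q)) (λ m → ρ-low r m le lt)
        go (no ¬le) = span-null (λ m → ρ-high r m (ℕP.≰⇒> ¬le) lt)

      θ-span : ∀ r → r ℕ.< p → Span X (ϑ X) null (section r θ)
      θ-span r lt = go (r ℕ.≤? n₀)
        where
        above : ∀ k → n₀ ℕ.+ suc k ≡ r → Span X (ϑ X) null (section r θ)
        above k refl = linear-span lX
          (rep-* (rep-* (rep-const (loc-ι (+ 3))) (rep-* (rep-inv-residue n₀ n₀<q) (rep-inv-residue n₀ n₀<q)))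
            (rep-* (rep-product n₀ n₀≤q) (rep-∏ k (λ i → N.step (n₀ ℕ.+ suc i)) (λ i i<k → N.rep-step (n₀ ℕ.+ suc i)
              (ℕP.<-≤-trans (ℕP.+-monoʳ-< n₀ (ℕ.s≤s i<k)) (ℕ.s≤s⁻¹ lt))))))
          (λ m → θ-high k m lt)
          where
          n₀<q : n₀ ℕ.< q
          n₀<q = ℕP.<-≤-trans (ℕP.m<m+n n₀ (ℕ.s≤s ℕ.z≤n)) (ℕ.s≤s⁻¹ lt)
        go : Dec (r ℕ.≤ n₀) → Span X (ϑ X) null (section r θ)
        go (yes le) = span-null (λ m → θ-low r m le lt)
        go (no ¬le) = above (r ℕ.∸ suc n₀) (trans (ℕP.+-suc n₀ _) (ℕP.m+[n∸m]≡n (ℕP.≰⇒> ¬le)))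

      0<c : 0 ℕ.< c
      0<c = go orientation
        where
        go : (c ≡ 1 × c′ ≡ 2) ⊎ (c ≡ 2 × c′ ≡ 1) → 0 ℕ.< c
        go (inj₁ (refl , _)) = ℕ.s≤s ℕ.z≤n
        go (inj₂ (refl , _)) = ℕ.s≤s ℕ.z≤n

      -- Immediate from 3 n₀ + c = p and c > 0. It keeps products of three copies of ρ free of
      -- carries.
      3n₀<p : n₀ ℕ.+ (n₀ ℕ.+ n₀) ℕ.< p
      3n₀<p = subst (suc (n₀ ℕ.+ (n₀ ℕ.+ n₀)) ℕ.≤_) (trans balance (ℕP.+-identityʳ p))
        (ℕP.≤-trans (ℕP.≤-reflexive (trans (ℕP.+-comm 1 _) (cong (λ z → n₀ ℕ.+ (n₀ ℕ.+ z) ℕ.+ 1) (sym (ℕP.+-identityʳ n₀)))))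
          (ℕP.+-monoʳ-≤ (3 ℕ.* n₀) 0<c))

      2n₀<p : n₀ ℕ.+ n₀ ℕ.< p
      2n₀<p = ℕP.≤-<-trans (ℕP.m≤n+m (n₀ ℕ.+ n₀) n₀) 3n₀<p

      ρ² ρ³ : S
      ρ² = ρ ⊛ ρ
      ρ³ = ρ ⊛ ρ²

      f² f·f′ : S
      f²   = f ⊛ f
      f·f′ = f ⊛ ϑ f

      lf² : Integral f²
      lf² = ⊛-loc integral-1 integral-1

      lff′ : Integral f·f′
      lff′ = ⊛-loc integral-1 (lϑ integral-1)

      ρ²-span : ∀ s → s ℕ.< p → Span f² f·f′ null (section s ρ²)
      ρ²-span s lt = span-ext (section-straight ρ-high ρ-high 2n₀<p s lt)
        (span-antidiagonal q (suc s) (λ i j → section i ρ ⊛ section j ρ) (λ i j d →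
          let i+j = ℕP.suc-injective d in
          span-merge (⊛-comm (ϑ f) f) (span-⊛ integral-1 (lϑ integral-1) integral-1 (lϑ integral-1)
            (ρ-span i (ℕP.≤-<-trans (ℕP.≤-trans (ℕP.m≤m+n i j) (ℕP.≤-reflexive i+j)) lt))
            (ρ-span j (ℕP.≤-<-trans (ℕP.≤-trans (ℕP.m≤n+m j i) (ℕP.≤-reflexive i+j)) lt)))))

      Cubic : S → Set
      Cubic = Span (f² ⊛ X) (f² ⊛ ϑ X) (f·f′ ⊛ X)

      product-span : ∀ i j → i ℕ.< p → j ℕ.< p → Cubic (section i ρ² ⊛ section j θ)
      product-span i j i<p j<p = span-⊛ lf² lff′ lX (lϑ lX) (ρ²-span i i<p) (θ-span j j<p)

      -- Multiples of f² ⊛ X, f² ⊛ ϑ X and f ϑf ⊛ X, rewritten through series that have short recurrences.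
      Error : S → Set
      Error u = ∃[ a ] ∃[ b ] ∃[ d ] Loc a × Loc b × Loc d ×
        (u ≋[ 2 ] (λ n → a * β₁ n + ϖ * b * ϑ β₁ n + d * β₂ n))

      -- The product X f ϑf is eliminated: ϑβ₁ = f² ϑX + 2 X f ϑf and β₂ = 3 f² ϑX, so 3 X f ϑf is
      -- half of 3 ϑβ₁ - β₂. The factor p in front of it survives in front of ϑβ₁.
      error-cubic : ∀ {u} → Cubic u → Error (λ n → ι (+ 3) * u n)
      error-cubic {u} (span {a} {b} {d} la lb ld e) =
        ι (+ 3) * a , half * (ι (+ 3) * d) , ϖ * (b + - (half * d)) ,
        loc-* (loc-ι (+ 3)) la , loc-* (loc-inv unit-2) (loc-* (loc-ι (+ 3)) ld) ,
        loc-* (loc-ι (+ p)) (loc-+ lb (loc-neg (loc-* (loc-inv unit-2) ld))) ,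
        λ n → ≈-trans (≈-*ˡ (loc-ι (+ 3)) (e n)) (≡⇒≈ (trans
          (solve 7 (λ a b d w x y z → con (+ 3) :* (a :* x :+ w :* b :* y :+ w :* d :* z)
             := con (+ 3) :* a :* x :+ w :* b :* (con (+ 3) :* y) :+ w :* d :* (con (+ 3) :* z)) refl a b d ϖ _ _ _)
          (trans (cong₂ (λ y z → ι (+ 3) * a * (f² ⊛ X) n + ϖ * b * y + ϖ * d * z) (second n) (third n))
            (trans (solve 8 (λ a b d h w x y z → con (+ 3) :* a :* x :+ w :* b :* y :+ w :* d :* (h :* (con (+ 3) :* z :+ :- y))
              := con (+ 3) :* a :* x :+ w :* (h :* (con (+ 3) :* d)) :* z :+ w :* (b :+ :- (h :* d)) :* y) refl a b d half ϖ _ (β₂ n) (ϑ β₁ n))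
              (+-congʳ (+-congʳ (*-congˡ (⊛-comm f² X n))))))))
        where
        second : ∀ n → ι (+ 3) * (f² ⊛ ϑ X) n ≡ β₂ n
        second n = trans (*-congˡ (⊛-comm f² (ϑ X) n)) (sym (const-⊛ _ _ n))
        doubled : ϑ β₁ ≗ ϑ X ⊛ f² ⊕ k (+ 2) ⊛ (f·f′ ⊛ X)
        doubled = ≗-trans (ϑ-⊛₃ X f f) (solveS 4 (λ X Y f g → Y ⊠ (f ⊠ f) ⊞ X ⊠ (g ⊠ f) ⊞ X ⊠ (f ⊠ g)
          :≗ Y ⊠ (f ⊠ f) ⊞ lit (+ 2) ⊠ (f ⊠ g ⊠ X)) ≗-refl X (ϑ X) f (ϑ f))
        third : ∀ n → ι (+ 3) * (f·f′ ⊛ X) n ≡ half * (ι (+ 3) * ϑ β₁ n + - β₂ n)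
        third n = trans (sym (half-2 _)) (*-congˡ (sym (trans
          (cong₂ (λ u v → ι (+ 3) * u + - v) (trans (doubled n) (+-congˡ (const-⊛ _ _ n))) (const-⊛ _ _ n))
          (solve 2 (λ y z → con (+ 3) :* (y :+ con (+ 2) :* z) :+ :- (con (+ 3) :* y) := con (+ 2) :* (con (+ 3) :* z)) refl _ _))))

      θ-integral : Integral θ
      θ-integral n = subst (λ k → Loc (θ k)) (sym (n≡ n))
        (span-integral lX (lϑ lX) (λ _ → loc-0) (θ-span (n ℕ.% p) (ℕD.m%n<n n p)) (n ℕ./ p))

      ρ-integral : Integral ρ
      ρ-integral n = subst (λ k → Loc (ρ k)) (sym (n≡ n))
        (span-integral integral-1 (lϑ integral-1) (λ _ → loc-0) (ρ-span (n ℕ.% p) (ℕD.m%n<n n p)) (n ℕ./ p))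

      cube-h : Cube.cube h ≋[ 4 ] (λ n → ρ³ n + π 2 * (ι (+ 3) * (ρ² ⊛ θ) n))
      cube-h = cube-expand ρ-integral θ-integral (λ n → ≡⇒≈ (h-split n))

      error-+ : ∀ {u v} → Error u → Error v → Error (u ⊕ v)
      error-+ (a , b , d , la , lb , ld , e) (a′ , b′ , d′ , la′ , lb′ , ld′ , e′) =
        a + a′ , b + b′ , d + d′ , loc-+ la la′ , loc-+ lb lb′ , loc-+ ld ld′ ,
        λ n → ≈-trans (≈-+ (e n) (e′ n)) (≡⇒≈ (solve 10 (λ a b c a′ b′ c′ w x y z →
          (a :* x :+ w :* b :* y :+ c :* z) :+ (a′ :* x :+ w :* b′ :* y :+ c′ :* z)
          := (a :+ a′) :* x :+ w :* (b :+ b′) :* y :+ (c :+ c′) :* z) refl _ _ _ _ _ _ ϖ _ _ _))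

      error-scale : ∀ {s u} → Loc s → Error u → Error (λ n → s * u n)
      error-scale {s} ls (a , b , d , la , lb , ld , e) =
        s * a , s * b , s * d , loc-* ls la , loc-* ls lb , loc-* ls ld ,
        λ n → ≈-trans (≈-*ˡ ls (e n)) (≡⇒≈ (solve 8 (λ s a b c w x y z →
          s :* (a :* x :+ w :* b :* y :+ c :* z) := s :* a :* x :+ w :* (s :* b) :* y :+ s :* c :* z) refl s _ _ _ ϖ _ _ _))

      shift-cong : ∀ {u v} → u ≗ v → shift u ≗ shift v
      shift-cong e zero    = refl
      shift-cong e (suc n) = e n

      shift-+ : ∀ u v n → shift (u ⊕ v) n ≡ shift u n + shift v n
      shift-+ u v zero    = sym (+-identityˡ 0#)
      shift-+ u v (suc n) = refl

      shift-scale : ∀ s u n → shift (λ n → s * u n) n ≡ s * shift u n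
      shift-scale s u zero    = sym (zeroʳ s)
      shift-scale s u (suc n) = refl

      shift-antidiagonal : ∀ k (φ : ℕ → ℕ → S) n →
        antidiagonal k (λ i j → shift (φ i j) n) ≡ shift (λ m → antidiagonal k (λ i j → φ i j m)) n
      shift-antidiagonal k φ zero    = antidiagonal-zero k (λ i j _ → refl)
      shift-antidiagonal k φ (suc n) = refl

      Lifted : S → Set
      Lifted u = ∃[ E ] Error E × (∀ m → u (m ℕ.* p) ≈[ 4 ] F m + π 2 * shift E m)

      -- θ has no exponents divisible by p, so only pairs with a carry contribute, and each of them
      -- is shifted.
      mixed-head : ∃[ V ] Cubic V × (∀ m → section 0 (ρ² ⊛ θ) m ≡ shift V m)
      mixed-head = (λ m → antidiagonal q (λ i j → φ i j m)) , span-antidiagonal q q φ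
          (λ i j d → product-span (suc i) (suc j)
            (ℕ.s≤s (subst (suc i ℕ.≤_) d (ℕ.s≤s (ℕP.m≤m+n i j)))) (ℕ.s≤s (subst (suc j ℕ.≤_) d (ℕ.s≤s (ℕP.m≤n+m j i))))) ,
        λ m → trans (section-⊛ 0 q refl m ρ² θ) (trans
          (+-congʳ (trans (+-identityʳ _) (trans (⊛-comm (section 0 ρ²) (section 0 θ) m)
            (trans (⊛-cong {v = section 0 ρ²} (λ n → trans (θ-low 0 n ℕ.z≤n (ℕ.s≤s ℕ.z≤n)) (sym (const-0 n))) (λ _ → refl) m)
              (trans (const-⊛ 0# (section 0 ρ²) m) (zeroˡ _))))))
          (trans (+-identityˡ _) (shift-antidiagonal q φ m)))
        where
        φ : ℕ → ℕ → S
        φ i j = section (suc i) ρ² ⊛ section (suc j) θ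

      -- q is the largest residue, so nothing carries and no shift appears.
      mixed-last : ∃[ V ] Cubic V × (∀ m → section q (ρ² ⊛ θ) m ≡ V m)
      mixed-last = (λ m → antidiagonal p (λ i j → φ i j m)) , span-antidiagonal q p φ
          (λ i j d → product-span i j (subst (suc i ℕ.≤_) d (ℕ.s≤s (ℕP.m≤m+n i j))) (subst (suc j ℕ.≤_) d (ℕ.s≤s (ℕP.m≤n+m j i)))) ,
        λ m → trans (section-⊛ q 0 (ℕP.+-identityʳ q) m ρ² θ) (+-identityʳ _)
        where
        φ : ℕ → ℕ → S
        φ i j = section i ρ² ⊛ section j θ

      -- Without carries this section is the cube of f G. By `G-near`, f G is f + p² (a ϑ²f + b
      -- ϑ³f), and both derivatives have a factor t by the differential equation. Therefore the
      -- error is a shift; 3 f² times 3 t (a X + b (X + ϑX)) gives the coefficients 9 (a + b) and 3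
      -- b.
      ρ³-head : ∃[ E ] Error E × (∀ m → section 0 ρ³ m ≈[ 4 ] F m + π 2 * shift E m)
      ρ³-head = go G-near
        where
        go : ∃[ a ] ∃[ b ] Loc a × Loc b × (∀ m → N.G m ≈[ 4 ] 1# + π 2 * (a * (n̂ m * n̂ m) + b * (n̂ m * n̂ m * n̂ m))) →
          ∃[ E ] Error E × (∀ m → section 0 ρ³ m ≈[ 4 ] F m + π 2 * shift E m)
        go (a , b , la , lb , G≈) = E , (ι (+ 9) * (a + b) , 0# , ι (+ 3) * b ,
            loc-* (loc-ι (+ 9)) (loc-+ la lb) , loc-0 , loc-* (loc-ι (+ 3)) lb ,
            λ n → ≡⇒≈ (sym (trans (+-congʳ (trans (+-congˡ (trans (*-congʳ (zeroʳ ϖ)) (zeroˡ _))) (+-identityʳ _))) refl))) ,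
            λ m → ≈-trans (≡⇒≈ (trans (section-head ρ-high (supported-⊛ ρ-high ρ-high 2n₀<p) 3n₀<p m)
              (⊛-cong {u = g} (λ _ → refl) (section-head ρ-high ρ-high 2n₀<p) m)))
              (≈-trans (cube-expand integral-1 ly g≈ m) (≡⇒≈ (+-congˡ (*-congˡ (tripled m)))))
          where
          E g y : S
          E n = ι (+ 9) * (a + b) * β₁ n + ι (+ 3) * b * β₂ n
          g = section 0 ρ
          y n = a * ϑ (ϑ f) n + b * ϑ (ϑ (ϑ f)) n
          ly : Integral y
          ly n = loc-+ (loc-* la (lϑ (lϑ integral-1) n)) (loc-* lb (lϑ (lϑ (lϑ integral-1)) n))
          g≈ : g ≋[ 4 ] (λ n → f n + π 2 * y n)
          g≈ n = ≈-trans (≡⇒≈ (trans (ρ-low 0 n ℕ.z≤n (ℕ.s≤s ℕ.z≤n)) (*-congˡ (*-identityʳ _)))) (≈-trans (≈-*ˡ (integral-1 n) (G≈ n))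
            (≡⇒≈ (trans (distribˡ _ _ _) (cong₂ _+_ (*-identityʳ _)
              (solve 5 (λ f P a b m → f :* (P :* (a :* (m :* m) :+ b :* (m :* m :* m))) := P :* (a :* (m :* (m :* f)) :+ b :* (m :* (m :* (m :* f)))))
                refl (f n) (π 2) a b (n̂ n))))))
          y-series : y ≗ const a ⊛ (k (+ 3) ⊛ (t ⊛ X)) ⊕ const b ⊛ (k (+ 3) ⊛ (t ⊛ (X ⊕ ϑ X)))
          y-series n = cong₂ _+_ (trans (*-congˡ (ode-X n)) (sym (const-⊛ a _ n))) (trans (*-congˡ (ode-ϑX n)) (sym (const-⊛ b _ n)))
          tripled : ∀ m → ι (+ 3) * (f² ⊛ y) m ≡ shift E m
          tripled m = trans (sym (const-⊛ _ _ m)) (trans (⊛-cong {u = k (+ 3)} (λ _ → refl) (⊛-cong {u = f²} (λ _ → refl) y-series) m)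
            (trans (solveS 6 (λ a b t f X Y → lit (+ 3) ⊠ (f ⊠ f ⊠ (a ⊠ (lit (+ 3) ⊠ (t ⊠ X)) ⊞ b ⊠ (lit (+ 3) ⊠ (t ⊠ (X ⊞ Y)))))
                :≗ t ⊠ (a ⊠ (lit (+ 9) ⊠ (X ⊠ (f ⊠ f))) ⊞ b ⊠ (lit (+ 9) ⊠ (X ⊠ (f ⊠ f)) ⊞ lit (+ 3) ⊠ (lit (+ 3) ⊠ (Y ⊠ (f ⊠ f))))))
                ≗-refl (const a) (const b) t f X (ϑ X) m)
            (trans (t-⊛ _ m) (shift-cong (λ n → trans
              (cong₂ _+_ (trans (const-⊛ a _ n) (*-congˡ (const-⊛ _ _ n)))
                (trans (const-⊛ b _ n) (*-congˡ (cong₂ _+_ (const-⊛ _ _ n) (const-⊛ _ _ n)))))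
              (solve 4 (λ a b x z → a :* (con (+ 9) :* x) :+ b :* (con (+ 9) :* x :+ con (+ 3) :* z)
                := con (+ 9) :* (a :+ b) :* x :+ con (+ 3) :* b :* z) refl a b (β₁ n) (β₂ n))) m))))

      cube-lifted : Lifted (Cube.cube h)
      cube-lifted = go ρ³-head mixed-head
        where
        go : ∃[ E ] Error E × (∀ m → section 0 ρ³ m ≈[ 4 ] F m + π 2 * shift E m) →
             ∃[ V ] Cubic V × (∀ m → section 0 (ρ² ⊛ θ) m ≡ shift V m) → Lifted (Cube.cube h)
        go (E , eE , head) (V , sV , mixed) = E ⊕ (λ n → ι (+ 3) * V n) , error-+ eE (error-cubic sV) ,
          λ m → ≈-trans (cube-h (m ℕ.* p)) (≈-trans (≈-+ (head m) (≡⇒≈ (*-congˡ (*-congˡ (mixed m)))))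
            (≡⇒≈ (trans (solve 4 (λ F P E V → F :+ P :* E :+ P :* (con (+ 3) :* V) := F :+ P :* (E :+ con (+ 3) :* V)) refl (F m) (π 2) _ _)
              (+-congˡ (*-congˡ (trans (+-congˡ (sym (shift-scale (ι (+ 3)) V m))) (sym (shift-+ E _ m))))))))

      -- For c = 2 the exponents of ρ³ have residues up to 3 n₀ = p - 2, one short of q.
      last-null : c ≡ 2 → ∀ m → section q ρ³ m ≡ 0#
      last-null refl m = supported-⊛ ρ-high (supported-⊛ ρ-high ρ-high 2n₀<p) 3n₀<p q m
        (ℕ.s≤s⁻¹ (ℕP.≤-reflexive (trans (trans (ℕP.+-comm 2 _) (cong (λ z → n₀ ℕ.+ (n₀ ℕ.+ z) ℕ.+ 2) (sym (ℕP.+-identityʳ n₀))))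
          (trans balance (ℕP.+-identityʳ p))))) (ℕP.n<1+n q)

    lifted : Lifted F
    lifted = go orientation
      where
      go : (c ≡ 1 × c′ ≡ 2) ⊎ (c ≡ 2 × c′ ≡ 1) → Lifted F
      go (inj₁ (c≡1 , _)) = subst (λ c → Lifted (Cube.cube (hyp c))) c≡1 cube-lifted
      go (inj₂ (c≡2 , _)) = combine cube-lifted mixed-last
        where
        combine : Lifted (Cube.cube h) → ∃[ V ] Cubic V × (∀ m → section q (ρ² ⊛ θ) m ≡ V m) → Lifted F
        combine (E , eE , lift) (V , sV , mixed) = E ⊕ (λ n → ι (ℤ.- (+ 27)) * V₃ n) , error-+ eE (error-scale (loc-ι (ℤ.- (+ 27))) (error-cubic sV)) , both′
          where
          V₃ : S
          V₃ n = ι (+ 3) * V n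
          twist : ∀ n → F n ≡ Cube.cube h n + ι (ℤ.- (+ 27)) * shift (Cube.cube h) n
          twist n = trans (euler n) (subst (λ c → twisted n ≡ Cube.cube (hyp c) n + ι (ℤ.- (+ 27)) * shift (Cube.cube (hyp c)) n) (sym c≡2)
            (+-congˡ (trans (cong -_ (trans (const-⊛ _ _ n) (*-congˡ (t-⊛ _ n)))) (solve 1 (λ x → :- (con (+ 27) :* x) := con (ℤ.- (+ 27)) :* x) refl _))))
          -- The factor t in Euler's transformation reads h³ at the exponent m p - 1, which has
          -- residue q in the period before; m = 0 has no such period. There only 3 p² ρ² θ
          -- contributes.
          tail-part : ∀ m → shift (Cube.cube h) (m ℕ.* p) ≈[ 4 ] π 2 * shift V₃ m
          tail-part zero    = ≡⇒≈ (sym (zeroʳ _))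
          tail-part (suc m) = ≈-trans (cube-h (q ℕ.+ m ℕ.* p)) (≡⇒≈ (trans
            (cong₂ (λ x y → x + π 2 * (ι (+ 3) * y)) (last-null c≡2 m) (mixed m)) (+-identityˡ _)))
          both′ : ∀ m → F (m ℕ.* p) ≈[ 4 ] F m + π 2 * shift (E ⊕ (λ n → ι (ℤ.- (+ 27)) * V₃ n)) m
          both′ m = ≈-trans (≡⇒≈ (twist (m ℕ.* p))) (≈-trans (≈-+ (lift m) (≈-*ˡ (loc-ι (ℤ.- (+ 27))) (tail-part m)))
            (≡⇒≈ (trans (solve 5 (λ F P E s W → F :+ P :* E :+ s :* (P :* W) := F :+ P :* (E :+ s :* W)) refl (F m) (π 2) _ (ι (ℤ.- (+ 27))) _)
              (+-congˡ (*-congˡ (trans (+-congˡ (sym (shift-scale (ι (ℤ.- (+ 27))) V₃ m))) (sym (shift-+ E _ m))))))))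

-- The recurrence along multiples of p, modulo p⁸.

module Stride (𝔾 : Ground) (q : ℕ) (p-prime : Prime (suc q)) where
  open Scalars 𝔾
  open Series 𝔾
  open Hypergeometric 𝔾 hiding (rhs; X)
  open Products 𝔾
  open Block 𝔾 q p-prime
  open Scalars.Solver 𝔾 using (solve; _:=_; _:+_; _:*_; _:-_; :-_; _:^_; con)

  private
    n̂-1 : n̂ 1 ≡ 1#
    n̂-1 = ι-1

    P-reflect : ∀ x → P (- 1# + - x) ≡ P x
    P-reflect x = solve 2 (λ x o → con (+ 54) :* ((:- o :+ :- x) :* ((:- o :+ :- x) :+ o) :* ((:- o :+ :- x) :* ((:- o :+ :- x) :+ o)))
        :+ con (+ 48) :* ((:- o :+ :- x) :* ((:- o :+ :- x) :+ o)) :+ con (+ 9)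
      := con (+ 54) :* (x :* (x :+ o) :* (x :* (x :+ o))) :+ con (+ 48) :* (x :* (x :+ o)) :+ con (+ 9)) refl x 1#

  8th : K → K
  8th x = 4th x * 4th x

  -- The determinant of a tridiagonal matrix with diagonal P(x), ..., P(x + r - 1). Eighth powers
  -- arise because the coefficient 729 (x + i)⁴ meets the leading coefficient (x + i)⁴ cleared one
  -- step earlier.
  continuant : ℕ → K → K
  continuant 0             x = 1#
  continuant 1             x = P x
  continuant (suc (suc r)) x = P (x + n̂ (suc r)) * continuant (suc r) x
    + - (ι (+ 729) * (8th (x + n̂ (suc r)) * continuant r x))

  -- Expansion of the determinant at the first row, where the definition expands at the last.
  -- Comparing the two reverses the order of the diagonal.
  continuant-left : ∀ r x → continuant (suc (suc r)) x
    ≡ P x * continuant (suc r) (x + 1#) + - (ι (+ 729) * (8th (x + 1#) * continuant r (x + 1# + 1#)))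
  continuant-left 0 x = trans (cong (λ o → P (x + o) * P x + - (ι (+ 729) * (8th (x + o) * 1#))) n̂-1) (+-congʳ (*-comm _ _))
  continuant-left 1 x = trans
    (cong₂ (λ o o₂ → P (x + o₂) * (P (x + o) * P x + - (ι (+ 729) * (8th (x + o) * 1#))) + - (ι (+ 729) * (8th (x + o₂) * P x))) n̂-1 (trans (n̂-suc 1) (+-congʳ n̂-1)))
    (trans (cong (λ z → P z * (P (x + 1#) * P x + - (ι (+ 729) * (8th (x + 1#) * 1#))) + - (ι (+ 729) * (8th z * P x))) (sym (+-assoc x 1# 1#)))
    (trans (solve 7 (λ a b c s d e o → a :* (b :* c :+ :- (s :* (d :* o))) :+ :- (s :* (e :* c))
        := c :* (a :* b :+ :- (s :* e)) :+ :- (s :* (d :* (a :* o)))) refl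
        (P (x + 1# + 1#)) (P (x + 1#)) (P x) (ι (+ 729)) (8th (x + 1#)) (8th (x + 1# + 1#)) 1#)
      (trans (cong₂ (λ u v → P x * (P (x + 1# + 1#) * P (x + 1#) + - (ι (+ 729) * u)) + - (ι (+ 729) * (8th (x + 1#) * v)))
          (sym (*-identityʳ _)) (*-identityʳ _))
        (cong (λ o → P x * (P (x + 1# + o) * P (x + 1#) + - (ι (+ 729) * (8th (x + 1# + o) * 1#))) + - (ι (+ 729) * (8th (x + 1#) * P (x + 1# + 1#)))) (sym n̂-1)))))
  continuant-left (suc (suc r)) x = trans
    (cong₂ (λ u v → P (x + n̂ (3 ℕ.+ r)) * u + - (ι (+ 729) * (8th (x + n̂ (3 ℕ.+ r)) * v))) (continuant-left (suc r) x) (continuant-left r x))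
    (trans (cong (λ z → P z * (P x * continuant (2 ℕ.+ r) x₁ + - (ι (+ 729) * (8th x₁ * continuant (suc r) x₂)))
                        + - (ι (+ 729) * (8th z * (P x * continuant (suc r) x₁ + - (ι (+ 729) * (8th x₁ * continuant r x₂)))))) at₁)
    (trans (solve 9 (λ p₃ p a b s e₁ e₃ c d → p₃ :* (p :* a :+ :- (s :* (e₁ :* b))) :+ :- (s :* (e₃ :* (p :* c :+ :- (s :* (e₁ :* d)))))
        := p :* (p₃ :* a :+ :- (s :* (e₃ :* c))) :+ :- (s :* (e₁ :* (p₃ :* b :+ :- (s :* (e₃ :* d))))))
        refl (P (x₁ + n̂ (2 ℕ.+ r))) (P x) (continuant (2 ℕ.+ r) x₁) (continuant (suc r) x₂) (ι (+ 729)) (8th x₁) (8th (x₁ + n̂ (2 ℕ.+ r)))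
        (continuant (suc r) x₁) (continuant r x₂))
      (cong (λ z → P x * continuant (3 ℕ.+ r) x₁ + - (ι (+ 729) * (8th x₁ * (P z * continuant (suc r) x₂ + - (ι (+ 729) * (8th z * continuant r x₂)))))) at₂)))
    where
    x₁ = x + 1#
    x₂ = x + 1# + 1#
    up : ∀ y n → y + n̂ (suc n) ≡ y + 1# + n̂ n
    up y n = trans (+-congˡ (trans (n̂-suc n) (+-comm _ _))) (sym (+-assoc y 1# (n̂ n)))
    at₁ : x + n̂ (3 ℕ.+ r) ≡ x₁ + n̂ (2 ℕ.+ r)
    at₁ = up x _
    at₂ : x₁ + n̂ (2 ℕ.+ r) ≡ x₂ + n̂ (suc r)
    at₂ = up x₁ _

  -- P(-1 - x) = P(x) and the eighth power is even, so x ↦ -r - x just reverses the tridiagonal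
  -- matrix. For r = p this is `reflect`.
  continuant-reflect : ∀ r x → continuant r (- n̂ r + - x) ≡ continuant r x
  continuant-reflect 0 x = refl
  continuant-reflect 1 x = trans (cong (λ o → P (- o + - x)) n̂-1) (P-reflect x)
  continuant-reflect (suc (suc r)) x = trans
    (cong₂ (λ u v → P y * u + - (ι (+ 729) * (8th y * v)))
      (trans (cong (continuant (suc r)) low₁) (continuant-reflect (suc r) (x + 1#)))
      (trans (cong (continuant r) low₂) (continuant-reflect r (x + 1# + 1#))))
    (trans (cong₂ (λ u v → u * continuant (suc r) (x + 1#) + - (ι (+ 729) * (v * continuant r (x + 1# + 1#))))
        (trans (cong P y≡) (P-reflect x))
        (trans (cong 8th y≡) (solve 2 (λ x o → let u = :- o :+ :- x ; v = x :+ o in u :* u :* (u :* u) :* (u :* u :* (u :* u)) := v :* v :* (v :* v) :* (v :* v :* (v :* v))) refl x 1#)))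
      (sym (continuant-left r x)))
    where
    y = - n̂ (2 ℕ.+ r) + - x + n̂ (suc r)
    n₂ = n̂-suc (suc r)
    n₁ = n̂-suc r
    y≡ : y ≡ - 1# + - x
    y≡ = trans (cong (λ z → - z + - x + n̂ (suc r)) n₂) (solve 3 (λ n o x → :- (n :+ o) :+ :- x :+ n := :- o :+ :- x) refl (n̂ (suc r)) 1# x)
    low₁ : - n̂ (2 ℕ.+ r) + - x ≡ - n̂ (suc r) + - (x + 1#)
    low₁ = trans (cong (λ z → - z + - x) n₂) (solve 3 (λ n o x → :- (n :+ o) :+ :- x := :- n :+ :- (x :+ o)) refl (n̂ (suc r)) 1# x)
    low₂ : - n̂ (2 ℕ.+ r) + - x ≡ - n̂ r + - (x + 1# + 1#)
    low₂ = trans low₁ (trans (cong (λ z → - z + - (x + 1#)) n₁) (solve 3 (λ n o x → :- (n :+ o) :+ :- (x :+ o) := :- n :+ :- (x :+ o :+ o)) refl (n̂ r) 1# x))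

  -- The solution of the same three-term recursion with initial values 0 and 1: the minor without
  -- the first row and column. It multiplies the value of F just before the starting point.
  cocontinuant : ℕ → K → K
  cocontinuant zero    x = 0#
  cocontinuant (suc r) x = continuant r (x + 1#)

  cocontinuant-step : ∀ r x → cocontinuant (suc (suc r)) x
    ≡ P (x + n̂ (suc r)) * cocontinuant (suc r) x + - (ι (+ 729) * (8th (x + n̂ (suc r)) * cocontinuant r x))
  cocontinuant-step zero x = trans (cong (λ o → P (x + o)) (sym n̂-1)) (sym (trans
    (cong₂ _+_ (*-identityʳ _) (trans (cong -_ (trans (*-congˡ (zeroʳ _)) (zeroʳ _))) -0#≡0#)) (+-identityʳ _)))
  cocontinuant-step (suc r) x = cong (λ z → P z * continuant (suc r) (x + 1#) + - (ι (+ 729) * (8th z * continuant r (x + 1#))))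
    (trans (+-assoc x 1# _) (+-congˡ (trans (+-comm _ _) (sym (n̂-suc (suc r))))))

  rep-4th : ∀ {N f} → Rep N f → Rep N (λ m → 4th (f m))
  rep-4th F = rep-* (rep-* F F) (rep-* F F)

  rep-P : ∀ {N f} → Rep N f → Rep N (λ m → P (f m))
  rep-P F = rep-+ (rep-+ (rep-* (rep-const (loc-ι (+ 54))) (rep-* Y Y)) (rep-* (rep-const (loc-ι (+ 48))) Y)) (rep-const (loc-ι (+ 9)))
    where Y = rep-* F (rep-+ F (rep-const loc-1))

  rep-continuant : ∀ {N f} → Rep N f → ∀ r → Rep N (λ m → continuant r (f m))
  rep-continuant F 0 = rep-const loc-1
  rep-continuant F 1 = rep-P F
  rep-continuant F (suc (suc r)) = rep-+ (rep-* (rep-P G) (rep-continuant F (suc r)))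
      (rep-neg (rep-* (rep-const (loc-ι (+ 729))) (rep-* (rep-* (rep-4th G) (rep-4th G)) (rep-continuant F r))))
    where G = rep-+ F (rep-const (loc-ι (+ suc r)))

  module _ {F : S} (F-recurrent : Recurrent F) where

    walk : ℕ → K → K
    walk r x = ∏ r (λ i → 4th (x + n̂ (suc i)))

    Expanded : ℕ → ℕ → Set
    Expanded m r = let x = ϖ * n̂ m in walk r x * F (r ℕ.+ m ℕ.* p)
      ≡ continuant r x * F (m ℕ.* p) + - (ι (+ 729) * (4th x * (cocontinuant r x * shift F (m ℕ.* p))))

    private
      index : ∀ r m → n̂ (r ℕ.+ m ℕ.* p) ≡ ϖ * n̂ m + n̂ r
      index r m = trans (n̂-+ r (m ℕ.* p)) (trans (+-comm _ _) (+-congʳ (trans (n̂-* m p) (*-comm _ _))))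

      advance : ∀ r m → let x = ϖ * n̂ m in
        4th (x + n̂ (suc r)) * F (suc r ℕ.+ m ℕ.* p)
        ≡ P (x + n̂ r) * F (r ℕ.+ m ℕ.* p) + - (ι (+ 729) * (4th (x + n̂ r) * shift F (r ℕ.+ m ℕ.* p)))
      advance r m = trans (trans (cong (λ z → 4th z * F (suc r ℕ.+ m ℕ.* p)) (sym (index (suc r) m)))
        (trans (solve 2 (λ a b → a := a :+ b :+ :- b) refl _ _) (+-congʳ (F-recurrent (r ℕ.+ m ℕ.* p)))))
        (cong (λ z → P z * F (r ℕ.+ m ℕ.* p) + - (ι (+ 729) * (4th z * shift F (r ℕ.+ m ℕ.* p)))) (index r m))

      expansions : ∀ m r → Expanded m r × Expanded m (suc r)
      expansions m zero = trans (*-identityˡ _) (sym (trans (cong₂ _+_ (*-identityˡ _)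
            (trans (cong -_ (trans (*-congˡ (trans (*-congˡ (zeroˡ _)) (zeroʳ _))) (zeroʳ _))) -0#≡0#)) (+-identityʳ _))) ,
        trans (*-congʳ (*-identityʳ _)) (trans (advance 0 m) (trans
          (cong (λ z → P z * F (m ℕ.* p) + - (ι (+ 729) * (4th z * shift F (m ℕ.* p)))) (trans (+-congˡ ι-0) (+-identityʳ _)))
          (+-congˡ (cong -_ (*-congˡ (*-congˡ (sym (*-identityˡ _))))))))
      expansions m (suc r) = proj₂ (expansions m r) , next (proj₁ (expansions m r)) (proj₂ (expansions m r))
        where
        x = ϖ * n̂ m
        s = ι (+ 729)
        A = F (m ℕ.* p)
        B = shift F (m ℕ.* p)
        next : Expanded m r → Expanded m (suc r) → Expanded m (suc (suc r))
        next e₀ e₁ = trans (*-congʳ (∏-last (suc r) (λ i → 4th (x + n̂ (suc i)))))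
          (trans (*-assoc _ _ _) (trans (*-congˡ (advance (suc r) m))
          (trans (solve 6 (λ v p f₁ s c f₀ → v :* (p :* f₁ :+ :- (s :* (c :* f₀))) := p :* (v :* f₁) :+ :- (s :* (c :* (v :* f₀))))
              refl (walk (suc r) x) (P (x + n̂ (suc r))) (F (suc r ℕ.+ m ℕ.* p)) s (4th (x + n̂ (suc r))) (F (r ℕ.+ m ℕ.* p)))
          (trans (cong₂ (λ u v → P (x + n̂ (suc r)) * u + - (s * (4th (x + n̂ (suc r)) * v))) e₁
              (trans (*-congʳ (∏-last r (λ i → 4th (x + n̂ (suc i))))) (trans (solve 3 (λ a b c → a :* b :* c := b :* (a :* c)) refl (walk r x) (4th (x + n̂ (suc r))) (F (r ℕ.+ m ℕ.* p))) (*-congˡ e₀))))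
          (trans (solve 10 (λ P c₁ A s X t₁ B e c₀ t₀ →
               P :* (c₁ :* A :+ :- (s :* (X :* (t₁ :* B)))) :+ :- (s :* (e :* (e :* (c₀ :* A :+ :- (s :* (X :* (t₀ :* B)))))))
               := (P :* c₁ :+ :- (s :* (e :* e :* c₀))) :* A :+ :- (s :* (X :* ((P :* t₁ :+ :- (s :* (e :* e :* t₀))) :* B))))
               refl (P (x + n̂ (suc r))) (continuant (suc r) x) A s (4th x) (cocontinuant (suc r) x) B (4th (x + n̂ (suc r))) (continuant r x) (cocontinuant r x))
            (cong (λ z → continuant (suc (suc r)) x * A + - (s * (4th x * (z * B)))) (sym (cocontinuant-step r x))))))))

    expanded : ∀ m r → Expanded m r
    expanded m r = proj₁ (expansions m r)

    module _ (5≤p : 5 ℕ.≤ p) (F-integral : ∀ n → Loc (F n)) where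
      open Halves 5≤p

      private
        iv : ℤ → K
        iv m = 4th (winv m)

        liv : ∀ m → Loc (iv m)
        liv m = loc-* (loc-* (winv-loc m) (winv-loc m)) (loc-* (winv-loc m) (winv-loc m))

        iv-mirror : ∀ m → iv (mirror m) ≡ iv m
        iv-mirror m = trans (sym (*-identityʳ _)) (trans (*-congˡ (sym (square m)))
          (trans (cong (λ z → iv (mirror m) * (z * (W m * iv m))) (sym (W-mirror m)))
            (trans (solve 4 (λ a W W′ b → a :* (W :* (W′ :* b)) := (W′ :* (W :* a)) :* b) refl (iv (mirror m)) (W (mirror m)) (W m) (iv m))
              (trans (*-congʳ (trans (*-congʳ (sym (W-mirror m))) (square (mirror m)))) (*-identityˡ _)))))
          where
          square : ∀ m → W m * (W m * iv m) ≡ 1#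
          square m = trans (solve 2 (λ W v → W :* (W :* (v :* v :* (v :* v))) := (W :* (v :* v)) :* (W :* (v :* v))) refl (W m) (winv m))
            (trans (cong (λ z → z * z) (W-inverse m)) (*-identityˡ 1#))

        walk-iv : ∀ m → walk q (ϖ * ι m) * iv m ≡ 1#
        walk-iv m = trans (*-congʳ (trans (∏-* q _ _) (cong₂ _*_ (∏-* q _ _) (∏-* q _ _))))
          (trans (solve 2 (λ w v → w :* w :* (w :* w) :* (v :* v :* (v :* v)) := w :* v :* (w :* v) :* (w :* v :* (w :* v))) refl (w (ϖ * ι m)) (winv m))
            (trans (cong 4th (w-winv m)) (trans (cong (λ z → z * z) (*-identityˡ 1#)) (*-identityˡ 1#))))

        4th-ϖ : ∀ x → 4th (ϖ * x) ≡ π 4 * 4th x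
        4th-ϖ x = solve 2 (λ w x → w :* x :* (w :* x) :* (w :* x :* (w :* x)) := w :* (w :* (w :* (w :* w :^ 0))) :* (x :* x :* (x :* x))) refl ϖ x

        walk-p : ∀ m → walk p (ϖ * n̂ m) * iv (+ m) ≡ π 4 * 4th (n̂ (suc m))
        walk-p m = trans (*-congʳ (∏-last q (λ i → 4th (ϖ * n̂ m + n̂ (suc i)))))
          (trans (solve 3 (λ a b c → a :* b :* c := a :* c :* b) refl (walk q (ϖ * n̂ m)) (4th (ϖ * n̂ m + ϖ)) (iv (+ m)))
          (trans (*-congʳ (walk-iv (+ m))) (trans (*-identityˡ _)
          (trans (cong 4th (trans (+-congˡ (sym (*-identityʳ ϖ))) (trans (sym (distribˡ ϖ _ _)) (*-congˡ (sym (n̂-suc m))))))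
            (4th-ϖ (n̂ (suc m)))))))

        n̄ : ℤ → K
        n̄ m = continuant p (ϖ * ι m) * iv m

        rep-iv : ∀ {N} → Rep (suc N) iv
        rep-iv = rep-4th rep-winv

        n̄-mirror : ∀ m → n̄ (mirror m) ≡ n̄ m
        n̄-mirror m = cong₂ _*_ (trans (cong (continuant p) (reflect-mirror m)) (continuant-reflect p (ϖ * ι m))) (iv-mirror m)

        eval₈ : ∀ c x → eval 8 c x ≡ c 0 + x * (c 1 + x * (c 2 + x * (c 3 + x * (c 4 + x * (c 5 + x * (c 6 + x * c 7))))))
        eval₈ c x = cong (λ z → c 0 + x * (c 1 + x * (c 2 + x * (c 3 + x * (c 4 + x * (c 5 + x * (c 6 + x * z)))))))
          (trans (+-congˡ (zeroʳ x)) (+-identityʳ (c 7)))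

      -- A function of m invariant under m ↦ −1 − m is a polynomial in m (m + 1).
      n̄-pronic : ∃[ η ] (∀ i → Loc (η i)) × (∀ m → n̄ m ≈[ 8 ] eval 4 η (pronic (ι m)))
      n̄-pronic = go (rep-* (rep-continuant rep-var p) rep-iv)
        where
        go : Rep 8 n̄ → ∃[ η ] (∀ i → Loc (η i)) × (∀ m → n̄ m ≈[ 8 ] eval 4 η (pronic (ι m)))
        go (rep k lk a) = η , lη , approx
          where
          d : S
          d i = π i * k i
          ld : ∀ i → Loc (d i)
          ld i = loc-* (loc-π i) (lk i)
          infixl 6 _⊹_
          infix 9 _·_
          _·_ : ℤ → ℕ → K
          i · j = ι i * d j
          _⊹_ : K → K → K
          _⊹_ = _+_
          ld· : ∀ i j → Loc (i · j)
          ld· i j = loc-* (loc-ι i) (ld j)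
          -- The coefficient of `d j` in `2η i` is that of yⁱ when xʲ + (-1 - x)ʲ is written as a
          -- polynomial in y = x (x + 1); for j = 4 it is 1 + 4 y + 2 y².
          2η : S
          2η 0 = (+ 2) · 0 ⊹ -[1+ 0 ] · 1 ⊹ (+ 1) · 2 ⊹ -[1+ 0 ] · 3 ⊹ (+ 1) · 4 ⊹ -[1+ 0 ] · 5 ⊹ (+ 1) · 6 ⊹ -[1+ 0 ] · 7
          2η 1 = (+ 2) · 2 ⊹ -[1+ 2 ] · 3 ⊹ (+ 4) · 4 ⊹ -[1+ 4 ] · 5 ⊹ (+ 6) · 6 ⊹ -[1+ 6 ] · 7
          2η 2 = (+ 2) · 4 ⊹ -[1+ 4 ] · 5 ⊹ (+ 9) · 6 ⊹ -[1+ 13 ] · 7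
          2η 3 = (+ 2) · 6 ⊹ -[1+ 6 ] · 7
          2η _ = 0#
          η : S
          η i = half * 2η i
          lη : ∀ i → Loc (η i)
          lη i = loc-* (loc-inv unit-2) (l2 i)
            where
            l2 : ∀ i → Loc (2η i)
            l2 0 = loc-+ (loc-+ (loc-+ (loc-+ (loc-+ (loc-+ (loc-+ (ld· _ 0) (ld· _ 1)) (ld· _ 2)) (ld· _ 3)) (ld· _ 4)) (ld· _ 5)) (ld· _ 6)) (ld· _ 7)
            l2 1 = loc-+ (loc-+ (loc-+ (loc-+ (loc-+ (ld· _ 2) (ld· _ 3)) (ld· _ 4)) (ld· _ 5)) (ld· _ 6)) (ld· _ 7)
            l2 2 = loc-+ (loc-+ (loc-+ (ld· _ 4) (ld· _ 5)) (ld· _ 6)) (ld· _ 7)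
            l2 3 = loc-+ (ld· _ 6) (ld· _ 7)
            l2 (suc (suc (suc (suc _)))) = loc-0
          value : ∀ m → n̄ m ≈[ 8 ] eval 8 d (ι m)
          value m = ≈-trans (a m) (≡⇒≈ (eval-scaled 8 k (ι m)))
          symmetric : ∀ m → eval 8 d (ι m) + eval 8 d (ι (mirror m)) ≡ eval 4 2η (pronic (ι m))
          symmetric m = trans (cong₂ _+_ (eval₈ d (ι m)) (trans (eval₈ d _) (cong (λ z → d 0 + z * (d 1 + z * (d 2 + z * (d 3 + z * (d 4 + z * (d 5 + z * (d 6 + z * d 7))))))) (ι-mirror m))))
            (trans (solve 9 (λ m d₀ d₁ d₂ d₃ d₄ d₅ d₆ d₇ →
                let x = m ; z = :- (con (+ 1) :+ m) ; y = m :* (m :+ con (+ 1)) in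
                (d₀ :+ x :* (d₁ :+ x :* (d₂ :+ x :* (d₃ :+ x :* (d₄ :+ x :* (d₅ :+ x :* (d₆ :+ x :* d₇)))))))
                :+ (d₀ :+ z :* (d₁ :+ z :* (d₂ :+ z :* (d₃ :+ z :* (d₄ :+ z :* (d₅ :+ z :* (d₆ :+ z :* d₇)))))))
                := (con (+ 2) :* d₀ :+ con -[1+ 0 ] :* d₁ :+ con (+ 1) :* d₂ :+ con -[1+ 0 ] :* d₃ :+ con (+ 1) :* d₄ :+ con -[1+ 0 ] :* d₅ :+ con (+ 1) :* d₆ :+ con -[1+ 0 ] :* d₇)
                :+ y :* ((con (+ 2) :* d₂ :+ con -[1+ 2 ] :* d₃ :+ con (+ 4) :* d₄ :+ con -[1+ 4 ] :* d₅ :+ con (+ 6) :* d₆ :+ con -[1+ 6 ] :* d₇)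
                :+ y :* ((con (+ 2) :* d₄ :+ con -[1+ 4 ] :* d₅ :+ con (+ 9) :* d₆ :+ con -[1+ 13 ] :* d₇)
                :+ y :* (con (+ 2) :* d₆ :+ con -[1+ 6 ] :* d₇))))
                refl (ι m) (d 0) (d 1) (d 2) (d 3) (d 4) (d 5) (d 6) (d 7))
              (sym (eval₄ 2η (pronic (ι m)))))
          approx : ∀ m → n̄ m ≈[ 8 ] eval 4 η (pronic (ι m))
          approx m = ≈-trans (≡⇒≈ (trans (sym (half-2 (n̄ m))) (*-congˡ (trans (solve 1 (λ x → con (+ 2) :* x := x :+ x) refl (n̄ m)) (+-congˡ (sym (n̄-mirror m)))))))
            (≈-trans (≈-*ˡ (loc-inv unit-2) (≈-+ (value m) (value (mirror m))))
              (≡⇒≈ (trans (*-congˡ (symmetric m)) (sym (eval-scale 4 half 2η _)))))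

      private
        a : S
        a m = F (m ℕ.* p)

        lcoc : ∀ m → Loc (cocontinuant p (ϖ * ι m))
        lcoc m = rep-loc (rep-continuant {0} (rep-+ rep-var (rep-const loc-1)) q) m

        s̄ : ℤ → K
        s̄ m = ι (+ 729) * (cocontinuant p (ϖ * ι m) * iv m * (iv (ℤ.pred m) * continuant q (ϖ * ι (ℤ.pred m))))

        rep-s̄ : Rep 4 s̄
        rep-s̄ = rep-* (rep-const (loc-ι (+ 729))) (rep-* (rep-* (rep-continuant (rep-+ rep-var (rep-const loc-1)) q) rep-iv)
            (rep-∘ ℤ.pred pred-var (rep-* rep-iv (rep-continuant rep-var q))))
          where
          pred-var : Rep 4 (λ m → ϖ * ι (ℤ.pred m))
          pred-var = rep-ext (λ m → trans (*-congˡ (ι-+ -[1+ 0 ] m)) (trans (distribˡ ϖ _ _) (+-comm _ _)))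
            (rep-+ rep-var (rep-const (loc-* (loc-ι (+ p)) (loc-ι -[1+ 0 ]))))

        -- The exponent is (m + 1) p - 1. In its expansion the value at m p - 1 carries the factor
        -- (p m)⁴ and drops out, leaving a multiple of a_m. Modulo p⁴ is enough, since `stride`
        -- multiplies this value by another p⁴.
        previous : ∀ m → F (q ℕ.+ m ℕ.* p) ≈[ 4 ] iv (+ m) * continuant q (ϖ * n̂ m) * a m
        previous m = ≈-trans (≡⇒≈ (sym (undo _))) (≈-trans (≈-*ˡ (liv (+ m)) (≈-trans (≡⇒≈ (expanded m q)) small)) (≡⇒≈ (sym (*-assoc _ _ _))))
          where
          undo : ∀ z → iv (+ m) * (walk q (ϖ * n̂ m) * z) ≡ z
          undo z = trans (solve 3 (λ i w z → i :* (w :* z) := w :* i :* z) refl (iv (+ m)) (walk q (ϖ * n̂ m)) z)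
            (trans (*-congʳ (walk-iv (+ m))) (*-identityˡ z))
          lb : Loc (shift F (m ℕ.* p))
          lb = go (m ℕ.* p)
            where
            go : ∀ n → Loc (shift F n)
            go zero    = loc-0
            go (suc n) = F-integral n
          lt : ∀ r → Loc (cocontinuant r (ϖ * n̂ m))
          lt zero    = loc-0
          lt (suc r) = rep-loc (rep-continuant {0} (rep-+ rep-var (rep-const loc-1)) r) (+ m)
          small : continuant q (ϖ * n̂ m) * a m + - (ι (+ 729) * (4th (ϖ * n̂ m) * (cocontinuant q (ϖ * n̂ m) * shift F (m ℕ.* p))))
            ≈[ 4 ] continuant q (ϖ * n̂ m) * a m
          small = ≈-trans (≈-+ ≈-refl (≈-trans
              (≡⇒≈ (trans (cong (λ z → - (ι (+ 729) * (z * (cocontinuant q (ϖ * n̂ m) * shift F (m ℕ.* p))))) (4th-ϖ (n̂ m)))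
                (solve 4 (λ s P x y → :- (s :* (P :* x :* y)) := P :* :- (s :* (x :* y))) refl (ι (+ 729)) (π 4) (4th (n̂ m)) _)))
              (π-null 4 (loc-neg (loc-* (loc-ι (+ 729)) (loc-* (loc-* (loc-* l l) (loc-* l l)) (loc-* (lt q) lb)))))))
            (≡⇒≈ (+-identityʳ _))
            where l = loc-ι (+ m)

      -- The expansion over p steps, divided by w(p m)⁴, has p⁴ (m + 1)⁴ a_{m+1} exactly on one
      -- side. The coefficient of a_m comes from `n̄-pronic`; the last term is p⁴ m⁴ times a value
      -- that `previous` replaces by a multiple of a_{m-1}.
      stride : ∃[ η ] ∃[ s ] (∀ i → Loc (η i)) × (∀ i → Loc (s i)) ×
        (∀ m → eval 4 η (pronic (n̂ m)) * a m + - (π 4 * (4th (n̂ m) * (eval 4 s (n̂ m) * shift a m)))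
               ≈[ 8 ] π 4 * (4th (n̂ (suc m)) * a (suc m)))
      stride = go n̄-pronic rep-s̄
        where
        go : ∃[ η ] (∀ i → Loc (η i)) × (∀ m → n̄ m ≈[ 8 ] eval 4 η (pronic (ι m))) → Rep 4 s̄ →
          ∃[ η ] ∃[ s ] (∀ i → Loc (η i)) × (∀ i → Loc (s i)) ×
          (∀ m → eval 4 η (pronic (n̂ m)) * a m + - (π 4 * (4th (n̂ m) * (eval 4 s (n̂ m) * shift a m)))
                 ≈[ 8 ] π 4 * (4th (n̂ (suc m)) * a (suc m)))
        go (η , lη , η≈) (rep k lk k≈) = η , s , lη , (λ i → loc-* (loc-π i) (lk i)) ,
            λ m → ≈-trans (≈-+ (≈-*ʳ (F-integral _) (≈-sym (η≈ (+ m)))) (≈-neg (≈-π 4 (≈-*ˡ (l4 m) (≈-sym (old m))))))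
              (≡⇒≈ (sym (exact m)))
          where
          s : S
          s i = π i * k i
          l4 : ∀ m → Loc (4th (n̂ m))
          l4 m = loc-* (loc-* l l) (loc-* l l)
            where l = loc-ι (+ m)
          late : ℕ → K
          late m = ι (+ 729) * (cocontinuant p (ϖ * n̂ m) * iv (+ m) * shift F (m ℕ.* p))
          old : ∀ m → late m ≈[ 4 ] eval 4 s (n̂ m) * shift a m
          old zero    = ≡⇒≈ (trans (*-congˡ (zeroʳ _)) (trans (zeroʳ _) (sym (zeroʳ _))))
          old (suc m) = ≈-trans (≈-*ˡ (loc-ι (+ 729)) (≈-*ˡ (loc-* (lcoc (+ suc m)) (liv (+ suc m))) (previous m)))
            (≈-trans (≡⇒≈ (solve 5 (λ s c i j x → s :* (c :* i :* (j :* x)) := s :* (c :* i :* j) :* x) refl (ι (+ 729))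
                (cocontinuant p (ϖ * n̂ (suc m))) (iv (+ suc m)) (iv (+ m) * continuant q (ϖ * n̂ m)) (a m)))
              (≈-*ʳ (F-integral _) (≈-trans (k≈ (+ suc m)) (≡⇒≈ (eval-scaled 4 k (n̂ (suc m)))))))
          exact : ∀ m → π 4 * (4th (n̂ (suc m)) * a (suc m)) ≡ n̄ (+ m) * a m + - (π 4 * (4th (n̂ m) * late m))
          exact m = trans (sym (*-assoc _ _ _)) (trans (*-congʳ (sym (walk-p m)))
            (trans (solve 3 (λ v i x → v :* i :* x := i :* (v :* x)) refl (walk p (ϖ * n̂ m)) (iv (+ m)) (a (suc m)))
            (trans (*-congˡ (expanded m p))
            (trans (cong (λ z → iv (+ m) * (continuant p (ϖ * n̂ m) * a m + - (ι (+ 729) * (z * (cocontinuant p (ϖ * n̂ m) * shift F (m ℕ.* p)))))) (4th-ϖ (n̂ m)))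
              (solve 8 (λ i c A s P x t b → i :* (c :* A :+ :- (s :* (P :* x :* (t :* b)))) := c :* i :* A :+ :- (P :* (x :* (s :* (t :* i :* b)))))
                refl (iv (+ m)) (continuant p (ϖ * n̂ m)) (a m) (ι (+ 729)) (π 4) (4th (n̂ m)) (cocontinuant p (ϖ * n̂ m)) (shift F (m ℕ.* p)))))))

-- Explicit integers and the certificate for the linear system.

module Tables where

  at : {X : Set} → X → List X → ℕ → X
  at d []       _       = d
  at d (x ∷ _)  zero    = x
  at d (_ ∷ xs) (suc n) = at d xs n

  -- Listed up to 21 because p = 7 needs a_3 = A_21. `recurrent` checks the list, and `value`
  -- identifies it with the coefficients of the cube.
  A : ℕ → ℤ
  A = at (+ 0)
    (+ 1 ∷ + 9 ∷ + 135 ∷ + 2439 ∷ + 48519 ∷ + 1023759 ∷ + 22478121 ∷ + 507897945 ∷ + 11727334791 ∷ + 275409734751 ∷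
     + 6556498796385 ∷ + 157841449993665 ∷ + 3835575156803625 ∷ + 93947556526734465 ∷ + 2316867932996452215 ∷
     + 57476307230175422439 ∷ + 1433280811235078958471 ∷ + 35905990596126060019455 ∷ + 903186018342615310954641 ∷
     + 22802253371684252762688081 ∷ + 577579228734556282409564769 ∷ + 14673839929993085942279867481 ∷ [])

  shift : (ℕ → ℤ) → ℕ → ℤ
  shift u zero    = + 0
  shift u (suc n) = u n

  β₁ β₂ ϑβ₁ : ℕ → ℤ
  β₁ zero    = A 0
  β₁ (suc n) = + 27 ℤ.* β₁ n ℤ.+ (+ 2 ℤ.* + suc n ℤ.+ + 1) ℤ.* A (suc n)
  β₂ zero    = + 0
  β₂ (suc n) = + 27 ℤ.* β₂ n ℤ.+ + 135 ℤ.* β₁ n ℤ.+ + suc n ℤ.* A (suc n)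
  ϑβ₁ n = + n ℤ.* β₁ n

  4th : ℤ → ℤ
  4th x = x ℤ.* x ℤ.* (x ℤ.* x)

  P : ℤ → ℤ
  P x = + 54 ℤ.* (x ℤ.* (x ℤ.+ + 1) ℤ.* (x ℤ.* (x ℤ.+ + 1))) ℤ.+ + 48 ℤ.* (x ℤ.* (x ℤ.+ + 1)) ℤ.+ + 9

  L : (ℕ → ℤ) → ℕ → ℤ
  L u m = 4th (+ suc m) ℤ.* u (suc m) ℤ.+ ℤ.- (P (+ m) ℤ.* u m) ℤ.+ + 729 ℤ.* (4th (+ m) ℤ.* shift u m)

  recurrent : ∀ {n} → n ℕ.< 21 → L A n ≡ + 0
  recurrent = from-yes (ℕP.allUpTo? (λ n → L A n ℤ.≟ + 0) 21)

  -- One equation: columns 0 to 3 belong to a cubic in y multiplying a_m, columns 4 to 7 to a cubic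
  -- in m multiplying m⁴ a_{m-1}, and columns 8 to 10 to the error constants, whose series have gone
  -- through the recurrence operator `L`.
  entry : (y m a a′ l₁ l₂ l₃ : ℤ) → ℕ → ℤ
  entry y m a a′ l₁ l₂ l₃ 0  = a
  entry y m a a′ l₁ l₂ l₃ 1  = y ℤ.* a
  entry y m a a′ l₁ l₂ l₃ 2  = y ℤ.* (y ℤ.* a)
  entry y m a a′ l₁ l₂ l₃ 3  = y ℤ.* (y ℤ.* (y ℤ.* a))
  entry y m a a′ l₁ l₂ l₃ 4  = 4th m ℤ.* a′
  entry y m a a′ l₁ l₂ l₃ 5  = m ℤ.* (4th m ℤ.* a′)
  entry y m a a′ l₁ l₂ l₃ 6  = m ℤ.* (m ℤ.* (4th m ℤ.* a′))
  entry y m a a′ l₁ l₂ l₃ 7  = m ℤ.* (m ℤ.* (m ℤ.* (4th m ℤ.* a′)))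
  entry y m a a′ l₁ l₂ l₃ 8  = ℤ.- l₁
  entry y m a a′ l₁ l₂ l₃ 9  = ℤ.- l₂
  entry y m a a′ l₁ l₂ l₃ _  = ℤ.- l₃

  matrix : ℕ → ℕ → ℤ
  matrix m = entry (+ m ℤ.* (+ m ℤ.+ + 1)) (+ m) (A m) (shift A m) (L (shift β₁) m) (L (shift ϑβ₁) m) (L (shift β₂) m)

  -- A left inverse up to Δ, which has no prime factor above 7.
  left-inverse : ℕ → ℕ → ℤ
  left-inverse j = at (+ 0) (at [] rows j)
    where
    rows : List (List ℤ)
    rows =
      (+ 30025743234961442452109482904072416388655 ∷ -[1+ 57956847547847784600430208123977948326368 ] ∷
       + 28278325525662360317437508556761137206390 ∷ -[1+ 6492662049357930565698484079324447168273 ] ∷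
       + 865842179931167584106455436093834395350 ∷ -[1+ 73852831376099074281644380632593038169 ] ∷
       + 4219490840209567321089511299168161136 ∷ -[1+ 164062249955946829780099890319217519 ] ∷
       + 4299190460683304512696213550888521 ∷ -[1+ 72841356021972652844664176142614 ] ∷ + 721996622913512155343142302478 ∷
       -[1+ 3184363961814145317750840153 ] ∷ []) ∷
      (+ 11117264776303036955634508662834695891496 ∷ -[1+ 21458973213326375212187991446994216752639 ] ∷
       + 10470269789465910219379137282952237094898 ∷ -[1+ 2403958581172457101504119510942629086853 ] ∷
       + 320584795968617315368497773855781383448 ∷ -[1+ 27344584760577978216337952707546392503 ] ∷
       + 1562299275149162425874411238851589060 ∷ -[1+ 60745323047741514396085139634655211 ] ∷
       + 1591808679011169329296083385341056 ∷ -[1+ 26970078150082654510461513403031 ] ∷ + 267324860594294035923968810094 ∷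
       -[1+ 1179035503986605894856768153 ] ∷ []) ∷
      (+ 23249224494929762919963725797001566424646 ∷ -[1+ 44876549736473592682394851232675305714409 ] ∷
       + 21896181997630113773416454714080995418908 ∷ -[1+ 5027331259513020819727173581299551880835 ] ∷
       + 670430006040945707865084002941202306364 ∷ -[1+ 57184964342526286180992748349446714883 ] ∷
       + 3267192722946696900269161218366228000 ∷ -[1+ 127034992956569409972332403410604671 ] ∷
       + 3328904912851693795557194425370474 ∷ -[1+ 56401769155810903892809727001605 ] ∷ + 559048994702393740505218707660 ∷
       -[1+ 2465683931366506347157816371 ] ∷ []) ∷
      (+ 6580001987682639895768230481061586370626 ∷ -[1+ 12700973597236847050231842810406383061709 ] ∷
       + 6197063523494625232805655901090683136890 ∷ -[1+ 1422836692361453427816945574098037113893 ] ∷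
       + 189745286915422087305998285095898678892 ∷ -[1+ 16184504524933428413205239586616943603 ] ∷
       + 924681793830150253700589500676716460 ∷ -[1+ 35953479065152024291588606662609299 ] ∷ + 942147594993870095960330199468486 ∷
       -[1+ 15962844405196765321557233647337 ] ∷ + 158222202084889175961524022846 ∷ -[1+ 697838552547288814577711265 ] ∷ []) ∷
      (-[1+ 20971485271178865940725363146148770473610 ] ∷ + 40479969644795025734996126325227922142029 ∷
       -[1+ 19751001086444583438595353883584160039094 ] ∷ + 4534800869818557974242555489853244335529 ∷
       -[1+ 604747612124020084892676897909541196753 ] ∷ + 51582522148371627126571846488312549534 ∷
       -[1+ 2947104067162409807779590952525696385 ] ∷ + 114589305303237159681098890474204830 ∷
       -[1+ 3002770280111881579826736199148320 ] ∷ + 50876057021922279659111848860231 ∷ -[1+ 504278659308632618644738495004 ] ∷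
       + 2224119529720739844380029795 ∷ []) ∷
      (-[1+ 12487926956580154339257001404328211181752 ] ∷ + 24104678213874834095368279467013148112543 ∷
       -[1+ 11761163107785469412148732936451519988726 ] ∷ + 2700345792997186015444227938694577683609 ∷
       -[1+ 360110116652052858300674184675902254829 ] ∷ + 30715934541379907179331274315145485282 ∷
       -[1+ 1754917205351362076374007008190317001 ] ∷ + 68234693734291191037200548878021398 ∷
       -[1+ 1788064862385353506166955323903090 ] ∷ + 30295254518844970708156032778005 ∷ -[1+ 300283693871835088912917825188 ] ∷
       + 1324400340305258331281721291 ∷ []) ∷
      (-[1+ 17592310841089706614886893464556769209154 ] ∷ + 33957356840519031110659135399023856030101 ∷
       -[1+ 16568485543222642500242743199944007984456 ] ∷ + 3804099970636344199095171206505390838167 ∷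
       -[1+ 507303504512080207756493875313307469577 ] ∷ + 43270934407715293359774580491069752070 ∷
       -[1+ 2472231707012824234823088249525536453 ] ∷ + 96125317396070079714158271240080058 ∷
       -[1+ 2518928319526924502080678706375952 ] ∷ + 42678303321162403094179693686327 ∷ -[1+ 423023300942706789586475376938 ] ∷
       + 1865743012887997065021544181 ∷ []) ∷
      (-[1+ 26205002915944074144626121125285575368800 ] ∷ + 50581907235583794634256497611427191569847 ∷
       -[1+ 24679942043704401026248709800652218891790 ] ∷ + 5666478481623586835369013881282416853505 ∷
       -[1+ 755664786456459446155517548134739277597 ] ∷ + 64455145919850449419341253494740114994 ∷
       -[1+ 3682565620648591207672269127145109977 ] ∷ + 143185522664629990362751265575308294 ∷
       -[1+ 3752123558667659901062088286126634 ] ∷ + 63572379608393231095843783589277 ∷ -[1+ 630123406461437296084190390636 ] ∷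
       + 2779157413415950032131998083 ∷ []) ∷
      (+ 30025743234961442452109482904072181242415 ∷ -[1+ 57956847547847784600430208123977948326368 ] ∷
       + 28278325525662360317437508556761137206390 ∷ -[1+ 6492662049357930565698484079324447168273 ] ∷
       + 865842179931167584106455436093834395350 ∷ -[1+ 73852831376099074281644380632593038169 ] ∷
       + 4219490840209567321089511299168161136 ∷ -[1+ 164062249955946829780099890319217519 ] ∷
       + 4299190460683304512696213550888521 ∷ -[1+ 72841356021972652844664176142614 ] ∷ + 721996622913512155343142302478 ∷
       -[1+ 3184363961814145317750840153 ] ∷ []) ∷
      (-[1+ 22414407516661163289843391595124586503317 ] ∷ + 43265153809943072704942363644767113130478 ∷
       -[1+ 21109949128019031985429242388524527587190 ] ∷ + 4846813346249410597949099151439502742981 ∷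
       -[1+ 646356671814001544476592039571315671495 ] ∷ + 55131606427502650754986801475253769152 ∷
       -[1+ 3149876639694701124080201006410516181 ] ∷ + 122473508809968996773134708040351874 ∷
       -[1+ 3209372911218847822917722200973653 ] ∷ + 54376533668669146182855203484294 ∷ -[1+ 538975052340861193391019532592 ] ∷
       + 2377147868178776069891765331 ∷ []) ∷
      (-[1+ 10515150783074258161339185824060880204605 ] ∷ + 20296749562810601448721727999373867742374 ∷
       -[1+ 9903197215413715108515292972209706647416 ] ∷ + 2273759550206525702806459991923219563555 ∷
       -[1+ 303221838842639095357781905469642199071 ] ∷ + 25863594835927682929924226866627026504 ∷
       -[1+ 1477684734243057854881930907949342905 ] ∷ + 57455340325713483399527854095728958 ∷
       -[1+ 1505595901006760948098115155233429 ] ∷ + 25509371602258695920304784948038 ∷ -[1+ 252846475619165014262460561806 ] ∷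
       + 1115178630038879562299594805 ∷ []) ∷ []

  ∑ℤ : ℕ → (ℕ → ℤ) → ℤ
  ∑ℤ zero    g = + 0
  ∑ℤ (suc n) g = g 0 ℤ.+ ∑ℤ n (λ i → g (suc i))

  -- Grouped into factors below 11, so that for p ≥ 11 each is a unit merely by being smaller than
  -- p.
  Δ : ℤ
  Δ = (+ 8 ℤ.* + 8) ℤ.* (+ 8 ℤ.* + 2) ℤ.* ((+ 9 ℤ.* + 9) ℤ.* (+ 9 ℤ.* + 9)) ℤ.* (+ 5 ℤ.* + 7)

  diagonal : ℤ → ℕ → ℕ → ℤ
  diagonal d zero    zero    = d
  diagonal d zero    (suc _) = + 0
  diagonal d (suc _) zero    = + 0
  diagonal d (suc j) (suc k) = diagonal d j k

  -- Decided by evaluating 121 integer sums. With twelve rows for eleven unknowns the left inverse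
  -- is not unique over ℚ; the one tabulated has a Δ free of large primes. The equation m = 0 says
  -- that unknowns 0 and 8 agree, which is why rows 0 and 8 of the table differ only by Δ in their
  -- first entry.
  certificate : ∀ {j} → j ℕ.< 11 → ∀ {k} → k ℕ.< 11 →
    ∑ℤ 12 (λ m → left-inverse j m ℤ.* matrix m k) ≡ diagonal Δ j k
  certificate = from-yes (ℕP.allUpTo? (λ j → ℕP.allUpTo? (λ k →
    ∑ℤ 12 (λ m → left-inverse j m ℤ.* matrix m k) ℤ.≟ diagonal Δ j k) 11) 11)

-- Linear systems known modulo p².

module Elimination (𝔾 : Ground) (p : ℕ) (p-prime : Prime p) where
  open Scalars 𝔾
  open Localisation 𝔾 p p-prime
  open Tables using (∑ℤ; Δ; diagonal)
  open Scalars.Solver 𝔾 using (solve; _:=_; _:+_; _:*_; _:-_; :-_)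

  ∑ : ℕ → (ℕ → K) → K
  ∑ zero    g = 0#
  ∑ (suc n) g = g 0 + ∑ n (λ i → g (suc i))

  ∑-cong : ∀ n {g h : ℕ → K} → (∀ {i} → i ℕ.< n → g i ≡ h i) → ∑ n g ≡ ∑ n h
  ∑-cong zero    e = refl
  ∑-cong (suc n) e = cong₂ _+_ (e (ℕ.s≤s ℕ.z≤n)) (∑-cong n (λ lt → e (ℕ.s≤s lt)))

  ∑-+ : ∀ n g h → ∑ n (λ i → g i + h i) ≡ ∑ n g + ∑ n h
  ∑-+ zero    g h = sym (+-identityˡ 0#)
  ∑-+ (suc n) g h = trans (+-congˡ (∑-+ n _ _))
    (solve 4 (λ a b x y → (a :+ b) :+ (x :+ y) := (a :+ x) :+ (b :+ y)) refl _ _ _ _)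

  ∑-*ˡ : ∀ n x g → ∑ n (λ i → x * g i) ≡ x * ∑ n g
  ∑-*ˡ zero    x g = sym (zeroʳ x)
  ∑-*ˡ (suc n) x g = trans (+-congˡ (∑-*ˡ n x _)) (sym (distribˡ x _ _))

  ∑-zero : ∀ n → ∑ n (λ _ → 0#) ≡ 0#
  ∑-zero zero    = refl
  ∑-zero (suc n) = trans (+-identityˡ _) (∑-zero n)

  ∑-swap : ∀ m n (g : ℕ → ℕ → K) → ∑ m (λ i → ∑ n (g i)) ≡ ∑ n (λ j → ∑ m (λ i → g i j))
  ∑-swap zero    n g = sym (∑-zero n)
  ∑-swap (suc m) n g = trans (+-congˡ (∑-swap m n (λ i → g (suc i)))) (sym (∑-+ n (g 0) _))

  ι-∑ : ∀ n g → ι (∑ℤ n g) ≡ ∑ n (λ i → ι (g i))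
  ι-∑ zero    g = ι-0
  ι-∑ (suc n) g = trans (ι-+ _ _) (+-congˡ (ι-∑ n _))

  ∑-null : ∀ {t} n g → (∀ {i} → i ℕ.< n → g i ≈[ t ] 0#) → ∑ n g ≈[ t ] 0#
  ∑-null zero    g e = ≈-refl
  ∑-null (suc n) g e = ≈-trans (≈-+ (e (ℕ.s≤s ℕ.z≤n)) (∑-null n _ (λ lt → e (ℕ.s≤s lt)))) (≡⇒≈ (+-identityˡ 0#))

  loc-∑ : ∀ n g → (∀ i → Loc (g i)) → Loc (∑ n g)
  loc-∑ zero    g l = loc-0
  loc-∑ (suc n) g l = loc-+ (l 0) (loc-∑ n _ (λ i → l (suc i)))

  ∑-diagonal : ∀ n d j (v : ℕ → K) → j ℕ.< n → ∑ n (λ k → ι (diagonal d j k) * v k) ≡ ι d * v j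
  ∑-diagonal (suc n) d zero    v lt = trans (+-congˡ (trans
      (∑-cong n (λ _ → trans (*-congʳ ι-0) (zeroˡ _))) (∑-zero n))) (+-identityʳ _)
  ∑-diagonal (suc n) d (suc j) v lt = trans (+-cong₂ (trans (*-congʳ ι-0) (zeroˡ _)) (∑-diagonal n d j (λ k → v (suc k)) (ℕ.s≤s⁻¹ lt))) (+-identityˡ _)
    where
    +-cong₂ : ∀ {a b c d} → a ≡ c → b ≡ d → a + b ≡ c + d
    +-cong₂ refl refl = refl

  -- M, with left inverse W up to a unit, stays injective on small vectors when perturbed by a multiple of p².
  module Perturbed (rows cols : ℕ) (W M : ℕ → ℕ → ℤ) (Δ : ℤ) (unit-Δ : Unit Δ)
    (inverse : ∀ {j} → j ℕ.< cols → ∀ {k} → k ℕ.< cols → ∑ℤ rows (λ m → W j m ℤ.* M m k) ≡ diagonal Δ j k)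
    (v : ℕ → K) (R : ℕ → ℕ → K) (loc-R : ∀ m k → Loc (R m k))
    (row : ∀ {m} → m ℕ.< rows → ∑ cols (λ k → (ι (M m k) + π 2 * R m k) * v k) ≈[ 8 ] 0#) where

    private
      w : ℕ → ℕ → K
      w j m = ι (W j m)

      combined : ∀ {j} → j ℕ.< cols → ι Δ * v j + π 2 * ∑ cols (λ k → ∑ rows (λ m → w j m * R m k) * v k) ≈[ 8 ] 0#
      combined {j} lt = ≈-trans (≡⇒≈ (sym exact)) (∑-null rows _ (λ m<rows → ≈-trans (≈-*ˡ (loc-ι _) (row m<rows)) (≡⇒≈ (zeroʳ _))))
        where
        split : ∀ m k → w j m * ((ι (M m k) + π 2 * R m k) * v k)
          ≡ ι (W j m ℤ.* M m k) * v k + π 2 * (w j m * R m k * v k)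
        split m k = trans (solve 5 (λ w r P s v → w :* ((r :+ P :* s) :* v) := w :* r :* v :+ P :* (w :* s :* v)) refl (w j m) (ι (M m k)) (π 2) (R m k) (v k))
          (+-congʳ (*-congʳ (sym (ι-* _ _))))
        column : ∀ (g : ℕ → K) y → ∑ rows (λ m → g m * y) ≡ ∑ rows g * y
        column g y = trans (∑-cong rows (λ _ → *-comm _ _)) (trans (∑-*ˡ rows y g) (*-comm _ _))
        exact : ∑ rows (λ m → w j m * ∑ cols (λ k → (ι (M m k) + π 2 * R m k) * v k))
          ≡ ι Δ * v j + π 2 * ∑ cols (λ k → ∑ rows (λ m → w j m * R m k) * v k)
        exact = trans (∑-cong rows (λ {m} _ → trans (sym (∑-*ˡ cols (w j m) _)) (trans (∑-cong cols (λ {k} _ → split m k)) (∑-+ cols _ _))))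
          (trans (∑-+ rows _ _) (cong₂ _+_
            (trans (∑-swap rows cols (λ m k → ι (W j m ℤ.* M m k) * v k))
              (trans (∑-cong cols (λ {k} k<cols → trans (column (λ m → ι (W j m ℤ.* M m k)) (v k))
                (*-congʳ (trans (sym (ι-∑ rows _)) (cong ι (inverse lt k<cols))))))
                (∑-diagonal cols Δ j v lt)))
            (trans (∑-cong rows (λ {m} _ → ∑-*ˡ cols (π 2) (λ k → w j m * R m k * v k)))
              (trans (∑-*ˡ rows (π 2) _) (*-congˡ (trans (∑-swap rows cols (λ m k → w j m * R m k * v k))
                (∑-cong cols (λ {k} _ → column (λ m → w j m * R m k) (v k)))))))))

      improve : ∀ t s → s ℕ.+ (2 ℕ.+ t) ≡ 8 → (∀ {k} → k ℕ.< cols → v k ≈[ t ] 0#) → ∀ {j} → j ℕ.< cols → v j ≈[ 2 ℕ.+ t ] 0#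
      improve t s total small {j} lt = unit-cancel unit-Δ (≈-trans (≡⇒≈ (solve 2 (λ x y → x := x :+ y :+ :- y) refl (ι Δ * v j) rest))
          (≈-trans (≈-+ (≈-weaken s (subst (ι Δ * v j + rest ≈[_] 0#) (sym total) (combined lt)))
              (≈-neg (≈-π 2 (∑-null cols _ (λ {k} k<cols → ≈-trans (≈-*ˡ (loc-∑ rows _ (λ m → loc-* (loc-ι _) (loc-R m k))) (small k<cols)) (≡⇒≈ (zeroʳ _)))))))
            (≡⇒≈ (trans (+-identityˡ _) (trans (cong -_ (zeroʳ _)) (trans zero-neg (sym (zeroʳ _))))))))
        where
        rest = π 2 * ∑ cols (λ k → ∑ rows (λ m → w j m * R m k) * v k)
        zero-neg : - 0# ≡ 0#
        zero-neg = trans (sym (+-identityˡ _)) (-‿inverseʳ 0#)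

    unknowns-vanish : (∀ k → Loc (v k)) → ∀ {j} → j ℕ.< cols → v j ≈[ 8 ] 0#
    unknowns-vanish lv = improve 6 0 refl (improve 4 2 refl (improve 2 4 refl (improve 0 6 refl
      (λ {k} _ → ≈-trans (≡⇒≈ (sym (*-identityˡ (v k)))) (π-null 0 (lv k))))))

  unit-Δ : 11 ℕ.≤ p → Unit Δ
  unit-Δ 11≤p = unit-* (unit-* (unit-* (unit-* u8 u8) (unit-* u8 u2)) (unit-* (unit-* u9 u9) (unit-* u9 u9))) (unit-* u5 u7)
    where
    small : ∀ n → suc (suc n) ℕ.≤ 11 → Unit (+ suc n)
    small n le = unit-small n (ℕP.≤-trans le 11≤p)
    u2 = small 1 (from-yes (3 ℕ.≤? 11))
    u5 = small 4 (from-yes (6 ℕ.≤? 11))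
    u7 = small 6 (from-yes (8 ℕ.≤? 11))
    u8 = small 7 (from-yes (9 ℕ.≤? 11))
    u9 = small 8 (from-yes (10 ℕ.≤? 11))

-- Identification of the tabulated values.

module Values (𝔾 : Ground) where
  open Scalars 𝔾
  open Series 𝔾
  open Hypergeometric 𝔾
  open Scalars.Solver 𝔾 using (solve; _:=_; _:+_; _:-_; :-_)
  module T = Tables

  F : S
  F = Cube.cube (hyp 1)

  L : S → S
  L u m = 4th (n̂ (suc m)) * u (suc m) + - (P (n̂ m) * u m) + ι (+ 729) * (4th (n̂ m) * shift u m)

  L-F : ∀ m → L F m ≡ 0#
  L-F m = trans (solve 3 (λ a b c → a :+ :- b :+ c := a :+ c :+ :- b) refl _ _ _)
    (trans (+-congʳ (cube-recurrent m)) (-‿inverseʳ _))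

  ι-4th : ∀ i → ι (T.4th i) ≡ 4th (ι i)
  ι-4th i = trans (ι-* _ _) (cong₂ _*_ (ι-* i i) (ι-* i i))

  ι-P : ∀ i → ι (T.P i) ≡ P (ι i)
  ι-P i = trans (ι-+ _ _) (+-congʳ (trans (ι-+ _ _) (cong₂ _+_
      (trans (ι-* _ _) (*-congˡ (trans (ι-* _ _) (cong₂ _*_ y y)))) (trans (ι-* _ _) (*-congˡ y)))))
    where
    y : ι (i ℤ.* (i ℤ.+ + 1)) ≡ ι i * (ι i + 1#)
    y = trans (ι-* _ _) (*-congˡ (trans (ι-+ _ _) (+-congˡ ι-1)))

  ι-L : ∀ {u v m} → u (suc m) ≡ ι (v (suc m)) → u m ≡ ι (v m) → shift u m ≡ ι (T.shift v m) → L u m ≡ ι (T.L v m)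
  ι-L {u} {v} {m} e₁ e₀ e = sym (trans (ι-+ _ _) (cong₂ _+_
    (trans (ι-+ _ _) (cong₂ _+_ (trans (ι-* _ _) (cong₂ _*_ (ι-4th _) (sym e₁)))
      (trans (ι-neg _) (cong -_ (trans (ι-* _ _) (cong₂ _*_ (ι-P _) (sym e₀)))))))
    (trans (ι-* _ _) (*-congˡ (trans (ι-* _ _) (cong₂ _*_ (ι-4th _) (sym e)))))))

  ι-shift : ∀ {u v} n → (∀ {k} → k ℕ.< n → u k ≡ ι (v k)) → shift u n ≡ ι (T.shift v n)
  ι-shift zero    e = sym ι-0
  ι-shift (suc n) e = e (ℕP.n<1+n n)

  -- F and the table both annihilate `L` in this range, and (n + 1)⁴ can be cancelled; the pair
  -- carries the two preceding values.
  value : ∀ {n} → n ℕ.≤ 21 → F n ≡ ι (T.A n)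
  value {n} le = proj₁ (pair n le)
    where
    pair : ∀ n → n ℕ.≤ 21 → F n ≡ ι (T.A n) × shift F n ≡ ι (T.shift T.A n)
    pair zero    _  = trans (*-identityˡ _) (trans (*-identityˡ _) (sym ι-1)) , sym ι-0
    pair (suc n) le = 4th-inv n _ _ (trans (isolate F) (trans
        (cong₂ _+_ (trans (L-F n) (sym (trans (ι-L {λ k → ι (T.A k)} {T.A} {n} refl refl (ι-shift {v = T.A} n (λ _ → refl)))
            (trans (cong ι (T.recurrent le)) ι-0))))
          (cong₂ (λ a b → P (n̂ n) * a + - (ι (+ 729) * (4th (n̂ n) * b))) (proj₁ IH)
             (trans (proj₂ IH) (sym (ι-shift {λ k → ι (T.A k)} {T.A} n (λ _ → refl))))))
        (sym (isolate (λ k → ι (T.A k)))))) , proj₁ IH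
      where
      IH = pair n (ℕP.<⇒≤ le)
      isolate : ∀ u → 4th (n̂ (suc n)) * u (suc n) ≡ L u n + (P (n̂ n) * u n + - (ι (+ 729) * (4th (n̂ n) * shift u n)))
      isolate u = solve 3 (λ a b c → a := a :+ :- b :+ c :+ (b :+ :- c)) refl _ _ _

  value-β : ∀ n → n ℕ.≤ 21 → β₁ n ≡ ι (T.β₁ n) × β₂ n ≡ ι (T.β₂ n)
  value-β zero le =
    trans (β₁-step 0) (trans (cong₂ (λ a b → ι (+ 27) * 0# + (ι (+ 2) * a + 1#) * b) ι-0 (value le))
      (trans (cong₂ _+_ (zeroʳ _) (trans (*-congʳ (trans (+-congʳ (zeroʳ _)) (+-identityˡ 1#))) (*-identityˡ _))) (+-identityˡ _))) ,
    trans (β₂-step 0) (trans (cong₂ _+_ (cong₂ _+_ (zeroʳ _) (zeroʳ _)) (trans (*-congʳ ι-0) (zeroˡ _)))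
      (trans (+-congʳ (+-identityˡ 0#)) (trans (+-identityˡ 0#) (sym ι-0))))
  value-β (suc n) le =
    trans (β₁-step (suc n)) (trans (cong₂ (λ a b → ι (+ 27) * a + (ι (+ 2) * n̂ (suc n) + 1#) * b) (proj₁ IH) (value le))
      (sym (trans (ι-+ _ _) (cong₂ _+_ (ι-* _ _) (trans (ι-* _ _) (*-congʳ (trans (ι-+ _ _) (cong₂ _+_ (ι-* _ _) ι-1)))))))) ,
    trans (β₂-step (suc n)) (trans
      (cong₂ _+_ (cong₂ (λ a b → ι (+ 27) * a + ι (+ 135) * b) (proj₂ IH) (proj₁ IH)) (*-congˡ (value le)))
      (sym (trans (ι-+ _ _) (cong₂ _+_ (trans (ι-+ _ _) (cong₂ _+_ (ι-* _ _) (ι-* _ _))) (ι-* _ _)))))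
    where IH = value-β n (ℕP.<⇒≤ le)

-- Vanishing of the error constants.

module Rigidity (𝔾 : Ground) (p : ℕ) (p-prime : Prime p) (5≤p : 5 ℕ.≤ p) where
  open Scalars 𝔾
  open Series 𝔾
  open Hypergeometric 𝔾
  open Values 𝔾
  open Localisation 𝔾 p p-prime
  open Representable 𝔾 p p-prime using (eval; eval₄)
  open Elimination 𝔾 p p-prime
  open Scalars.Solver 𝔾 using (solve; _:=_; _:+_; _:*_; _:-_; :-_; con)

  entry : (y m a a′ l₁ l₂ l₃ : K) → ℕ → K
  entry y m a a′ l₁ l₂ l₃ 0  = a
  entry y m a a′ l₁ l₂ l₃ 1  = y * a
  entry y m a a′ l₁ l₂ l₃ 2  = y * (y * a)
  entry y m a a′ l₁ l₂ l₃ 3  = y * (y * (y * a))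
  entry y m a a′ l₁ l₂ l₃ 4  = 4th m * a′
  entry y m a a′ l₁ l₂ l₃ 5  = m * (4th m * a′)
  entry y m a a′ l₁ l₂ l₃ 6  = m * (m * (4th m * a′))
  entry y m a a′ l₁ l₂ l₃ 7  = m * (m * (m * (4th m * a′)))
  entry y m a a′ l₁ l₂ l₃ 8  = - l₁
  entry y m a a′ l₁ l₂ l₃ 9  = - l₂
  entry y m a a′ l₁ l₂ l₃ _  = - l₃

  ι-entry : ∀ y m a a′ l₁ l₂ l₃ k → ι (T.entry y m a a′ l₁ l₂ l₃ k) ≡ entry (ι y) (ι m) (ι a) (ι a′) (ι l₁) (ι l₂) (ι l₃) k
  ι-entry y m a a′ l₁ l₂ l₃ 0 = refl
  ι-entry y m a a′ l₁ l₂ l₃ 1 = ι-* _ _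
  ι-entry y m a a′ l₁ l₂ l₃ 2 = trans (ι-* _ _) (*-congˡ (ι-* _ _))
  ι-entry y m a a′ l₁ l₂ l₃ 3 = trans (ι-* _ _) (*-congˡ (trans (ι-* _ _) (*-congˡ (ι-* _ _))))
  ι-entry y m a a′ l₁ l₂ l₃ 4 = trans (ι-* _ _) (*-congʳ (ι-4th m))
  ι-entry y m a a′ l₁ l₂ l₃ 5 = trans (ι-* _ _) (*-congˡ (trans (ι-* _ _) (*-congʳ (ι-4th m))))
  ι-entry y m a a′ l₁ l₂ l₃ 6 = trans (ι-* _ _) (*-congˡ (trans (ι-* _ _) (*-congˡ (trans (ι-* _ _) (*-congʳ (ι-4th m))))))
  ι-entry y m a a′ l₁ l₂ l₃ 7 = trans (ι-* _ _) (*-congˡ (trans (ι-* _ _) (*-congˡ (trans (ι-* _ _) (*-congˡ (trans (ι-* _ _) (*-congʳ (ι-4th m))))))))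
  ι-entry y m a a′ l₁ l₂ l₃ 8 = ι-neg _
  ι-entry y m a a′ l₁ l₂ l₃ 9 = ι-neg _
  ι-entry y m a a′ l₁ l₂ l₃ (suc (suc (suc (suc (suc (suc (suc (suc (suc (suc _)))))))))) = ι-neg _

  -- Entries are linear in a and a′, except that the last three columns do not involve them.
  -- Replacing F by F + p² e therefore perturbs the matrix by p² times an integral matrix with three
  -- zero columns.
  entry-+ : ∀ y m a a′ l₁ l₂ l₃ c e e′ k →
    entry y m (a + c * e) (a′ + c * e′) l₁ l₂ l₃ k ≡ entry y m a a′ l₁ l₂ l₃ k + c * entry y m e e′ 0# 0# 0# k
  entry-+ y m a a′ l₁ l₂ l₃ c e e′ = go
    where
    one : ∀ y a e → y * (a + c * e) ≡ y * a + c * (y * e)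
    one y a e = solve 4 (λ y a c e → y :* (a :+ c :* e) := y :* a :+ c :* (y :* e)) refl y a c e
    two : ∀ y a e → y * (y * (a + c * e)) ≡ y * (y * a) + c * (y * (y * e))
    two y a e = trans (*-congˡ (one y a e)) (one y _ _)
    flat : ∀ l → - l ≡ - l + c * - 0#
    flat l = sym (trans (+-congˡ (trans (*-congˡ -0#≡0#) (zeroʳ c))) (+-identityʳ _))
    go : ∀ k → entry y m (a + c * e) (a′ + c * e′) l₁ l₂ l₃ k ≡ entry y m a a′ l₁ l₂ l₃ k + c * entry y m e e′ 0# 0# 0# k
    go 0 = refl
    go 1 = one y a e
    go 2 = two y a e
    go 3 = trans (*-congˡ (two y a e)) (one y _ _)
    go 4 = one (4th m) a′ e′
    go 5 = trans (*-congˡ (one (4th m) a′ e′)) (one m _ _)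
    go 6 = trans (*-congˡ (*-congˡ (one (4th m) a′ e′))) (two m _ _)
    go 7 = trans (*-congˡ (trans (*-congˡ (*-congˡ (one (4th m) a′ e′))) (two m _ _))) (one m _ _)
    go 8 = flat l₁
    go 9 = flat l₂
    go (suc (suc (suc (suc (suc (suc (suc (suc (suc (suc _)))))))))) = flat l₃

  loc-entry : ∀ {y m a a′ l₁ l₂ l₃} → Loc y → Loc m → Loc a → Loc a′ → Loc l₁ → Loc l₂ → Loc l₃ → ∀ k → Loc (entry y m a a′ l₁ l₂ l₃ k)
  loc-entry {y} {m} {a} {a′} ly lm la la′ l₁ l₂ l₃ = go
    where
    l4 : Loc (4th m * a′)
    l4 = loc-* (loc-* (loc-* lm lm) (loc-* lm lm)) la′
    go : ∀ k → Loc (entry y m a a′ _ _ _ k)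
    go 0 = la
    go 1 = loc-* ly la
    go 2 = loc-* ly (loc-* ly la)
    go 3 = loc-* ly (loc-* ly (loc-* ly la))
    go 4 = l4
    go 5 = loc-* lm l4
    go 6 = loc-* lm (loc-* lm l4)
    go 7 = loc-* lm (loc-* lm (loc-* lm l4))
    go 8 = loc-neg l₁
    go 9 = loc-neg l₂
    go (suc (suc (suc (suc (suc (suc (suc (suc (suc (suc _)))))))))) = loc-neg l₃

  L-≈ : ∀ {k u v} m → (∀ n → u n ≈[ k ] v n) → L u m ≈[ k ] L v m
  L-≈ {k} {u} {v} m e = ≈-+ (≈-+ (≈-*ˡ (l4 (suc m)) (e (suc m))) (≈-neg (≈-*ˡ lP (e m)))) (≈-*ˡ (loc-ι (+ 729)) (≈-*ˡ (l4 m) (back m)))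
    where
    l4 : ∀ m → Loc (4th (n̂ m))
    l4 m = loc-* (loc-* l l) (loc-* l l)
      where l = loc-ι (+ m)
    ly : Loc (n̂ m * (n̂ m + 1#))
    ly = loc-* (loc-ι (+ m)) (loc-+ (loc-ι (+ m)) loc-1)
    lP : Loc (P (n̂ m))
    lP = loc-+ (loc-+ (loc-* (loc-ι (+ 54)) (loc-* ly ly)) (loc-* (loc-ι (+ 48)) ly)) (loc-ι (+ 9))
    back : ∀ m → shift u m ≈[ k ] shift v m
    back zero    = ≈-refl
    back (suc m) = e m

  L-linear : ∀ c d u v m → L (λ n → c * u n + d * v n) m ≡ c * L u m + d * L v m
  L-linear c d u v m = trans (cong (λ z → 4th (n̂ (suc m)) * (c * u (suc m) + d * v (suc m)) + - (P (n̂ m) * (c * u m + d * v m)) + ι (+ 729) * (4th (n̂ m) * z)) (back m))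
    (solve 12 (λ c d q P s f u₁ u₀ u′ v₁ v₀ v′ → q :* (c :* u₁ :+ d :* v₁) :+ :- (P :* (c :* u₀ :+ d :* v₀)) :+ s :* (f :* (c :* u′ :+ d :* v′))
      := c :* (q :* u₁ :+ :- (P :* u₀) :+ s :* (f :* u′)) :+ d :* (q :* v₁ :+ :- (P :* v₀) :+ s :* (f :* v′)))
      refl c d _ _ _ _ (u (suc m)) (u m) (shift u m) (v (suc m)) (v m) (shift v m))
    where
    back : ∀ m → shift (λ n → c * u n + d * v n) m ≡ c * shift u m + d * shift v m
    back zero    = sym (trans (cong₂ _+_ (zeroʳ c) (zeroʳ d)) (+-identityˡ 0#))
    back (suc m) = refl

  module _ (F-integral : ∀ n → Loc (F n)) (β₁-integral : ∀ n → Loc (β₁ n)) (β₂-integral : ∀ n → Loc (β₂ n))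
    (a E : S) {c₀ c₁ c₂ : K} (lc₀ : Loc c₀) (lc₁ : Loc c₁) (lc₂ : Loc c₂)
    (E-shape : ∀ n → E n ≈[ 2 ] c₀ * β₁ n + ϖ * c₁ * ϑ β₁ n + c₂ * β₂ n)
    (a-lifts : ∀ m → a m ≈[ 4 ] F m + π 2 * shift E m) where

    private
      shift-zero : ∀ {k} n → (∀ n → E n ≈[ k ] 0#) → shift E n ≈[ k ] 0#
      shift-zero zero    e = ≈-refl
      shift-zero (suc n) e = e n

    conclude : c₀ ≈[ 2 ] 0# → ϖ * c₁ ≈[ 2 ] 0# → c₂ ≈[ 2 ] 0# → ∀ m → a m ≈[ 4 ] F m
    conclude e₀ e₁ e₂ m = ≈-trans (a-lifts m) (≈-trans (≈-+ ≈-refl (≈-π 2 (shift-zero m (λ n → ≈-trans (E-shape n) (≈-trans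
      (≈-+ (≈-+ (≈-*ʳ (β₁-integral n) e₀) (≈-*ʳ (loc-* (loc-ι (+ n)) (β₁-integral n)) e₁)) (≈-*ʳ (β₂-integral n) e₂))
      (≡⇒≈ (trans (cong₂ _+_ (cong₂ _+_ (zeroˡ _) (zeroˡ _)) (zeroˡ _)) (trans (+-congʳ (+-identityˡ 0#)) (+-identityˡ 0#)))))))))
      (≡⇒≈ (trans (+-congˡ (zeroʳ _)) (+-identityʳ _))))

    private
      shape-integral : ∀ n → Loc (E n)
      shape-integral n = ≈-loc (E-shape n) (loc-+ (loc-+ (loc-* lc₀ (β₁-integral n))
        (loc-* (loc-* (loc-ι (+ p)) lc₁) (loc-* (loc-ι (+ n)) (β₁-integral n)))) (loc-* lc₂ (β₂-integral n)))

      loc-shift : ∀ {u} → (∀ n → Loc (u n)) → ∀ n → Loc (shift u n)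
      loc-shift l zero    = loc-0
      loc-shift l (suc n) = l n

    module Large (11≤p : 11 ℕ.≤ p) (η s : S) (lη : ∀ i → Loc (η i)) (ls : ∀ i → Loc (s i))
      (stride : ∀ m → eval 4 η (n̂ m * (n̂ m + ι (+ 1))) * a m + - (π 4 * (4th (n̂ m) * (eval 4 s (n̂ m) * shift a m)))
                      ≈[ 8 ] π 4 * (4th (n̂ (suc m)) * a (suc m))) where

      private
        e : S
        e m = shift E m + π 2 * _≈[_]_.quotient (a-lifts m)

        le : ∀ m → Loc (e m)
        le m = loc-+ (loc-shift shape-integral m) (loc-* (loc-π 2) (_≈[_]_.local (a-lifts m)))

        a-split : ∀ m → a m ≡ F m + π 2 * e m
        a-split m = trans (_≈[_]_.equation (a-lifts m)) (trans (+-congˡ (*-congʳ (π-+ 2 2)))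
          (solve 4 (λ F P E q → F :+ P :* E :+ P :* P :* q := F :+ P :* (E :+ P :* q)) refl (F m) (π 2) (shift E m) _))

        a′-split : ∀ m → shift a m ≡ shift F m + π 2 * shift e m
        a′-split zero    = sym (trans (+-identityˡ _) (zeroʳ _))
        a′-split (suc m) = a-split m

        -- Differences between the recurrence along multiples of p and p⁴ times the recurrence of F, followed by the error terms.
        v : ℕ → K
        v 0 = η 0 + - (π 4 * ι (+ 9))
        v 1 = η 1 + - (π 4 * ι (+ 48))
        v 2 = η 2 + - (π 4 * ι (+ 54))
        v 3 = η 3
        v 4 = - (π 4 * (s 0 + - ι (+ 729)))
        v 5 = - (π 4 * s 1)
        v 6 = - (π 4 * s 2)
        v 7 = - (π 4 * s 3)
        v 8 = π 6 * c₀
        v 9 = π 6 * (ϖ * c₁)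
        v _ = π 6 * c₂

        lv : ∀ k → Loc (v k)
        lv 0 = loc-+ (lη 0) (loc-neg (loc-* (loc-π 4) (loc-ι _)))
        lv 1 = loc-+ (lη 1) (loc-neg (loc-* (loc-π 4) (loc-ι _)))
        lv 2 = loc-+ (lη 2) (loc-neg (loc-* (loc-π 4) (loc-ι _)))
        lv 3 = lη 3
        lv 4 = loc-neg (loc-* (loc-π 4) (loc-+ (ls 0) (loc-neg (loc-ι _))))
        lv 5 = loc-neg (loc-* (loc-π 4) (ls 1))
        lv 6 = loc-neg (loc-* (loc-π 4) (ls 2))
        lv 7 = loc-neg (loc-* (loc-π 4) (ls 3))
        lv 8 = loc-* (loc-π 6) lc₀
        lv 9 = loc-* (loc-π 6) (loc-* (loc-ι (+ p)) lc₁)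
        lv (suc (suc (suc (suc (suc (suc (suc (suc (suc (suc _)))))))))) = loc-* (loc-π 6) lc₂

        l₁ l₂ l₃ : S
        l₁ = L (shift β₁)
        l₂ = L (shift (ϑ β₁))
        l₃ = L (shift β₂)

        y : ℕ → K
        y m = n̂ m * (n̂ m + ι (+ 1))

        error : S
        error m = c₀ * l₁ m + ϖ * c₁ * l₂ m + c₂ * l₃ m

        L-shift-E : ∀ m → L (shift E) m ≈[ 2 ] error m
        L-shift-E m = ≈-trans (L-≈ m shapes) (≡⇒≈ (trans (L-linear 1# c₂ _ (shift β₂) m)
            (+-congʳ (trans (*-identityˡ _) (L-linear c₀ (ϖ * c₁) (shift β₁) (shift (ϑ β₁)) m)))))
          where
          shapes : ∀ n → shift E n ≈[ 2 ] 1# * (c₀ * shift β₁ n + ϖ * c₁ * shift (ϑ β₁) n) + c₂ * shift β₂ n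
          shapes zero    = ≡⇒≈ (sym (trans (cong₂ _+_ (trans (*-identityˡ _) (cong₂ _+_ (zeroʳ _) (zeroʳ _))) (zeroʳ _))
            (trans (+-congʳ (+-identityˡ 0#)) (+-identityˡ 0#))))
          shapes (suc n) = ≈-trans (E-shape n) (≡⇒≈ (+-congʳ (sym (*-identityˡ _))))

        -- `L` annihilates F, so only the error p² E is seen, and E enters through its known shape.
        L-a : ∀ m → L a m ≈[ 4 ] π 2 * error m
        L-a m = ≈-trans (L-≈ m (λ n → ≈-trans (a-lifts n) (≡⇒≈ (+-congʳ (sym (*-identityˡ (F n)))))))
          (≈-trans (≡⇒≈ (trans (L-linear 1# (π 2) F (shift E) m) (trans (+-congʳ (trans (*-congˡ (L-F m)) (zeroʳ _))) (+-identityˡ _))))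
            (≈-π 2 (L-shift-E m)))

        weighted : ∀ m → ∑ 11 (λ k → entry (y m) (n̂ m) (a m) (shift a m) (l₁ m) (l₂ m) (l₃ m) k * v k)
          ≡ eval 4 η (y m) * a m + - (π 4 * (4th (n̂ m) * (eval 4 s (n̂ m) * shift a m)))
            + (π 4 * (- (P (n̂ m) * a m) + ι (+ 729) * (4th (n̂ m) * shift a m)) + - (π 6 * error m))
        weighted m = trans (solve 12 (λ a b c d e f g h i j k z → a :+ (b :+ (c :+ (d :+ (e :+ (f :+ (g :+ (h :+ (i :+ (j :+ (k :+ z))))))))))
              := (a :+ b :+ c :+ d) :+ (e :+ f :+ g :+ h) :+ ((i :+ j :+ k) :+ z)) refl _ _ _ _ _ _ _ _ _ _ _ 0#)
          (trans (cong₂ _+_ (cong₂ _+_ first second) (trans (+-identityʳ _) third))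
            (solve 5 (λ A B C D E → (A :+ C) :+ (B :+ D) :+ E := A :+ B :+ ((C :+ D) :+ E)) refl
               (eval 4 η (y m) * a m) (- (π 4 * (4th (n̂ m) * (eval 4 s (n̂ m) * shift a m))))
               (π 4 * - (P (n̂ m) * a m)) (π 4 * (ι (+ 729) * (4th (n̂ m) * shift a m))) (- (π 6 * error m))
             ∙ +-congˡ (+-congʳ (sym (distribˡ (π 4) _ _)))))
          where
          infixl 4 _∙_
          _∙_ : ∀ {x y z : K} → x ≡ y → y ≡ z → x ≡ z
          _∙_ = trans
          A = a m
          A′ = shift a m
          Y = y m
          first : A * v 0 + Y * A * v 1 + Y * (Y * A) * v 2 + Y * (Y * (Y * A)) * v 3 ≡ eval 4 η Y * A + π 4 * - (P (n̂ m) * A)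
          first = trans (solve 7 (λ a y h₀ h₁ h₂ h₃ P → a :* (h₀ :+ :- (P :* con (+ 9))) :+ y :* a :* (h₁ :+ :- (P :* con (+ 48)))
                :+ y :* (y :* a) :* (h₂ :+ :- (P :* con (+ 54))) :+ y :* (y :* (y :* a)) :* h₃
                := (h₀ :+ y :* (h₁ :+ y :* (h₂ :+ y :* h₃))) :* a :+ P :* :- ((con (+ 54) :* (y :* y) :+ con (+ 48) :* y :+ con (+ 9)) :* a))
              refl A Y (η 0) (η 1) (η 2) (η 3) (π 4))
            (cong₂ _+_ (*-congʳ (sym (eval₄ η Y)))
              (cong (λ o → π 4 * - ((ι (+ 54) * (n̂ m * (n̂ m + o) * (n̂ m * (n̂ m + o))) + ι (+ 48) * (n̂ m * (n̂ m + o)) + ι (+ 9)) * A)) ι-1))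
          second : 4th (n̂ m) * A′ * v 4 + n̂ m * (4th (n̂ m) * A′) * v 5 + n̂ m * (n̂ m * (4th (n̂ m) * A′)) * v 6
              + n̂ m * (n̂ m * (n̂ m * (4th (n̂ m) * A′))) * v 7
            ≡ - (π 4 * (4th (n̂ m) * (eval 4 s (n̂ m) * A′))) + π 4 * (ι (+ 729) * (4th (n̂ m) * A′))
          second = trans (solve 8 (λ a f m s₀ s₁ s₂ s₃ P → f :* a :* :- (P :* (s₀ :+ :- con (+ 729))) :+ m :* (f :* a) :* :- (P :* s₁)
                :+ m :* (m :* (f :* a)) :* :- (P :* s₂) :+ m :* (m :* (m :* (f :* a))) :* :- (P :* s₃)
                := :- (P :* (f :* ((s₀ :+ m :* (s₁ :+ m :* (s₂ :+ m :* s₃))) :* a))) :+ P :* (con (+ 729) :* (f :* a)))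
              refl A′ (4th (n̂ m)) (n̂ m) (s 0) (s 1) (s 2) (s 3) (π 4))
            (+-congʳ (cong (λ z → - (π 4 * (4th (n̂ m) * (z * A′)))) (sym (eval₄ s (n̂ m)))))
          third : - l₁ m * v 8 + - l₂ m * v 9 + - l₃ m * v 10 ≡ - (π 6 * error m)
          third = solve 8 (λ x y z P a w b c → :- x :* (P :* a) :+ :- y :* (P :* (w :* b)) :+ :- z :* (P :* c)
              := :- (P :* (a :* x :+ w :* b :* y :+ c :* z))) refl (l₁ m) (l₂ m) (l₃ m) (π 6) c₀ ϖ c₁ c₂

        -- By `weighted` and `stride` the sum is p⁴ times L a - p² `error` modulo p⁸, and `L-a`
        -- makes that difference a multiple of p⁴.
        row-null : ∀ m → ∑ 11 (λ k → entry (y m) (n̂ m) (a m) (shift a m) (l₁ m) (l₂ m) (l₃ m) k * v k) ≈[ 8 ] 0#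
        row-null m = ≈-trans (≡⇒≈ (weighted m)) (≈-trans (≈-+ (stride m) ≈-refl) (≈-trans
          (≡⇒≈ (trans (+-congˡ (+-congˡ (cong (λ z → - (z * error m)) (π-+ 4 2))))
            (solve 6 (λ P Q x y z e → P :* x :+ (P :* (:- y :+ z) :+ :- (P :* Q :* e)) := P :* (x :+ :- y :+ z :+ :- (Q :* e)))
              refl (π 4) (π 2) _ _ _ (error m))))
          (≈-trans (≈-π 4 (≈-trans (≈-+ (L-a m) ≈-refl) (≡⇒≈ (-‿inverseʳ _)))) (≡⇒≈ (zeroʳ _)))))

        R : ℕ → ℕ → K
        R m = entry (y m) (n̂ m) (e m) (shift e m) 0# 0# 0#

        lR : ∀ m k → Loc (R m k)
        lR m = loc-entry (loc-* (loc-ι (+ m)) (loc-+ (loc-ι (+ m)) (loc-ι (+ 1)))) (loc-ι (+ m)) (le m) (loc-shift le m) loc-0 loc-0 loc-0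

        bounded : ∀ {m} → m ℕ.< 12 → ∀ k → ι (T.matrix m k) ≡ entry (y m) (n̂ m) (F m) (shift F m) (l₁ m) (l₂ m) (l₃ m) k
        bounded {m} lt k = trans (ι-entry _ _ _ _ _ _ _ k) (match
            (trans (ι-* _ _) (*-congˡ (ι-+ _ _))) (sym (value (up ℕP.≤-refl))) (sym (ι-shift m (λ lt′ → value (up (ℕP.<⇒≤ lt′)))))
            (sym (ι-L (β-at₁ ℕP.≤-refl) (shift-β₁ m (up ℕP.≤-refl)) (ι-shift m (λ {n} lt′ → shift-β₁ n (up (ℕP.<⇒≤ lt′))))))
            (sym (ι-L (ϑ-at ℕP.≤-refl) (shift-ϑ m (up ℕP.≤-refl)) (ι-shift m (λ {n} lt′ → shift-ϑ n (up (ℕP.<⇒≤ lt′))))))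
            (sym (ι-L (β-at₂ ℕP.≤-refl) (shift-β₂ m (up ℕP.≤-refl)) (ι-shift m (λ {n} lt′ → shift-β₂ n (up (ℕP.<⇒≤ lt′))))))
            k)
          where
          up : ∀ {n} → n ℕ.≤ m → n ℕ.≤ 21
          up le = ℕP.≤-trans le (ℕP.≤-trans (ℕP.<⇒≤ lt) (from-yes (12 ℕ.≤? 21)))
          β-at₁ : ∀ {n} → n ℕ.≤ m → β₁ n ≡ ι (T.β₁ n)
          β-at₁ {n} le = proj₁ (value-β n (up le))
          β-at₂ : ∀ {n} → n ℕ.≤ m → β₂ n ≡ ι (T.β₂ n)
          β-at₂ {n} le = proj₂ (value-β n (up le))
          ϑ-at : ∀ {n} → n ℕ.≤ m → ϑ β₁ n ≡ ι (T.ϑβ₁ n)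
          ϑ-at le = trans (*-congˡ (β-at₁ le)) (sym (ι-* _ _))
          shift-β₁ : ∀ n → n ℕ.≤ 21 → shift β₁ n ≡ ι (T.shift T.β₁ n)
          shift-β₁ n le = ι-shift n (λ {k} lt → proj₁ (value-β k (ℕP.≤-trans (ℕP.<⇒≤ lt) le)))
          shift-β₂ : ∀ n → n ℕ.≤ 21 → shift β₂ n ≡ ι (T.shift T.β₂ n)
          shift-β₂ n le = ι-shift n (λ {k} lt → proj₂ (value-β k (ℕP.≤-trans (ℕP.<⇒≤ lt) le)))
          shift-ϑ : ∀ n → n ℕ.≤ 21 → shift (ϑ β₁) n ≡ ι (T.shift T.ϑβ₁ n)
          shift-ϑ n le = ι-shift n (λ {k} lt → trans (*-congˡ (proj₁ (value-β k (ℕP.≤-trans (ℕP.<⇒≤ lt) le)))) (sym (ι-* _ _)))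
          match : ∀ {y y′ m a b a₁ b₁ x x′ z z′ w w′} → y ≡ y′ → a ≡ b → a₁ ≡ b₁ → x ≡ x′ → z ≡ z′ → w ≡ w′ → ∀ k →
            entry y m a a₁ x z w k ≡ entry y′ m b b₁ x′ z′ w′ k
          match refl refl refl refl refl refl k = refl

        rows : ∀ {m} → m ℕ.< 12 → ∑ 11 (λ k → (ι (T.matrix m k) + π 2 * R m k) * v k) ≈[ 8 ] 0#
        rows {m} lt = ≈-trans (≡⇒≈ (∑-cong 11 {λ k → (ι (T.matrix m k) + π 2 * R m k) * v k}
            {λ k → entry (y m) (n̂ m) (a m) (shift a m) (l₁ m) (l₂ m) (l₃ m) k * v k} (λ {k} _ → *-congʳ (exact k)))) (row-null m)
          where
          exact : ∀ k → ι (T.matrix m k) + π 2 * R m k ≡ entry (y m) (n̂ m) (a m) (shift a m) (l₁ m) (l₂ m) (l₃ m) k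
          exact k = trans (+-congʳ (bounded lt k)) (trans
            (sym (entry-+ (y m) (n̂ m) (F m) (shift F m) (l₁ m) (l₂ m) (l₃ m) (π 2) (e m) (shift e m) k))
            (cong₂ (λ x x′ → entry (y m) (n̂ m) x x′ (l₁ m) (l₂ m) (l₃ m) k) (sym (a-split m)) (sym (a′-split m))))

        module Solved = Perturbed 12 11 T.left-inverse T.matrix T.Δ (unit-Δ 11≤p) T.certificate v R lR rows

        vanish : ∀ {j} → j ℕ.< 11 → v j ≈[ 8 ] 0#
        vanish = Solved.unknowns-vanish lv

        small : ∀ {x} → π 6 * x ≈[ 8 ] 0# → x ≈[ 2 ] 0#
        small h = ≈-cancel 6 (≈-trans h (≡⇒≈ (sym (zeroʳ _))))

      -- The error constants stand in `v` with the factor p⁶, so their vanishing modulo p⁸ there is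
      -- vanishing modulo p², just what the factor p² of the error requires.
      supercongruence : ∀ m → a m ≈[ 4 ] F m
      supercongruence = conclude (small (vanish (from-yes (9 ℕ.≤? 11)))) (small (vanish (from-yes (10 ℕ.≤? 11)))) (small (vanish (from-yes (11 ℕ.≤? 11))))

    -- For p = 5 and 7, which divide Δ, the error is found from three values instead.
    module Small (unit-3 : Unit (+ 3)) (a₁ : a 1 ≈[ 4 ] F 1) (a₂ : a 2 ≈[ 4 ] F 2) (a₃ : a 3 ≈[ 4 ] F 3) where

      private
        open Halves 5≤p using (unit-2; unit-4)

        error-at : ∀ m → a (suc m) ≈[ 4 ] F (suc m) → c₀ * β₁ m + ϖ * c₁ * ϑ β₁ m + c₂ * β₂ m ≈[ 2 ] 0#
        error-at m h = ≈-trans (≈-sym (E-shape m)) (≈-cancel 2 (subst₂ (_≈[ 4 ]_)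
          (solve 2 (λ F x → F :+ x :+ :- F := x) refl (F (suc m)) (π 2 * E m)) (trans (-‿inverseʳ _) (sym (zeroʳ _)))
          (≈-+ (≈-trans (≈-sym (a-lifts (suc m))) h) (≈-refl {x = - F (suc m)}))))

        combination : ℕ → K
        combination m = c₀ * ι (T.β₁ m) + ϖ * c₁ * (ι (+ m) * ι (T.β₁ m)) + c₂ * ι (T.β₂ m)

        at : ∀ m → m ℕ.≤ 21 → a (suc m) ≈[ 4 ] F (suc m) → combination m ≈[ 2 ] 0#
        at m le h = subst (_≈[ 2 ] 0#) (cong₂ (λ u v → c₀ * u + ϖ * c₁ * (n̂ m * u) + c₂ * v) (proj₁ (value-β m le)) (proj₂ (value-β m le)))
          (error-at m h)

        e₀ : c₀ ≈[ 2 ] 0#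
        e₀ = subst (_≈[ 2 ] 0#) (solve 4 (λ a w b c → a :* con (+ 1) :+ w :* b :* (con (+ 0) :* con (+ 1)) :+ c :* con (+ 0) := a) refl c₀ ϖ c₁ c₂)
          (at 0 (from-yes (0 ℕ.≤? 21)) a₁)

        without-c₀ : ∀ {x y z} → Loc x → z ≡ c₀ * x + y → z ≈[ 2 ] 0# → y ≈[ 2 ] 0#
        without-c₀ {x} {y} lx e h = ≈-trans (≡⇒≈ (trans (solve 2 (λ u y → y := u :+ y :+ :- u) refl (c₀ * x) y) (+-congʳ (sym e))))
          (≈-trans (≈-+ h (≈-neg (≈-*ʳ lx e₀))) (≡⇒≈ (trans (+-identityˡ _) (trans (cong -_ (zeroˡ _)) -0#≡0#))))

        -- β₁ takes the values 1, 54, 2133 and β₂ the values 0, 144, 11448 at 0, 1, 2. The first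
        -- pair gives c₀, the others two equations for p c₁ and c₂.
        f₁ : ι (+ 54) * (ϖ * c₁) + ι (+ 144) * c₂ ≈[ 2 ] 0#
        f₁ = without-c₀ (loc-ι (+ 54)) (solve 4 (λ a w b c → a :* con (+ 54) :+ w :* b :* (con (+ 1) :* con (+ 54)) :+ c :* con (+ 144)
          := a :* con (+ 54) :+ (con (+ 54) :* (w :* b) :+ con (+ 144) :* c)) refl c₀ ϖ c₁ c₂) (at 1 (from-yes (1 ℕ.≤? 21)) a₂)

        f₂ : ι (+ 4266) * (ϖ * c₁) + ι (+ 11448) * c₂ ≈[ 2 ] 0#
        f₂ = without-c₀ (loc-ι (+ 2133)) (solve 4 (λ a w b c → a :* con (+ 2133) :+ w :* b :* (con (+ 2) :* con (+ 2133)) :+ c :* con (+ 11448)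
          := a :* con (+ 2133) :+ (con (+ 4266) :* (w :* b) :+ con (+ 11448) :* c)) refl c₀ ϖ c₁ c₂) (at 2 (from-yes (2 ℕ.≤? 21)) a₃)

        27-unit : Unit (+ 3 ℤ.* (+ 3 ℤ.* + 3))
        27-unit = unit-* unit-3 (unit-* unit-3 unit-3)

        null : ∀ {d x} → Unit d → ι d * x ≈[ 2 ] 0# → x ≈[ 2 ] 0#
        null u h = unit-cancel u (≈-trans h (≡⇒≈ (sym (zeroʳ _))))

        times : ∀ i {x} → x ≈[ 2 ] 0# → ι i * x ≈[ 2 ] 0#
        times i h = ≈-trans (≈-*ˡ (loc-ι i) h) (≡⇒≈ (zeroʳ _))

        e₂ : c₂ ≈[ 2 ] 0#
        -- 3888 = 54 · 11448 - 4266 · 144 = 2⁴ 3⁵ is the determinant of the remaining system.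
        e₂ = null (unit-* (unit-* unit-4 unit-4) (unit-* (unit-* unit-3 unit-3) 27-unit)) (≈-trans (≡⇒≈ (solve 2 (λ b c → con (+ 3888) :* c
            := con (+ 54) :* (con (+ 4266) :* b :+ con (+ 11448) :* c) :+ con (ℤ.- (+ 4266)) :* (con (+ 54) :* b :+ con (+ 144) :* c)) refl (ϖ * c₁) c₂))
          (≈-trans (≈-+ (times (+ 54) f₂) (times (ℤ.- (+ 4266)) f₁)) (≡⇒≈ (+-identityˡ 0#))))

        e₁ : ϖ * c₁ ≈[ 2 ] 0#
        e₁ = null (unit-* unit-2 27-unit) (≈-trans (≡⇒≈ (solve 2 (λ b c → con (+ 54) :* b
            := con (+ 54) :* b :+ con (+ 144) :* c :+ con (ℤ.- (+ 144)) :* c) refl (ϖ * c₁) c₂))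
          (≈-trans (≈-+ f₁ (times (ℤ.- (+ 144)) e₂)) (≡⇒≈ (+-identityˡ 0#))))

      supercongruence : ∀ m → a m ≈[ 4 ] F m
      supercongruence = conclude e₀ e₁ e₂

-- The two classes of p modulo 3.

-- For p = q + 1 not divisible by 3: the indices n₀, n₁ < p at which 3 n + c and 3 n + c′ vanish modulo p.
record Thirds (q : ℕ) : Set where
  field
    n₀ n₁ c c′  : ℕ
    size        : n₀ ℕ.+ n₁ ≡ q
    balance     : 3 ℕ.* n₀ ℕ.+ c ≡ 1 ℕ.* suc q
    balance′    : 3 ℕ.* n₁ ℕ.+ c′ ≡ 2 ℕ.* suc q
    orientation : (c ≡ 1 × c′ ≡ 2) ⊎ (c ≡ 2 × c′ ≡ 1)

thirds : ∀ q → 3 ∤ suc q → Thirds q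
thirds q ¬3∣p = go (q ℕ.% 3) (q ℕ./ 3) (ℕD.m≡m%n+[m/n]*n q 3) (ℕD.m%n<n q 3)
  where
  open +-*-Solver
  go : ∀ r k → q ≡ r ℕ.+ k ℕ.* 3 → r ℕ.< 3 → Thirds q
  go 0 k refl _ = record
    { n₀ = k ; n₁ = 2 ℕ.* k ; c = 1 ; c′ = 2
    ; size = solve 1 (λ k → k :+ con 2 :* k := k :* con 3) refl k
    ; balance = solve 1 (λ k → con 3 :* k :+ con 1 := con 1 :* (con 1 :+ k :* con 3)) refl k
    ; balance′ = solve 1 (λ k → con 3 :* (con 2 :* k) :+ con 2 := con 2 :* (con 1 :+ k :* con 3)) refl k
    ; orientation = inj₁ (refl , refl) }
  go 1 k refl _ = record
    { n₀ = k ; n₁ = 2 ℕ.* k ℕ.+ 1 ; c = 2 ; c′ = 1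
    ; size = solve 1 (λ k → k :+ (con 2 :* k :+ con 1) := con 1 :+ k :* con 3) refl k
    ; balance = solve 1 (λ k → con 3 :* k :+ con 2 := con 1 :* (con 1 :+ (con 1 :+ k :* con 3))) refl k
    ; balance′ = solve 1 (λ k → con 3 :* (con 2 :* k :+ con 1) :+ con 1 := con 2 :* (con 1 :+ (con 1 :+ k :* con 3))) refl k
    ; orientation = inj₂ (refl , refl) }
  go 2 k refl _ = contradiction (divides (suc k) refl) ¬3∣p
  go (suc (suc (suc _))) k _ (ℕ.s≤s (ℕ.s≤s (ℕ.s≤s ())))

-- Integrality at 3, where no numerator 3 n + 1 is divisible by the prime.

module AtThree (𝔾 : Ground) (3-prime : Prime 3) where
  open Scalars 𝔾
  open Hypergeometric 𝔾
  open Localisation 𝔾 3 3-prime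
  open Scalars.Solver 𝔾 using (solve; _:=_; _:*_; con)

  private
    y : ℕ → K
    y zero    = 1#
    y (suc n) = y n * ι (+ 3) * (inv (+ suc n) * inv (+ suc n))

    line : ℕ → K
    line zero    = 1#
    line (suc n) = line n * linear 1 n

    hyp-y : ∀ n → hyp 1 n ≡ y n * (line n * line n)
    hyp-y zero    = sym (trans (*-congˡ (*-identityˡ 1#)) (*-identityˡ 1#))
    hyp-y (suc n) = trans (*-congʳ (*-congʳ (hyp-y n)))
      (solve 4 (λ y l m i → y :* (l :* l) :* (con (+ 3) :* (m :* m)) :* i := y :* con (+ 3) :* i :* (l :* m :* (l :* m))) refl
        (y n) (line n) (linear 1 n) (inv (+ suc n) * inv (+ suc n)))

    loc-line : ∀ n → Loc (line n)
    loc-line zero    = loc-1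
    loc-line (suc n) = loc-* (loc-line n) (loc-+ (loc-* (loc-ι (+ 3)) (loc-ι (+ n))) (loc-ι (+ 1)))

    unit-residue : ∀ r m → suc r ℕ.< 3 → Unit (+ (suc r ℕ.+ m ℕ.* 3))
    unit-residue r m lt = unit (λ h → ℕP.<⇒≱ lt (∣⇒≤ (∣m+n∣m⇒∣n (subst (3 ∣_) (ℕP.+-comm (suc r) (m ℕ.* 3)) h) (n∣m*n m))))

    loc-i : ∀ r m → suc r ℕ.< 3 → Loc (inv (+ (suc r ℕ.+ m ℕ.* 3)) * inv (+ (suc r ℕ.+ m ℕ.* 3)))
    loc-i r m lt = loc-* (loc-inv (unit-residue r m lt)) (loc-inv (unit-residue r m lt))

    inv-3 : ∀ m → inv (+ (3 ℕ.+ m ℕ.* 3)) ≡ inv (+ 3) * inv (+ suc m)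
    inv-3 m = trans (sym (*-identityʳ _)) (trans (*-congˡ (sym one)) (trans (sym (*-assoc _ _ _))
      (trans (*-congʳ (trans (*-comm _ _) (ι-inv (+ (3 ℕ.+ m ℕ.* 3)) (λ ())))) (*-identityˡ _))))
      where
      one : ι (+ (3 ℕ.+ m ℕ.* 3)) * (inv (+ 3) * inv (+ suc m)) ≡ 1#
      one = trans (*-congʳ (trans (cong ι (trans (cong +_ (ℕP.*-comm (suc m) 3)) refl)) (trans (cong ι (ℤP.pos-* 3 (suc m))) (ι-* (+ 3) (+ suc m)))))
        (trans (solve 4 (λ a b x y → a :* b :* (x :* y) := a :* x :* (b :* y)) refl _ _ _ _)
          (trans (cong₂ _*_ (ι-inv (+ 3) (λ ())) (n̂-inv m)) (*-identityˡ 1#)))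

    -- 3ⁿ / n!² at 3 m is its value at m, up to a unit.
    y-triple : ∀ m → ∃[ u ] Loc u × y (m ℕ.* 3) ≡ y m * u
    y-triple zero    = 1# , loc-1 , sym (*-identityˡ 1#)
    y-triple (suc m) = go (y-triple m)
      where
      go : ∃[ u ] Loc u × y (m ℕ.* 3) ≡ y m * u → ∃[ u ] Loc u × y (suc m ℕ.* 3) ≡ y (suc m) * u
      go (u , lu , e) = u * (i 0 * i 1) , loc-* lu (loc-* (loc-i 0 m (from-yes (2 ℕ.≤? 3))) (loc-i 1 m (from-yes (3 ℕ.≤? 3)))) ,
        trans (cong₂ (λ a b → a * ι (+ 3) * i 0 * ι (+ 3) * i 1 * ι (+ 3) * (b * b)) e (inv-3 m))
          (trans (solve 7 (λ y u t i j h k → y :* u :* t :* i :* t :* j :* t :* (h :* k :* (h :* k))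
              := (t :* h) :* (t :* h) :* (y :* t :* (k :* k) :* (u :* (i :* j)))) refl (y m) u (ι (+ 3)) (i 0) (i 1) (inv (+ 3)) (inv (+ suc m)))
            (trans (*-congʳ (trans (cong (λ z → z * z) (ι-inv (+ 3) (λ ()))) (*-identityˡ 1#))) (*-identityˡ _)))
        where
        i : ℕ → K
        i r = inv (+ (suc r ℕ.+ m ℕ.* 3)) * inv (+ (suc r ℕ.+ m ℕ.* 3))

    -- Strong induction from n to n / 3. The power 3ⁿ outweighs the powers of 3 in n!²: across a
    -- multiple of 3, `y-triple` absorbs two of the three new factors, and the other denominators
    -- are prime to 3.
    loc-y : ∀ b n → n ℕ.≤ b → Loc (y n)
    loc-y b       zero    _  = loc-1
    loc-y (suc b) (suc n) le = subst (λ k → Loc (y k)) (sym (ℕD.m≡m%n+[m/n]*n (suc n) 3)) (climb (suc n ℕ.% 3) (ℕD.m%n<n (suc n) 3))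
      where
      m = suc n ℕ./ 3
      start : Loc (y (m ℕ.* 3))
      start = go (y-triple m)
        where
        go : ∃[ u ] Loc u × y (m ℕ.* 3) ≡ y m * u → Loc (y (m ℕ.* 3))
        go (u , lu , e) = subst Loc (sym e) (loc-* (loc-y b m (ℕ.s≤s⁻¹ (ℕP.<-≤-trans (ℕD.m/n<m (suc n) 3 (from-yes (2 ℕ.≤? 3))) le))) lu)
      climb : ∀ r → r ℕ.< 3 → Loc (y (r ℕ.+ m ℕ.* 3))
      climb zero    lt = start
      climb (suc r) lt = loc-* (loc-* (climb r (ℕP.<⇒≤ lt)) (loc-ι (+ 3))) (loc-i r m lt)

  hyp-integral-3 : ∀ n → Loc (hyp 1 n)
  hyp-integral-3 n = subst Loc (sym (hyp-y n)) (loc-* (loc-y n n ℕP.≤-refl) (loc-* (loc-line n) (loc-line n)))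

-- Integrality at every prime.

module Integrality (𝔾 : Ground) where
  open Scalars 𝔾
  open Values 𝔾 using (F)
  open Hypergeometric 𝔾 using (hyp)

  -- The period argument serves every prime other than 3, including 2; integrality away from p is
  -- needed at the end to make the quotient by p⁴ an integer.
  hyp-loc : ∀ p (p-prime : Prime p) n → Localisation.Loc 𝔾 p p-prime (hyp 1 n)
  hyp-loc (suc q) p-prime n = go (3 ∣? suc q)
    where
    at-3 : ∀ p (p-prime : Prime p) → 3 ≡ p → Localisation.Loc 𝔾 p p-prime (hyp 1 n)
    at-3 _ p-prime refl = AtThree.hyp-integral-3 𝔾 p-prime n
    go : Dec (3 ∣ suc q) → Localisation.Loc 𝔾 (suc q) p-prime (hyp 1 n)
    go (yes 3∣p) = only (prime⇒irreducible p-prime 3∣p)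
      where
      only : 3 ≡ 1 ⊎ 3 ≡ suc q → Localisation.Loc 𝔾 (suc q) p-prime (hyp 1 n)
      only (inj₂ e) = at-3 (suc q) p-prime e
    go (no 3∤p) = Lifting.integral-1 𝔾 q p-prime n₀ n₁ c c′ size balance balance′ orientation n
      where open Thirds (thirds q 3∤p)
  hyp-loc zero p-prime n = contradiction (Localisation.1<p 𝔾 0 p-prime) (λ ())

  F-loc : ∀ p (p-prime : Prime p) n → Localisation.Loc 𝔾 p p-prime (F n)
  F-loc p p-prime = ⊛-loc (hyp-loc p p-prime) (⊛-loc (hyp-loc p p-prime) (hyp-loc p p-prime))
    where open Representable 𝔾 p p-prime using (⊛-loc)

-- Assembly, and the primes 5 and 7.

module Supercongruence (𝔾 : Ground) where
  open Scalars 𝔾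
  open Series 𝔾
  open Hypergeometric 𝔾 hiding (rhs)
  open Values 𝔾
  open Integrality 𝔾

  module _ (p : ℕ) (p-prime : Prime p) where
    open Localisation 𝔾 p p-prime
    open Representable 𝔾 p p-prime using (⊛-loc)

    X-integral : ∀ m → Loc (X m)
    X-integral m = loc-+ (loc-+ (scaled (+ 9) (ϑ (ϑ f)) (loc-* lm (loc-* lm lf))) (scaled (+ 6) (ϑ f) (loc-* lm lf))) lf
      where
      f = hyp 1
      lm = loc-ι (+ m)
      lf = hyp-loc p p-prime m
      scaled : ∀ i u → Loc (u m) → Loc ((k i ⊛ u) m)
      scaled i u l = subst Loc (sym (const-⊛ (ι i) u m)) (loc-* (loc-ι i) l)

    β₁-integral : ∀ m → Loc (β₁ m)
    β₁-integral = ⊛-loc X-integral (⊛-loc (hyp-loc p p-prime) (hyp-loc p p-prime))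

    β₂-integral : ∀ m → Loc (β₂ m)
    β₂-integral m = subst Loc (sym (const-⊛ (ι (+ 3)) _ m)) (loc-* (loc-ι (+ 3))
      (⊛-loc (λ n → loc-* (loc-ι (+ n)) (X-integral n)) (⊛-loc (hyp-loc p p-prime) (hyp-loc p p-prime)) m))

    tabulated : ∀ m {n} q → n ℕ.≤ 21 → m ℕ.≤ 21 → Tables.A n ≡ Tables.A m ℤ.+ + p ℤ.* (+ p ℤ.* (+ p ℤ.* (+ p ℤ.* q))) → F n ≈[ 4 ] F m
    tabulated m q ln lm e = congruent (ι q) (loc-ι q) (trans (value ln) (trans (cong ι e) (trans (ι-+ _ _) (cong₂ _+_ (sym (value lm))
      (trans (ι-* _ _) (trans (*-congˡ (trans (ι-* _ _) (trans (*-congˡ (trans (ι-* _ _) (*-congˡ (ι-* _ _)))) refl)))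
        (trans (trans (sym (*-assoc ϖ ϖ _)) (trans (sym (*-assoc _ ϖ _)) (sym (*-assoc _ ϖ _)))) (*-congʳ power))))))))
      where
      open Scalars.Solver 𝔾 using (solve; _:=_; _:*_; _:^_)
      power : ϖ * ϖ * ϖ * ϖ ≡ π 4
      power = solve 1 (λ w → w :* w :* w :* w := w :* (w :* (w :* (w :* w :^ 0)))) refl ϖ

  module _ (q : ℕ) (p-prime : Prime (suc q)) (5≤p : 5 ℕ.≤ suc q) where
    private
      p = suc q
    open Localisation 𝔾 p p-prime
    open Rigidity 𝔾 p p-prime 5≤p
    open Representable 𝔾 p p-prime using (eval)

    private
      a : S
      a m = F (m ℕ.* p)

      Lift : Set
      Lift = ∃[ E ] (∃[ c₀ ] ∃[ c₁ ] ∃[ c₂ ] Loc c₀ × Loc c₁ × Loc c₂ × (∀ n → E n ≈[ 2 ] c₀ * β₁ n + ϖ * c₁ * ϑ β₁ n + c₂ * β₂ n))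
        × (∀ m → a m ≈[ 4 ] F m + π 2 * shift E m)

      lift : Lift
      lift = Lifting.lifted 𝔾 q p-prime n₀ n₁ c c′ size balance balance′ orientation 5≤p
        where
        3∤p : 3 ∤ p
        3∤p 3∣p = only (prime⇒irreducible p-prime 3∣p)
          where
          only : ¬ (3 ≡ 1 ⊎ 3 ≡ p)
          only (inj₂ e) = contradiction (subst (5 ℕ.≤_) (sym e) 5≤p) (from-no (5 ℕ.≤? 3))
        open Thirds (thirds q 3∤p)

    large : 11 ℕ.≤ p → ∀ m → a m ≈[ 4 ] F m
    large 11≤p = go lift (Stride.stride 𝔾 q p-prime cube-recurrent 5≤p (F-loc p p-prime))
      where
      go : Lift → ∃[ η ] ∃[ s ] (∀ i → Loc (η i)) × (∀ i → Loc (s i)) ×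
        (∀ m → eval 4 η (n̂ m * (n̂ m + ι (+ 1))) * a m + - (π 4 * (4th (n̂ m) * (eval 4 s (n̂ m) * shift a m)))
               ≈[ 8 ] π 4 * (4th (n̂ (suc m)) * a (suc m))) → ∀ m → a m ≈[ 4 ] F m
      go (E , (c₀ , c₁ , c₂ , l₀ , l₁ , l₂ , shape) , lifts) (η , s , lη , ls , step) =
        Large.supercongruence (F-loc p p-prime) (β₁-integral p p-prime) (β₂-integral p p-prime) a E l₀ l₁ l₂ shape lifts 11≤p η s lη ls step

    small : Unit (+ 3) → a 1 ≈[ 4 ] F 1 → a 2 ≈[ 4 ] F 2 → a 3 ≈[ 4 ] F 3 → ∀ m → a m ≈[ 4 ] F m
    small u₃ e₁ e₂ e₃ = go lift
      where
      go : Lift → ∀ m → a m ≈[ 4 ] F m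
      go (E , (c₀ , c₁ , c₂ , l₀ , l₁ , l₂ , shape) , lifts) =
        Small.supercongruence (F-loc p p-prime) (β₁-integral p p-prime) (β₂-integral p p-prime) a E l₀ l₁ l₂ shape lifts u₃ e₁ e₂ e₃

  private
    prime-below-11 : ∀ p → 5 ℕ.≤ p → ¬ 11 ℕ.≤ p → Prime p → p ≡ 5 ⊎ p ≡ 7
    prime-below-11 0  h _ _ = contradiction h (from-no (5 ℕ.≤? 0))
    prime-below-11 1  h _ _ = contradiction h (from-no (5 ℕ.≤? 1))
    prime-below-11 2  h _ _ = contradiction h (from-no (5 ℕ.≤? 2))
    prime-below-11 3  h _ _ = contradiction h (from-no (5 ℕ.≤? 3))
    prime-below-11 4  h _ _ = contradiction h (from-no (5 ℕ.≤? 4))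
    prime-below-11 5  _ _ _ = inj₁ refl
    prime-below-11 6  _ _ h = contradiction h (from-no (prime? 6))
    prime-below-11 7  _ _ _ = inj₂ refl
    prime-below-11 8  _ _ h = contradiction h (from-no (prime? 8))
    prime-below-11 9  _ _ h = contradiction h (from-no (prime? 9))
    prime-below-11 10 _ _ h = contradiction h (from-no (prime? 10))
    prime-below-11 (suc (suc (suc (suc (suc (suc (suc (suc (suc (suc (suc n))))))))))) _ h _ =
      contradiction (ℕP.m≤m+n 11 n) h

    5≤5 : 5 ℕ.≤ 5
    5≤5 = from-yes (5 ℕ.≤? 5)

    5≤7 : 5 ℕ.≤ 7
    5≤7 = from-yes (5 ℕ.≤? 7)

  supercongruence : ∀ p (p-prime : Prime p) → 5 ℕ.≤ p → ∀ m → Localisation._≈[_]_ 𝔾 p p-prime (F (m ℕ.* p)) 4 (F m)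
  supercongruence zero      p-prime 5≤p = contradiction 5≤p (from-no (5 ℕ.≤? 0))
  supercongruence p@(suc q) p-prime 5≤p = go (11 ℕ.≤? p)
    where
    at-5 : ∀ p (p-prime : Prime p) → p ≡ 5 → ∀ m → Localisation._≈[_]_ 𝔾 p p-prime (F (m ℕ.* p)) 4 (F m)
    at-5 _ p-prime refl = small 4 p-prime 5≤5 (Localisation.unit-small 𝔾 5 p-prime 2 (from-yes (4 ℕ.≤? 5)))
      -- The literals are the quotients of A_{5 m} - A_m by 5⁴ for m = 1, 2, 3; for p = 7 they are
      -- the analogous quotients by 7⁴.
      (tabulated 5 p-prime 1 (+ 1638) (from-yes (5 ℕ.≤? 21)) (from-yes (1 ℕ.≤? 21)) refl)
      (tabulated 5 p-prime 2 (+ 10490398074) (from-yes (10 ℕ.≤? 21)) (from-yes (2 ℕ.≤? 21)) refl)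
      (tabulated 5 p-prime 3 (+ 91962091568280672) (from-yes (15 ℕ.≤? 21)) (from-yes (3 ℕ.≤? 21)) refl)
    at-7 : ∀ p (p-prime : Prime p) → p ≡ 7 → ∀ m → Localisation._≈[_]_ 𝔾 p p-prime (F (m ℕ.* p)) 4 (F m)
    at-7 _ p-prime refl = small 6 p-prime 5≤7 (Localisation.unit-small 𝔾 7 p-prime 2 (from-yes (4 ℕ.≤? 7)))
      (tabulated 7 p-prime 1 (+ 211536) (from-yes (7 ℕ.≤? 21)) (from-yes (1 ℕ.≤? 21)) refl)
      (tabulated 7 p-prime 2 (+ 964959572260080) (from-yes (14 ℕ.≤? 21)) (from-yes (2 ℕ.≤? 21)) refl)
      (tabulated 7 p-prime 3 (+ 6111553490209531837684242) (from-yes (21 ℕ.≤? 21)) (from-yes (3 ℕ.≤? 21)) refl)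
    go : Dec (11 ℕ.≤ p) → ∀ m → Localisation._≈[_]_ 𝔾 p p-prime (F (m ℕ.* p)) 4 (F m)
    go (yes 11≤p) = large q p-prime 5≤p 11≤p
    go (no ¬11≤p) = decide (prime-below-11 p 5≤p ¬11≤p p-prime)
      where
      decide : p ≡ 5 ⊎ p ≡ 7 → ∀ m → Localisation._≈[_]_ 𝔾 p p-prime (F (m ℕ.* p)) 4 (F m)
      decide (inj₁ e) = at-5 p p-prime e
      decide (inj₂ e) = at-7 p p-prime e

-- Instantiation at ℚ and passage to integers.

module Rationals where

  fraction : ∀ i d .{{_ : NonZero d}} → toℚᵘ (i / d) ≃ (i ℚᵘ./ d)
  fraction i (suc d) = ℚP.toℚᵘ-fromℚᵘ (mkℚᵘ i d)

  rationals : Ground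
  rationals = record
    { K = ℚ ; _+_ = ℚ._+_ ; _*_ = ℚ._*_ ; -_ = ℚ.-_ ; 0# = 0ℚ ; 1# = 1ℚ
    ; isCR = ℚP.+-*-isCommutativeRing
    ; ι = ι
    ; ι-+ = λ i j → ℚP.toℚᵘ-injective (ℚᵘP.≃-trans (fraction (i ℤ.+ j) 1) (ℚᵘP.≃-sym (ℚᵘP.≃-trans (ℚP.toℚᵘ-homo-+ (ι i) (ι j))
        (ℚᵘP.≃-trans (ℚᵘP.+-cong (fraction i 1) (fraction j 1)) (*≡* (cong (ℤ._* + 1) (cong₂ ℤ._+_ (ℤP.*-identityʳ i) (ℤP.*-identityʳ j))))))))
    ; ι-* = ι-*
    ; ι-neg = λ i → ℚP.toℚᵘ-injective (ℚᵘP.≃-trans (fraction (ℤ.- i) 1) (ℚᵘP.≃-sym (ℚᵘP.≃-trans (ℚP.toℚᵘ-homo‿- (ι i))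
        (ℚᵘP.-‿cong (fraction i 1)))))
    ; ι-0 = refl
    ; ι-1 = refl
    ; inv = inv
    ; ι-inv = ι-inv
    }
    where
    ι : ℤ → ℚ
    ι i = i / 1
    ι-* : ∀ i j → ι (i ℤ.* j) ≡ ι i ℚ.* ι j
    ι-* i j = ℚP.toℚᵘ-injective (ℚᵘP.≃-trans (fraction (i ℤ.* j) 1) (ℚᵘP.≃-sym (ℚᵘP.≃-trans (ℚP.toℚᵘ-homo-* (ι i) (ι j))
        (ℚᵘP.*-cong (fraction i 1) (fraction j 1)))))
    inv : ℤ → ℚ
    inv (+ zero)  = 0ℚ
    inv (+ suc n) = + 1 / suc n
    inv -[1+ n ]  = -[1+ 0 ] / suc n
    ι-inv : ∀ i → i ≢ + 0 → ι i ℚ.* inv i ≡ 1ℚ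
    ι-inv (+ zero)  i≢0 = contradiction refl i≢0
    ι-inv (+ suc n) _   = ℚP.toℚᵘ-injective (ℚᵘP.≃-trans (ℚP.toℚᵘ-homo-* (ι (+ suc n)) (+ 1 / suc n))
      (ℚᵘP.≃-trans (ℚᵘP.*-cong (fraction (+ suc n) 1) (fraction (+ 1) (suc n)))
        (*≡* (trans (ℤP.*-identityʳ _) (trans (ℤP.*-comm (+ suc n) (+ 1)) (cong (λ k → + 1 ℤ.* + suc k) (sym (ℕP.+-identityʳ n))))))))
    ι-inv -[1+ n ]  _   = ℚP.toℚᵘ-injective (ℚᵘP.≃-trans (ℚP.toℚᵘ-homo-* (ι -[1+ n ]) (-[1+ 0 ] / suc n))
      (ℚᵘP.≃-trans (ℚᵘP.*-cong (fraction -[1+ n ] 1) (fraction -[1+ 0 ] (suc n)))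
        (*≡* (trans (ℤP.*-identityʳ _) (trans (ℤP.*-comm -[1+ n ] -[1+ 0 ]) (cong (λ k → + 1 ℤ.* + suc k) (sym (ℕP.+-identityʳ n))))))))

  open Scalars rationals
  open Series rationals
  open Hypergeometric rationals
  open Values rationals using (F)
  open Integrality rationals using (F-loc)
  open Supercongruence rationals using (supercongruence)
  open Scalars.Solver rationals using (solve; _:=_; _:+_; _:*_; _:-_; :-_; _:^_; con)

  -- A prime factor of the denominator would divide the numerator.
  locally-integral⇒integral : ∀ x → (∀ p (p-prime : Prime p) → Localisation.Loc rationals p p-prime x) → ∃[ z ] x ≡ ι z
  locally-integral⇒integral x@(mkℚ n d-1 coprime) l = go d-1 refl
    where
    clear : ∀ {d u} → ι d * x ≡ ι u → d ℤ.* n ≡ u ℤ.* + suc d-1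
    clear {d} {u} e = cross (ℚᵘP.≃-trans (ℚᵘP.≃-sym (ℚᵘP.≃-trans (ℚP.toℚᵘ-homo-* (ι d) x) (ℚᵘP.*-cong (fraction d 1) (ℚᵘP.≃-refl {toℚᵘ x}))))
        (ℚᵘP.≃-trans (ℚᵘP.≃-reflexive (cong toℚᵘ e)) (fraction u 1)))
      where
      cross : mkℚᵘ (d ℤ.* n) (d-1 ℕ.+ 0) ≃ mkℚᵘ u 0 → d ℤ.* n ≡ u ℤ.* + suc d-1
      cross (*≡* eq) = trans (sym (ℤP.*-identityʳ _)) (trans eq (cong (λ z → u ℤ.* + suc z) (ℕP.+-identityʳ d-1)))
    impossible : ∀ p → Prime p → ¬ p ∣ suc d-1
    impossible p p-prime p∣D = use (l p p-prime)
      where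
      use : ¬ Localisation.Loc rationals p p-prime x
      use (d , u , Localisation.unit p∤d , e) = [ p∤d , p∤n ]′ (euclidsLemma ∣ d ∣ ∣ n ∣ p-prime (subst (p ∣_) eq (∣-trans p∣D (divides ∣ u ∣ refl))))
        where
        eq : ∣ u ∣ ℕ.* suc d-1 ≡ ∣ d ∣ ℕ.* ∣ n ∣
        eq = trans (sym (ℤP.abs-* u (+ suc d-1))) (trans (cong ∣_∣ (sym (clear {d} {u} e))) (ℤP.abs-* d n))
        p∤n : ¬ p ∣ ∣ n ∣
        p∤n p∣n = ¬prime[1] (subst Prime (recompute coprime (p∣n , p∣D)) p-prime)
    go : ∀ k → k ≡ d-1 → ∃[ z ] x ≡ ι z
    go zero    refl = n , sym (ℚP.↥p/↧p≡p x)
    go (suc k) refl = contradiction (factors (factorise (suc (suc k)))) (λ h → h)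
      where
      factors : ¬ PrimeFactorisation (suc (suc k))
      factors record { factors = [] ; isFactorisation = () }
      factors record { factors = ℓ ∷ ℓs ; isFactorisation = e ; factorsPrime = pr ∷ _ } =
        impossible ℓ pr (subst (ℓ ∣_) (sym e) (m∣m*n _))

  private
    power : ℕ → S
    power c n = ι (+ (c ℕ.^ n))

    scale : ℕ → S → S
    scale c u n = power c n * u n

    ι-ℕ* : ∀ a b → ι (+ (a ℕ.* b)) ≡ ι (+ a) * ι (+ b)
    ι-ℕ* a b = trans (cong ι (ℤP.pos-* a b)) (ι-* (+ a) (+ b))

    -- The substitution t ↦ c t is a ring homomorphism; with c = 27 it carries the cube of the
    -- normalised series to F.
    scale-⊛ : ∀ c u v n → (scale c u ⊛ scale c v) n ≡ scale c (u ⊛ v) n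
    scale-⊛ c u v zero    = trans (cong₂ _*_ (*-identityˡ (u 0)) (*-identityˡ (v 0))) (sym (*-identityˡ _))
    scale-⊛ c u v (suc n) = trans
      (cong₂ _+_ (cong₂ _*_ (*-identityˡ (u 0)) (cong (_* v (suc n)) (ι-ℕ* c (c ℕ.^ n))))
        (trans (⊛-cong {v = scale c v} (λ i → trans (cong (_* u (suc i)) (ι-ℕ* c (c ℕ.^ i))) (*-assoc (ι (+ c)) (power c i) (u (suc i)))) (λ _ → refl) n)
          (trans (⊛-scaleˡ (ι (+ c)) (scale c (tail u)) (scale c v) n) (cong (ι (+ c) *_) (scale-⊛ c (tail u) v n)))))
      (trans (solve 5 (λ a c w b y → a :* (c :* w :* b) :+ c :* (w :* y) := c :* w :* (a :* b :+ y)) refl (u 0) (ι (+ c)) (power c n) (v (suc n)) ((tail u ⊛ v) n))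
        (cong (_* (u ⊛ v) (suc n)) (sym (ι-ℕ* c (c ℕ.^ n)))))

    sumUpTo-cong : ∀ n {f g : ℕ → ℚ} → (∀ {i} → i ℕ.≤ n → f i ≡ g i) → Defs.sumUpTo n f ≡ Defs.sumUpTo n g
    sumUpTo-cong zero    e = e ℕ.z≤n
    sumUpTo-cong (suc n) e = cong₂ _+_ (sumUpTo-cong n (λ le → e (ℕP.m≤n⇒m≤1+n le))) (e ℕP.≤-refl)

    cauchy-⊛ : ∀ u v n → Defs.cauchy u v n ≡ (u ⊛ v) n
    cauchy-⊛ u v zero    = refl
    cauchy-⊛ u v (suc n) = trans (cong₂ _+_
        (trans (sumUpTo-cong n (λ {i} le → cong (λ k → u i * v k) (ℕP.+-∸-assoc 1 le))) (cauchy-⊛ u (tail v) n))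
        (cong (λ k → u (suc n) * v k) (ℕP.n∸n≡0 n)))
      (trans (+-comm ((u ⊛ tail v) n) (u (suc n) * v 0)) (sym (⊛-tailʳ u v n)))

    reciprocal : ∀ d .{{_ : NonZero d}} → n̂ d * (+ 1 / d) ≡ 1#
    reciprocal (suc d) = ι-inv (+ suc d) (λ ())

    reciprocal-unique : ∀ d .{{_ : NonZero d}} {x} → n̂ d * x ≡ 1# → (+ 1 / d) ≡ x
    reciprocal-unique d {x} e = trans (sym (*-identityʳ (+ 1 / d))) (trans (cong ((+ 1 / d) *_) (sym e))
      (trans (solve 3 (λ r d x → r :* (d :* x) := d :* r :* x) refl (+ 1 / d) (n̂ d) x) (trans (cong (_* x) (reciprocal d)) (*-identityˡ x))))

    ⅓ : ℚ
    ⅓ = + 1 / 3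

    factor : ℕ → ℕ
    factor n = Defs.risingℕ 1 n ℕ.* n !

    factor-nonZero : ∀ n → NonZero (factor n)
    factor-nonZero n = ℕP.m*n≢0 _ _ {{Defs.risingℕ-nonZero 1 n}} {{n ℕP.!≢0}}

    factor-suc : ∀ n → n̂ (factor (suc n)) ≡ n̂ (factor n) * (n̂ (suc n) * n̂ (suc n))
    factor-suc n = trans (ι-ℕ* (r ℕ.* suc n) (suc n ℕ.* n !)) (trans (cong₂ _*_ (ι-ℕ* r (suc n)) (ι-ℕ* (suc n) (n !))) (trans
      (solve 3 (λ r s t → r :* s :* (s :* t) := r :* t :* (s :* s)) refl (n̂ r) (n̂ (suc n)) (n̂ (n !)))
      (cong (_* (n̂ (suc n) * n̂ (suc n))) (sym (ι-ℕ* r (n !))))))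
      where r = Defs.risingℕ 1 n

    reciprocal-factor : ∀ n → (+ 1 / factor (suc n)) {{factor-nonZero (suc n)}}
      ≡ (+ 1 / factor n) {{factor-nonZero n}} * (inv (+ suc n) * inv (+ suc n))
    reciprocal-factor n = reciprocal-unique (factor (suc n)) {{factor-nonZero (suc n)}} (trans (cong (_* (D * (i * i))) (factor-suc n))
      (trans (solve 4 (λ f s r i → f :* (s :* s) :* (r :* (i :* i)) := (f :* r) :* ((s :* i) :* (s :* i))) refl (n̂ (factor n)) (n̂ (suc n)) D i)
        (trans (cong₂ _*_ (reciprocal (factor n) {{factor-nonZero n}}) (trans (cong (λ z → z * z) (n̂-inv n)) (*-identityˡ 1#))) (*-identityˡ 1#))))
      where
      i = inv (+ suc n)
      D = (+ 1 / factor n) {{factor-nonZero n}}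

    -- One step on either side: 27 (1/3 + n)² = 3 (3 n + 1)², and both denominators grow by (n +
    -- 1)².
    hyp-F : ∀ n → scale 27 Defs.F n ≡ hyp 1 n
    hyp-F zero    = refl
    hyp-F (suc n) = trans (cong₂ (λ a b → a * (r * (⅓ + n̂ n) * (r * (⅓ + n̂ n)) * b)) (ι-ℕ* 27 (27 ℕ.^ n)) (reciprocal-factor n))
      (trans (solve 6 (λ w r h m D i → con (+ 27) :* w :* (r :* (h :+ m) :* (r :* (h :+ m)) :* (D :* i))
          := w :* (r :* r :* D) :* (con (+ 3) :* ((con (+ 3) :* m :+ con (+ 3) :* h) :* (con (+ 3) :* m :+ con (+ 3) :* h))) :* i)
          refl (power 27 n) r ⅓ (n̂ n) D (inv (+ suc n) * inv (+ suc n)))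
        (cong₂ (λ a b → a * (ι (+ 3) * ((ι (+ 3) * n̂ n + b) * (ι (+ 3) * n̂ n + b))) * (inv (+ suc n) * inv (+ suc n))) (hyp-F n) (reciprocal 3)))
      where
      r = Defs.rising ⅓ n
      D = (+ 1 / factor n) {{factor-nonZero n}}

    F-A : ∀ n → Defs.A n ≡ F n
    F-A n = sym (trans (⊛-cong f (⊛-cong f f) n) (trans (⊛-cong {u = scale 27 Defs.F} (λ _ → refl) (scale-⊛ 27 Defs.F Defs.F) n)
      (trans (scale-⊛ 27 Defs.F (Defs.F ⊛ Defs.F) n) (cong (power 27 n *_) (sym (trans (cauchy-⊛ Defs.F (Defs.cauchy Defs.F Defs.F) n)
        (⊛-cong {u = Defs.F} (λ _ → refl) (cauchy-⊛ Defs.F Defs.F) n)))))))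
      where
      f : hyp 1 ≗ scale 27 Defs.F
      f k = sym (hyp-F k)

    distinct-unit : ∀ {p ℓ} (p-prime : Prime p) (ℓ-prime : Prime ℓ) → ℓ ≢ p → Localisation.Unit rationals ℓ ℓ-prime (+ p)
    distinct-unit {p} {ℓ} p-prime ℓ-prime ℓ≢p = Localisation.unit (λ ℓ∣p → [ (λ e → ¬prime[1] (subst Prime e ℓ-prime)) , ℓ≢p ]′ (prime⇒irreducible p-prime ℓ∣p))

  congruence : (p : ℕ) → Prime p → 5 ℕ.≤ p → (m : ℕ) →
    ∃[ k ] (Defs.A (p ℕ.* m) ℚ.- Defs.A m ≡ Defs.ℕtoℚ (p ℕ.^ 4) ℚ.* (k / 1))
  congruence p p-prime 5≤p m = conclude (supercongruence p p-prime 5≤p m)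
    where
    open Localisation rationals p p-prime using (_≈[_]_; congruent; π; ϖ; Loc; π-cancel)
    conclude : F (m ℕ.* p) ≈[ 4 ] F m → ∃[ k ] (Defs.A (p ℕ.* m) ℚ.- Defs.A m ≡ Defs.ℕtoℚ (p ℕ.^ 4) ℚ.* (k / 1))
    conclude (congruent x local equation) = finish (locally-integral⇒integral x everywhere)
      where
      difference : F (m ℕ.* p) ℚ.+ ℚ.- F m ≡ π 4 ℚ.* x
      difference = trans (cong (ℚ._+ ℚ.- F m) equation) (solve 2 (λ a b → a :+ b :+ :- a := b) refl (F m) (π 4 ℚ.* x))
      i : ℚ
      i = inv (+ p)
      p≢0 : + p ≢ + 0
      p≢0 e = contradiction (subst (5 ℕ.≤_) (ℤP.+-injective e) 5≤p) (λ ())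
      recovered : x ≡ i ℚ.* (i ℚ.* (i ℚ.* (i ℚ.* (F (m ℕ.* p) ℚ.+ ℚ.- F m))))
      recovered = sym (trans (cong (λ z → i ℚ.* (i ℚ.* (i ℚ.* (i ℚ.* z)))) difference)
        (trans (solve 3 (λ i w x → i :* (i :* (i :* (i :* (w :* (w :* (w :* (w :* w :^ 0))) :* x)))) := w :* i :* (w :* i) :* (w :* i :* (w :* i)) :* x) refl i ϖ x)
          (trans (cong (λ z → z ℚ.* z ℚ.* (z ℚ.* z) ℚ.* x) (ι-inv (+ p) p≢0)) (*-identityˡ x))))
      -- At p the congruence itself provides integrality of the quotient. At any other prime,
      -- `recovered` writes it as a difference of integral coefficients divided by p⁴, and p is a
      -- unit there.
      everywhere : ∀ ℓ (ℓ-prime : Prime ℓ) → Localisation.Loc rationals ℓ ℓ-prime x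
      everywhere ℓ ℓ-prime = go (ℓ ℕ.≟ p)
        where
        open Localisation rationals ℓ ℓ-prime using (loc-*; loc-+; loc-neg; loc-inv)
        change : ∀ ℓ (ℓ-prime : Prime ℓ) → ℓ ≡ p → Localisation.Loc rationals ℓ ℓ-prime x
        change _ ℓ-prime refl = go′ local
          where
          go′ : Loc x → Localisation.Loc rationals p ℓ-prime x
          go′ (d , u , Localisation.unit h , e) = d , u , Localisation.unit h , e
        go : Dec (ℓ ≡ p) → Localisation.Loc rationals ℓ ℓ-prime x
        go (yes e)  = change ℓ ℓ-prime e
        go (no ℓ≢p) = subst (Localisation.Loc rationals ℓ ℓ-prime) (sym recovered)
          (loc-* li (loc-* li (loc-* li (loc-* li (loc-+ (F-loc ℓ ℓ-prime (m ℕ.* p)) (loc-neg (F-loc ℓ ℓ-prime m)))))))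
          where li = loc-inv (distinct-unit p-prime ℓ-prime ℓ≢p)
      π-4 : π 4 ≡ ι (+ (p ℕ.^ 4))
      π-4 = sym (trans (ι-ℕ* p _) (cong (ϖ ℚ.*_) (trans (ι-ℕ* p _) (cong (ϖ ℚ.*_) (trans (ι-ℕ* p _) (cong (ϖ ℚ.*_) (ι-ℕ* p 1)))))))
      finish : ∃[ z ] x ≡ ι z → ∃[ k ] (Defs.A (p ℕ.* m) ℚ.- Defs.A m ≡ Defs.ℕtoℚ (p ℕ.^ 4) ℚ.* (k / 1))
      finish (z , x≡z) = z , trans (cong₂ (λ a b → a ℚ.+ ℚ.- b) (trans (cong Defs.A (ℕP.*-comm p m)) (F-A (m ℕ.* p))) (F-A m))
        (trans difference (cong₂ ℚ._*_ π-4 x≡z))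

open import Defs
open import Data.Nat using (ℕ; _≤_; _*_; _^_)
open import Data.Nat.Primality using (Prime)
open import Data.Integer using (ℤ)
open import Data.Rational using (ℚ; _-_; _/_) renaming (_*_ to _*ℚ_)
open import Data.Product using (∃-syntax)
open import Relation.Binary.PropositionalEquality using (_≡_)

theorem7p6 : (p : ℕ) → Prime p → 5 ≤ p → (m : ℕ) → 1 ≤ m →
    ∃[ k ] (A (p * m) - A m ≡ ℕtoℚ (p ^ 4) *ℚ (k / 1))
theorem7p6 p p-prime 5≤p m _ = Rationals.congruence p p-prime 5≤p m
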